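{- Let $\mathcal{P}$ be a vertex problem expressible in $MSO_1$ logic and let $\Phi$ be an $MSO_1$ formula for this problem (in prenex normal form) with $q$ quantified variables, $q_v$ of which are individual (vertex) variables. Then there exists a monotone dynamic programming core $\mathfrak{C}$ which, together with a suitable $\mathfrak{C}$-vertex-membership function $\rho$, solves $\mathcal{P}$, and such that for every cliquewidth decomposition $\mathcal{D}$ of width $\omega$, \[\tau(\mathfrak{C},\mathcal{D})=|V(\mathcal{D})|\cdot T_{q+1}\big(\mathcal{O}(q_v(q+\log\omega))\big),\qquad Size_{\mathfrak{C},\mathcal{D}}=T_{q}\big(\mathcal{O}(q_v(q+\log\omega))\big),\] where $T_h(x)$ denotes a tower of exponentials $2^{2^{\cdot^{\cdot^{2^{x}}}}}$ with $h$ twos.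
   Context: All graphs are finite, simple and undirected. A vertex problem is a set of pairs $(G,S)$ with $S\subseteq V(G)$. $MSO_1$ is monadic second-order logic over graphs with the vertex set as universe: formulas use logical connectives, variables for single vertices (individual variables) and for sets of vertices (set variables), quantification over both, and predicates for membership, equality and adjacency. A vertex problem $\mathcal{P}$ is expressible in $MSO_1$ if there is an $MSO_1$ formula $\Phi(S)$ with one free set variable such that $(G,S)\in\mathcal{P}$ iff $G\models\Phi(S)$. Cliquewidth decomposition: a rooted tree $\mathcal{D}$ of width $\omega$ in which every node $t$ is $intro(v,a)$ with $a\in[\omega]$ (a leaf; builds the one-vertex graph with vertex $v$ of color $a$; write $t=Leaf_{\mathcal{D}}(v)$), $t_1\oplus t_2$ (disjoint union of the colored graphs of the two children), $recolor(t',a\to b)$ or $addEdges(t',a,b)$ (add all edges between colors $a$ and $b$). $\delta(t)$ is the number of children; $\mathcal{D}$ is a decomposition of $G$ if $G$ is isomorphic to the graph built at the root. A dynamic programming core is an algorithm $\mathfrak{C}$ that, given a cliquewidth decomposition $\mathcal{D}$ of $G$, produces a finite set $Accept_{\mathfrak{C},\mathcal{D}}\subseteq\{0,1\}^*$ and for each node $t$ a finite set $Process_{\mathfrak{C},\mathcal{D}}(t)\subseteq(\{0,1\}^*)^{\delta(t)+1}$; $\tau(\mathfrak{C},\mathcal{D})$ is the time to construct these data and $Size_{\mathfrak{C},\mathcal{D}}=\max_t|Process_{\mathfrak{C},\mathcal{D}}(t)|$. A $(\mathfrak{C},\mathcal{D})$-witness is a map $\alpha:V(\mathcal{D})\to\{0,1\}^*$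 with $(\alpha(t),\alpha(t_1),\dots,\alpha(t_{\delta(t)}))\in Process_{\mathfrak{C},\mathcal{D}}(t)$ for every node $t$ with children $t_1,\dots,t_{\delta(t)}$ and $\alpha(\text{root})\in Accept_{\mathfrak{C},\mathcal{D}}$. The pair $(\mathfrak{C},\rho)$ with $\rho:\{0,1\}^*\to\{0,1\}$ solves $\mathcal{P}$ (and $\mathfrak{C}$ is then called monotone, $\rho$ a $\mathfrak{C}$-vertex-membership function) if for every graph $G$, every cliquewidth decomposition $\mathcal{D}$ of $G$ and every $S\subseteq V(G)$: $(G,S)\in\mathcal{P}$ iff there is a $(\mathfrak{C},\mathcal{D})$-witness $\alpha$ with $S=\{v:\rho(\alpha(Leaf_{\mathcal{D}}(v)))=1\}$. -}

module Defs where

open import Data.Bool using (Bool; true; false)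
import Data.Bool.Properties as Bool
open import Data.Fin using (Fin; toℕ)
import Data.Fin.Properties as Fin
open import Data.Fin.Subset using (Subset; _∈_)
open import Data.List using (List; []; _∷_; _++_; map; length; deduplicate)
open import Data.List.Extrema.Nat using (max)
import Data.List.Membership.Propositional as List
import Data.List.Properties as List
open import Data.Nat using (ℕ; zero; suc; _+_; _*_; _^_)
open import Data.Nat.Logarithm using (⌈log₂_⌉)
open import Data.Product using (Σ; ∃-syntax; _×_)
open import Data.Sum using (_⊎_; inj₁; inj₂)
open import Data.Unit using (⊤)
open import Data.Vec using (Vec; []; _∷_; lookup; toList)
import Data.Vec as Vec
import Data.Vec.Properties as Vec
open import Function.Bundles using (_⇔_; _↔_; Inverse)
open import Relation.Binary.Definitions using (DecidableEquality)
open import Relation.Binary.PropositionalEquality using (_≡_; _≢_)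
open import Relation.Nullary using (¬_; yes; no)

------------------------------------------------------------------------
-- Graphs and vertex problems

record Graph : Set where
  field
    order   : ℕ
    adj     : Fin order → Fin order → Bool
    adj-sym : ∀ u v → adj u v ≡ adj v u
    adj-irr : ∀ u → adj u u ≡ false

  V : Set
  V = Fin order

  Adj : V → V → Set
  Adj u v = adj u v ≡ true

VertexProblem : Set₁
VertexProblem = (G : Graph) → Subset (Graph.order G) → Set

------------------------------------------------------------------------
-- MSO₁

-- `Formula i s` has i free individual variables and s free set variables,
-- both written as de Bruijn indices.
data Formula (i s : ℕ) : Set where
  _≐_     : Fin i → Fin i → Formula i s
  adjᶠ    : Fin i → Fin i → Formula i s
  _∈ᶠ_    : Fin i → Fin s → Formula i s
  ¬ᶠ_     : Formula i s → Formula i s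
  _∧ᶠ_    : Formula i s → Formula i s → Formula i s
  _∨ᶠ_    : Formula i s → Formula i s → Formula i s
  _⇒ᶠ_    : Formula i s → Formula i s → Formula i s
  _⇔ᶠ_    : Formula i s → Formula i s → Formula i s
  ∃v_ ∀v_ : Formula (suc i) s → Formula i s
  ∃s_ ∀s_ : Formula i (suc s) → Formula i s

module _ (G : Graph) where
  open Graph G

  ⟦_⟧ : ∀ {i s} → Formula i s → Vec V i → Vec (Subset order) s → Set
  ⟦ x ≐ y ⟧    ρ σ = lookup ρ x ≡ lookup ρ y
  ⟦ adjᶠ x y ⟧ ρ σ = Adj (lookup ρ x) (lookup ρ y)
  ⟦ x ∈ᶠ X ⟧   ρ σ = lookup ρ x ∈ lookup σ X
  ⟦ ¬ᶠ φ ⟧     ρ σ = ¬ ⟦ φ ⟧ ρ σ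
  ⟦ φ ∧ᶠ ψ ⟧   ρ σ = ⟦ φ ⟧ ρ σ × ⟦ ψ ⟧ ρ σ
  ⟦ φ ∨ᶠ ψ ⟧   ρ σ = ⟦ φ ⟧ ρ σ ⊎ ⟦ ψ ⟧ ρ σ
  ⟦ φ ⇒ᶠ ψ ⟧   ρ σ = ⟦ φ ⟧ ρ σ → ⟦ ψ ⟧ ρ σ
  ⟦ φ ⇔ᶠ ψ ⟧   ρ σ = ⟦ φ ⟧ ρ σ ⇔ ⟦ ψ ⟧ ρ σ
  ⟦ ∃v φ ⟧     ρ σ = Σ V λ v → ⟦ φ ⟧ (v ∷ ρ) σ
  ⟦ ∀v φ ⟧     ρ σ = (v : V) → ⟦ φ ⟧ (v ∷ ρ) σ
  ⟦ ∃s φ ⟧     ρ σ = Σ (Subset order) λ X → ⟦ φ ⟧ ρ (X ∷ σ)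
  ⟦ ∀s φ ⟧     ρ σ = (X : Subset order) → ⟦ φ ⟧ ρ (X ∷ σ)

_Expresses_ : Formula 0 1 → VertexProblem → Set
Φ Expresses P = ∀ G S → P G S ⇔ ⟦_⟧ G Φ [] (S ∷ [])

data QuantifierFree {i s} : Formula i s → Set where
  eq  : ∀ {x y} → QuantifierFree (x ≐ y)
  adj : ∀ {x y} → QuantifierFree (adjᶠ x y)
  mem : ∀ {x X} → QuantifierFree (x ∈ᶠ X)
  neg : ∀ {φ} → QuantifierFree φ → QuantifierFree (¬ᶠ φ)
  and : ∀ {φ ψ} → QuantifierFree φ → QuantifierFree ψ → QuantifierFree (φ ∧ᶠ ψ)
  or  : ∀ {φ ψ} → QuantifierFree φ → QuantifierFree ψ → QuantifierFree (φ ∨ᶠ ψ)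
  imp : ∀ {φ ψ} → QuantifierFree φ → QuantifierFree ψ → QuantifierFree (φ ⇒ᶠ ψ)
  iff : ∀ {φ ψ} → QuantifierFree φ → QuantifierFree ψ → QuantifierFree (φ ⇔ᶠ ψ)

data Prenex {i s} : Formula i s → Set where
  matrix : ∀ {φ} → QuantifierFree φ → Prenex φ
  ∃v_    : ∀ {φ} → Prenex φ → Prenex (∃v φ)
  ∀v_    : ∀ {φ} → Prenex φ → Prenex (∀v φ)
  ∃s_    : ∀ {φ} → Prenex φ → Prenex (∃s φ)
  ∀s_    : ∀ {φ} → Prenex φ → Prenex (∀s φ)

#individual #set : ∀ {i s} → Formula i s → ℕ
#individual (_ ≐ _)    = 0
#individual (adjᶠ _ _) = 0
#individual (_ ∈ᶠ _)   = 0
#individual (¬ᶠ φ)     = #individual φ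
#individual (φ ∧ᶠ ψ)   = #individual φ + #individual ψ
#individual (φ ∨ᶠ ψ)   = #individual φ + #individual ψ
#individual (φ ⇒ᶠ ψ)   = #individual φ + #individual ψ
#individual (φ ⇔ᶠ ψ)   = #individual φ + #individual ψ
#individual (∃v φ)     = suc (#individual φ)
#individual (∀v φ)     = suc (#individual φ)
#individual (∃s φ)     = #individual φ
#individual (∀s φ)     = #individual φ

#set (_ ≐ _)    = 0
#set (adjᶠ _ _) = 0
#set (_ ∈ᶠ _)   = 0
#set (¬ᶠ φ)     = #set φ
#set (φ ∧ᶠ ψ)   = #set φ + #set ψ
#set (φ ∨ᶠ ψ)   = #set φ + #set ψ
#set (φ ⇒ᶠ ψ)   = #set φ + #set ψ
#set (φ ⇔ᶠ ψ)   = #set φ + #set ψ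
#set (∃v φ)     = #set φ
#set (∀v φ)     = #set φ
#set (∃s φ)     = suc (#set φ)
#set (∀s φ)     = suc (#set φ)

#quantified : ∀ {i s} → Formula i s → ℕ
#quantified φ = #individual φ + #set φ

------------------------------------------------------------------------
-- Cliquewidth decompositions

-- The vertex v of a node intro(v,a) is that leaf itself, so that _⊕_ is
-- literally a disjoint union; the identification of leaves with the vertices
-- of a given graph is the isomorphism in `_DecompositionOf_`.
data Decomp (ω : ℕ) : Set where
  intro    : (a : Fin ω) → Decomp ω
  _⊕_      : (t₁ t₂ : Decomp ω) → Decomp ω
  recolor  : (t : Decomp ω) (a b : Fin ω) → Decomp ω
  addEdges : (t : Decomp ω) (a b : Fin ω) → Decomp ω

module _ {ω : ℕ} where

  Vertex : Decomp ω → Set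
  Vertex (intro a)        = ⊤
  Vertex (t₁ ⊕ t₂)        = Vertex t₁ ⊎ Vertex t₂
  Vertex (recolor t a b)  = Vertex t
  Vertex (addEdges t a b) = Vertex t

  color : (D : Decomp ω) → Vertex D → Fin ω
  color (intro a)        _        = a
  color (t₁ ⊕ t₂)        (inj₁ v) = color t₁ v
  color (t₁ ⊕ t₂)        (inj₂ v) = color t₂ v
  color (recolor t a b)  v with color t v Fin.≟ a
  ... | yes _ = b
  ... | no  _ = color t v
  color (addEdges t a b) v        = color t v

  data Edge : (D : Decomp ω) → Vertex D → Vertex D → Set where
    inˡ   : ∀ {t₁ t₂ u v} → Edge t₁ u v → Edge (t₁ ⊕ t₂) (inj₁ u) (inj₁ v)
    inʳ   : ∀ {t₁ t₂ u v} → Edge t₂ u v → Edge (t₁ ⊕ t₂) (inj₂ u) (inj₂ v)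
    inRec : ∀ {t a b u v} → Edge t u v → Edge (recolor t a b) u v
    inAdd : ∀ {t a b u v} → Edge t u v → Edge (addEdges t a b) u v
    -- u ≢ v only matters when a ≡ b; it keeps the graph loopless.
    new   : ∀ {t a b u v} → u ≢ v → color t u ≡ a → color t v ≡ b →
            Edge (addEdges t a b) u v
    new′  : ∀ {t a b u v} → u ≢ v → color t u ≡ b → color t v ≡ a →
            Edge (addEdges t a b) u v

  record _DecompositionOf_ (D : Decomp ω) (G : Graph) : Set where
    open Graph G
    field
      vertices : V ↔ Vertex D

    at : V → Vertex D
    at = Inverse.to vertices

    field
      edges : ∀ u v → Adj u v ⇔ Edge D (at u) (at v)

  data Node : Decomp ω → Set where
    root  : ∀ {D} → Node D
    left  : ∀ {t₁ t₂} → Node t₁ → Node (t₁ ⊕ t₂)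
    right : ∀ {t₁ t₂} → Node t₂ → Node (t₁ ⊕ t₂)
    inRec : ∀ {t a b} → Node t → Node (recolor t a b)
    inAdd : ∀ {t a b} → Node t → Node (addEdges t a b)

  δ : ∀ {D} → Node D → ℕ
  δ {intro _}        root      = 0
  δ {_ ⊕ _}          root      = 2
  δ {recolor _ _ _}  root      = 1
  δ {addEdges _ _ _} root      = 1
  δ                  (left t)  = δ t
  δ                  (right t) = δ t
  δ                  (inRec t) = δ t
  δ                  (inAdd t) = δ t

  children : ∀ {D} (t : Node D) → Vec (Node D) (δ t)
  children {intro _}        root      = []
  children {_ ⊕ _}          root      = left root ∷ right root ∷ []
  children {recolor _ _ _}  root      = inRec root ∷ []
  children {addEdges _ _ _} root      = inAdd root ∷ []
  children                  (left t)  = Vec.map left (children t)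
  children                  (right t) = Vec.map right (children t)
  children                  (inRec t) = Vec.map inRec (children t)
  children                  (inAdd t) = Vec.map inAdd (children t)

  leaf : (D : Decomp ω) → Vertex D → Node D
  leaf (intro a)        _        = root
  leaf (t₁ ⊕ t₂)        (inj₁ v) = left (leaf t₁ v)
  leaf (t₁ ⊕ t₂)        (inj₂ v) = right (leaf t₂ v)
  leaf (recolor t a b)  v        = inRec (leaf t v)
  leaf (addEdges t a b) v        = inAdd (leaf t v)

  -- All nodes, in postorder.
  nodes : (D : Decomp ω) → List (Node D)
  nodes (intro a)        = root ∷ []
  nodes (t₁ ⊕ t₂)        = map left (nodes t₁) ++ map right (nodes t₂) ++ root ∷ []
  nodes (recolor t a b)  = map inRec (nodes t) ++ root ∷ []
  nodes (addEdges t a b) = map inAdd (nodes t) ++ root ∷ []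

  #nodes : Decomp ω → ℕ
  #nodes D = length (nodes D)

------------------------------------------------------------------------
-- The model of computation
--
-- Programs on binary trees in the style of Jones' WHILE language ("Computability
-- and Complexity", MIT Press 1997), with a single implicit store: a program maps
-- a tree to a tree, and each construct costs one unit plus the cost of its
-- parts.  Trees are immutable pointer structures, so copying a tree (`here`)
-- and `cons` take constant time on a random access machine; the language is
-- Turing complete, and `nil` counts as false, every other tree as true.

data Tree : Set where
  nil : Tree
  _∙_ : Tree → Tree → Tree

infixr 5 _∙_

head tail : Tree → Tree
head nil     = nil
head (x ∙ _) = x
tail nil     = nil
tail (_ ∙ y) = y

data Program : Set where
  here empty hd tl : Program
  cons             : Program → Program → Program
  _⨾_              : Program → Program → Program
  if_then_else_    : Program → Program → Program → Program
  while_loop_      : Program → Program → Program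

infixr 4 _⨾_
infix  2 _⊢_⇓_#_

-- p ⊢ x ⇓ y # n : on input x the program p halts with output y in time n.
data _⊢_⇓_#_ : Program → Tree → Tree → ℕ → Set where
  here  : ∀ {x} → here  ⊢ x ⇓ x      # 1
  empty : ∀ {x} → empty ⊢ x ⇓ nil    # 1
  hd    : ∀ {x} → hd    ⊢ x ⇓ head x # 1
  tl    : ∀ {x} → tl    ⊢ x ⇓ tail x # 1
  cons  : ∀ {p q x y z m n} →
          p ⊢ x ⇓ y # m → q ⊢ x ⇓ z # n →
          cons p q ⊢ x ⇓ y ∙ z # suc (m + n)
  seq   : ∀ {p q x y z m n} →
          p ⊢ x ⇓ y # m → q ⊢ y ⇓ z # n →
          p ⨾ q ⊢ x ⇓ z # suc (m + n)
  then  : ∀ {b p q x l r y m n} →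
          b ⊢ x ⇓ l ∙ r # m → p ⊢ x ⇓ y # n →
          if b then p else q ⊢ x ⇓ y # suc (m + n)
  else  : ∀ {b p q x y m n} →
          b ⊢ x ⇓ nil # m → q ⊢ x ⇓ y # n →
          if b then p else q ⊢ x ⇓ y # suc (m + n)
  stop  : ∀ {b p x m} →
          b ⊢ x ⇓ nil # m →
          while b loop p ⊢ x ⇓ x # suc m
  loop  : ∀ {b p x l r y z m n k} →
          b ⊢ x ⇓ l ∙ r # m → p ⊢ x ⇓ y # n → while b loop p ⊢ y ⇓ z # k →
          while b loop p ⊢ x ⇓ z # suc (m + n + k)

Bits : Set
Bits = List Bool

encList : {A : Set} → (A → Tree) → List A → Tree
encList f []       = nil
encList f (x ∷ xs) = f x ∙ encList f xs

encBool : Bool → Tree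
encBool false = nil
encBool true  = nil ∙ nil

encBits : Bits → Tree
encBits = encList encBool

encℕ : ℕ → Tree
encℕ zero    = nil
encℕ (suc n) = nil ∙ encℕ n

encFin : ∀ {n} → Fin n → Tree
encFin i = encℕ (toℕ i)

encDecomp : ∀ {ω} → Decomp ω → Tree
encDecomp (intro a)        = encℕ 0 ∙ encFin a
encDecomp (t₁ ⊕ t₂)        = encℕ 1 ∙ encDecomp t₁ ∙ encDecomp t₂
encDecomp (recolor t a b)  = encℕ 2 ∙ encDecomp t ∙ encFin a ∙ encFin b
encDecomp (addEdges t a b) = encℕ 3 ∙ encDecomp t ∙ encFin a ∙ encFin b

encInput : ∀ {ω} → Decomp ω → Tree
encInput {ω} D = encℕ ω ∙ encDecomp D

-- The sets Process(t) are output as a list over the nodes t in postorder.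
encOutput : ∀ {ω} (D : Decomp ω) →
            List Bits → ((t : Node D) → List (Vec Bits (suc (δ t)))) → Tree
encOutput D accept process =
  encList encBits accept ∙
  encList (λ t → encList (λ w → encList encBits (toList w)) (process t)) (nodes D)

------------------------------------------------------------------------
-- Dynamic programming cores

-- Finite sets are given as lists, in which repetitions are allowed.
record Core : Set where
  field
    program : Program
    accept  : ∀ {ω} → Decomp ω → List Bits
    process : ∀ {ω} (D : Decomp ω) (t : Node D) → List (Vec Bits (suc (δ t)))
    τ       : ∀ {ω} → Decomp ω → ℕ
    runs    : ∀ {ω} (D : Decomp ω) →
              program ⊢ encInput D ⇓ encOutput D (accept D) (process D) # τ D

  _≟_ : ∀ {n} → DecidableEquality (Vec Bits n)
  _≟_ = Vec.≡-dec (List.≡-dec Bool._≟_)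

  Size : ∀ {ω} → Decomp ω → ℕ
  Size D = max 0 (map (λ t → length (deduplicate _≟_ (process D t))) (nodes D))

  record Witness {ω} (D : Decomp ω) (α : Node D → Bits) : Set where
    field
      local  : ∀ t → (α t ∷ Vec.map α (children t)) List.∈ process D t
      global : α root List.∈ accept D

open Core public using (τ; Size; Witness)

Solves : Core → (Bits → Bool) → VertexProblem → Set
Solves C ρ P =
  ∀ (G : Graph) {ω} (D : Decomp ω) (iso : D DecompositionOf G)
    (S : Subset (Graph.order G)) →
  let open _DecompositionOf_ iso in
  P G S ⇔
  (∃[ α ] Witness C D α × (∀ v → v ∈ S ⇔ ρ (α (leaf D (at v))) ≡ true))

------------------------------------------------------------------------
-- Bounds

tower : ℕ → ℕ → ℕ
tower zero    x = x
tower (suc h) x = 2 ^ tower h x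

-- q_v (q + log ω)
parameter : ∀ {i s} → Formula i s → ℕ → ℕ
parameter Φ ω = #individual Φ * (#quantified Φ + ⌈log₂ ω ⌉)

{-# OPTIONS --safe #-}

-- A core sees the whole decomposition, so at a node t it knows which pairs of colours get joined
-- above t, and the final adjacency within the graph of t is determined.  The state of t for a set S
-- is the type of the formula there.  At a quantifier the type is the set of the types obtained from
-- the values inside t, together with the type for a vertex that stays outside; at the matrix it
-- consists of the colours and atoms of the variables inside, or of a mere truth value if all of
-- them are inside.  Types are compositional: recolouring is a union with the empty structure, whose
-- type is nil.
--
-- Put L₀ = O(q_v (q + log ω)) and L_{j+1} = 2 ^ (3 L_j).  With j quantifiers left there are at most
-- L_j types if all variables are inside and at most 2 ^ L_j otherwise.  Hence there are at most L_q
-- states, which is T_q (O(q_v (q + log ω))).  A process lists all pairs of states of the children,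
-- in time (L_q) ^ O(L_q), far below T_{q+1}.
module Submission where

open import Defs
open import Data.Bool using (Bool; true; false; _∧_; _∨_; not; T)
open import Data.Empty using (⊥; ⊥-elim)
open import Data.Fin using (Fin; zero; suc; toℕ; remQuot; combine; splitAt; _↑ˡ_; _↑ʳ_)
import Data.Fin.Properties as Fin
open import Data.Fin.Subset using (Subset) renaming (_∈_ to _∈ₛ_)
open import Data.List using (List; []; _∷_; _++_; _ʳ++_; reverse; foldr; map; length)
open import Data.List.Extrema.Nat using (max≤v⁺)
open import Data.List.Membership.Propositional using () renaming (_∈_ to _∈ₗ_)
import Data.List.Properties as List
open import Data.List.Relation.Unary.All as All using (All; []; _∷_)
import Data.List.Relation.Unary.All.Properties as All
open import Data.List.Relation.Unary.Any using () renaming (here to hereₗ; there to thereₗ)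
open import Data.Maybe using (Maybe; just; nothing; is-just; maybe′)
open import Data.Nat
open import Data.Nat.Induction using (<-rec)
open import Data.Nat.Logarithm using (⌈log₂_⌉; ⌈log₂⌉-mono-≤; ⌈log₂⌈n/2⌉⌉≡⌈log₂n⌉∸1)
open import Data.Nat.Properties
open import Data.Nat.Tactic.RingSolver using (solve-∀)
open import Data.Product using (∃-syntax; _×_; _,_; proj₁; proj₂; uncurry)
open import Data.Sum using (_⊎_; inj₁; inj₂; [_,_]′)
open import Data.Unit using (⊤; tt)
open import Data.Vec using (Vec; []; _∷_; lookup; tabulate)
import Data.Vec as Vec
import Data.Vec.Properties as Vec
open import Function using (_∘_; _⇔_; mk⇔; Equivalence)
open import Function.Bundles using (Inverse)
open import Relation.Binary.PropositionalEquality
open import Relation.Nullary using (¬_; Dec; yes; no; does)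

-- Programs with bounded loops, and their cost

-- One constant must serve all formulas, although the program depends on the formula. Hence the cost
-- analysis has two parameters: `B` bounds every list that is folded over and every call of a
-- primitive, and the time is at most `B ^ deg`, where `deg` depends on the program text alone. With
-- ℓ = L_q, `B` is 1024 ℓ², and the degree is linear in the numbers of quantifiers, variables and
-- atoms, hence at most 750 ℓ. So a node costs 2 ^ O(ℓ²). The square and the factor 3 in every
-- exponent of L_j are absorbed together: a constant multiple of the square of L_j stays below the
-- tower, and this invariant survives exponentiation.
--
-- Sets of types must also be countable objects. They are sublists of one fixed list of all
-- conceivable types, which is what bounds the number of states. The price is that the program also
-- runs on states that describe no structure. For the time bound these need an induction of their
-- own; a witness never takes such values, because its values are forced from the leaves upwards.

record Primitive : Set where
  field
    prog  : Program
    fun   : Tree → Tree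
    time  : Tree → ℕ
    exec  : ∀ x → ∃[ n ] (n ≤ time x × (prog ⊢ x ⇓ fun x # n))

infixr 4 _▸_

-- A language without `while`, so that its meaning is a total function. The only recursion is a fold
-- along the right spine of a tree; recursions into both subtrees enter as `primᶜ` with their own
-- time bounds. `boxᶜ` changes neither program nor value and only marks a part whose degree is
-- estimated separately.
data Code : Set where
  itᶜ nilᶜ hdᶜ tlᶜ : Code
  consᶜ _▸_        : Code → Code → Code
  ifᶜ              : Code → Code → Code → Code
  foldᶜ            : Code → Code
  primᶜ            : Primitive → Code
  boxᶜ             : Code → Code

mutual
  run : Code → Tree → Tree
  run itᶜ         x = x
  run nilᶜ        x = nil
  run hdᶜ         x = head x
  run tlᶜ         x = tail x
  run (consᶜ p q) x = run p x ∙ run q x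
  run (p ▸ q)     x = run q (run p x)
  run (ifᶜ b p q) x = branch (run b x) (run p x) (run q x)
  run (foldᶜ s)   x = runFold s (head x) (head (tail x)) (tail (tail x))
  run (primᶜ p)   x = Primitive.fun p x
  run (boxᶜ p)    x = run p x

  branch : Tree → Tree → Tree → Tree
  branch nil     x y = y
  branch (_ ∙ _) x y = x

  runFold : Code → Tree → Tree → Tree → Tree
  runFold s nil     a e = a
  runFold s (x ∙ l) a e = runFold s l (run s (x ∙ a ∙ e)) e

foldLoop : Program → Program
foldLoop p = while hd loop cons (hd ⨾ tl) (cons (cons (hd ⨾ hd) tl ⨾ p) (tl ⨾ tl))

⌜_⌝ : Code → Program
⌜ itᶜ ⌝       = here
⌜ nilᶜ ⌝      = empty
⌜ hdᶜ ⌝       = hd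
⌜ tlᶜ ⌝       = tl
⌜ consᶜ p q ⌝ = cons ⌜ p ⌝ ⌜ q ⌝
⌜ p ▸ q ⌝     = ⌜ p ⌝ ⨾ ⌜ q ⌝
⌜ ifᶜ b p q ⌝ = if ⌜ b ⌝ then ⌜ p ⌝ else ⌜ q ⌝
-- Rebuilding the input gives it the shape list, accumulator, environment required by the loop
-- invariant, even where the input is `nil`.
⌜ foldᶜ s ⌝   = cons hd (cons (tl ⨾ hd) (tl ⨾ tl)) ⨾ foldLoop ⌜ s ⌝ ⨾ tl ⨾ hd
⌜ primᶜ p ⌝   = Primitive.prog p
⌜ boxᶜ p ⌝    = ⌜ p ⌝

len : Tree → ℕ
len nil     = 0
len (_ ∙ l) = suc (len l)

mutual
  -- The one side condition of the time bound: along the run on this input, folds have at most `B`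
  -- rounds and primitives take time at most `B`. Sizes of accumulators and intermediate trees need
  -- no control, since trees are copied in constant time.
  Fits : ℕ → Code → Tree → Set
  Fits B itᶜ         x = ⊤
  Fits B nilᶜ        x = ⊤
  Fits B hdᶜ         x = ⊤
  Fits B tlᶜ         x = ⊤
  Fits B (consᶜ p q) x = Fits B p x × Fits B q x
  Fits B (p ▸ q)     x = Fits B p x × Fits B q (run p x)
  Fits B (ifᶜ b p q) x = Fits B b x × FitsBranch B (run b x) p q x
  Fits B (foldᶜ s)   x = len (head x) ≤ B × FitsFold B s (head x) (head (tail x)) (tail (tail x))
  Fits B (primᶜ p)   x = Primitive.time p x ≤ B
  Fits B (boxᶜ p)    x = Fits B p x

  FitsBranch : ℕ → Tree → Code → Code → Tree → Set
  FitsBranch B nil     p q x = Fits B q x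
  FitsBranch B (_ ∙ _) p q x = Fits B p x

  FitsFold : ℕ → Code → Tree → Tree → Tree → Set
  FitsFold B s nil     a e = ⊤
  FitsFold B s (x ∙ l) a e = Fits B s (x ∙ a ∙ e) × FitsFold B s l (run s (x ∙ a ∙ e)) e

-- The exponent of `B` in the running time. One extra factor absorbs the sum of the costs of the
-- parts; a fold takes two, one for the number of rounds and one for the constant overhead.
deg : Code → ℕ
deg itᶜ         = 0
deg nilᶜ        = 0
deg hdᶜ         = 0
deg tlᶜ         = 0
deg (consᶜ p q) = suc (deg p ⊔ deg q)
deg (p ▸ q)     = suc (deg p ⊔ deg q)
deg (ifᶜ b p q) = suc (deg b ⊔ (deg p ⊔ deg q))
deg (foldᶜ s)   = 2 + deg s
deg (primᶜ p)   = 1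
deg (boxᶜ p)    = deg p

-- The height above the boxes, which must be bounded separately.
height : Code → ℕ
height itᶜ         = 0
height nilᶜ        = 0
height hdᶜ         = 0
height tlᶜ         = 0
height (consᶜ p q) = suc (height p ⊔ height q)
height (p ▸ q)     = suc (height p ⊔ height q)
height (ifᶜ b p q) = suc (height b ⊔ (height p ⊔ height q))
height (foldᶜ s)   = 2 + height s
height (primᶜ p)   = 1
height (boxᶜ p)    = 0

boxes : Code → List Code
boxes (consᶜ p q) = boxes p ++ boxes q
boxes (p ▸ q)     = boxes p ++ boxes q
boxes (ifᶜ b p q) = boxes b ++ (boxes p ++ boxes q)
boxes (foldᶜ s)   = boxes s
boxes (boxᶜ p)    = p ∷ []
boxes _           = []

⊔-lub-+ : ∀ {a b m n d} → a ≤ m + d → b ≤ n + d → a ⊔ b ≤ m ⊔ n + d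
⊔-lub-+ {m = m} {n} {d} p q =
  ⊔-lub (≤-trans p (+-monoˡ-≤ d (m≤m⊔n m n))) (≤-trans q (+-monoˡ-≤ d (m≤n⊔m m n)))

-- Separates the fixed skeleton of a code, whose height is a numeral found by evaluation, from the
-- boxed parts, which depend on the formula and are bounded by induction.
deg≤height : ∀ {d} c → All (λ p → deg p ≤ d) (boxes c) → deg c ≤ height c + d
deg≤height itᶜ         h = z≤n
deg≤height nilᶜ        h = z≤n
deg≤height hdᶜ         h = z≤n
deg≤height tlᶜ         h = z≤n
deg≤height (consᶜ p q) h =
  s≤s (⊔-lub-+ {m = height p} (deg≤height p (All.++⁻ˡ _ h)) (deg≤height q (All.++⁻ʳ (boxes p) h)))
deg≤height (p ▸ q)     h =
  s≤s (⊔-lub-+ {m = height p} (deg≤height p (All.++⁻ˡ _ h)) (deg≤height q (All.++⁻ʳ (boxes p) h)))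
deg≤height (ifᶜ b p q) h =
  s≤s (⊔-lub-+ {m = height b} (deg≤height b (All.++⁻ˡ _ h))
        (⊔-lub-+ {m = height p} (deg≤height p (All.++⁻ˡ _ (All.++⁻ʳ (boxes b) h)))
                 (deg≤height q (All.++⁻ʳ (boxes p) (All.++⁻ʳ (boxes b) h)))))
deg≤height (foldᶜ s)   h = s≤s (s≤s (deg≤height s h))
deg≤height (primᶜ p)   h = s≤s z≤n
deg≤height (boxᶜ p)    (h ∷ []) = h

infix 2 _⊢_⇓_within_

_⊢_⇓_within_ : Program → Tree → Tree → ℕ → Set
p ⊢ x ⇓ y within b = ∃[ n ] (n ≤ b × (p ⊢ x ⇓ y # n))

within-mono : ∀ {p x y m n} → m ≤ n → p ⊢ x ⇓ y within m → p ⊢ x ⇓ y within n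
within-mono m≤n (k , k≤m , r) = k , ≤-trans k≤m m≤n , r

module _ {B : ℕ} (64≤B : 64 ≤ B) where

  private instance
    B≢0 : NonZero B
    B≢0 = >-nonZero (≤-trans (s≤s z≤n) 64≤B)

  1≤B^ : ∀ d → 1 ≤ B ^ d
  1≤B^ d = m^n>0 B d

  private
    sum≤ : ∀ {m n d e} → m ≤ B ^ d → n ≤ B ^ e → suc (m + n) ≤ B ^ suc (d ⊔ e)
    sum≤ {m} {n} {d} {e} p q = begin
      suc (m + n)       ≤⟨ s≤s (+-mono-≤ (≤-trans p (^-monoʳ-≤ B (m≤m⊔n d e)))
                                         (≤-trans q (^-monoʳ-≤ B (m≤n⊔m d e)))) ⟩
      suc (X + X)       ≤⟨ +-monoˡ-≤ (X + X) (1≤B^ (d ⊔ e)) ⟩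
      X + (X + X)       ≡⟨ cong (λ z → X + (X + z)) (+-identityʳ X) ⟨
      3 * X             ≤⟨ *-monoˡ-≤ X (≤-trans (≤ᵇ⇒≤ 3 64 tt) 64≤B) ⟩
      B * X             ∎
      where open ≤-Reasoning
            X = B ^ (d ⊔ e)

    -- A round costs the body plus 16, and set-up and exit together are covered by another 16. One
    -- factor `B` counts the rounds; the other dominates 1 + 16 + 16 = 33, which is where the lower
    -- bound on `B` is needed.
    fold≤ : ∀ {m k d} → k ≤ B → m ≤ k * (B ^ d + 16) + 16 → m ≤ B ^ (2 + d)
    fold≤ {m} {k} {d} k≤B h = begin
      m                            ≤⟨ h ⟩
      k * (X + 16) + 16            ≤⟨ +-mono-≤ (*-mono-≤ k≤B (+-monoʳ-≤ X 16≤)) (≤-trans 16≤ (m≤n*m _ B)) ⟩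
      B * (X + 16 * X) + B * (16 * X) ≡⟨ *-distribˡ-+ B (X + 16 * X) (16 * X) ⟨
      B * (X + 16 * X + 16 * X)    ≡⟨ cong (λ z → B * z) (+-assoc X (16 * X) (16 * X)) ⟩
      B * (X + (16 * X + 16 * X))  ≡⟨ cong (λ z → B * (X + z)) (*-distribʳ-+ X 16 16) ⟨
      B * (33 * X)                 ≤⟨ *-monoʳ-≤ B (*-monoˡ-≤ X (≤-trans (≤ᵇ⇒≤ 33 64 tt) 64≤B)) ⟩
      B * (B * X)                  ∎
      where open ≤-Reasoning
            X = B ^ d
            16≤ : 16 ≤ 16 * X
            16≤ = ≤-trans (≤-reflexive (sym (*-identityʳ 16))) (*-monoʳ-≤ 16 (1≤B^ d))

  mutual
    exec : ∀ c x → Fits B c x → ⌜ c ⌝ ⊢ x ⇓ run c x within B ^ deg c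
    exec itᶜ         x f = 1 , ≤-refl , here
    exec nilᶜ        x f = 1 , ≤-refl , empty
    exec hdᶜ         x f = 1 , ≤-refl , hd
    exec tlᶜ         x f = 1 , ≤-refl , tl
    exec (consᶜ p q) x (f , g) with exec p x f | exec q x g
    ... | m , m≤ , r | n , n≤ , s = suc (m + n) , sum≤ {d = deg p} m≤ n≤ , cons r s
    exec (p ▸ q)     x (f , g) with exec p x f | exec q (run p x) g
    ... | m , m≤ , r | n , n≤ , s = suc (m + n) , sum≤ {d = deg p} m≤ n≤ , seq r s
    exec (ifᶜ b p q) x (f , g) with exec b x f
    ... | m , m≤ , r with run b x
    ... | nil with exec q x g
    ...   | n , n≤ , s = suc (m + n)
                       , sum≤ {d = deg b} m≤ (≤-trans n≤ (^-monoʳ-≤ B (m≤n⊔m (deg p) (deg q))))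
                       , else r s
    exec (ifᶜ b p q) x (f , g) | m , m≤ , r | _ ∙ _ with exec p x g
    ...   | n , n≤ , s = suc (m + n)
                       , sum≤ {d = deg b} m≤ (≤-trans n≤ (^-monoʳ-≤ B (m≤m⊔n (deg p) (deg q))))
                       , then r s
    exec (foldᶜ s)   x (f , g) with execFold s (head x) (head (tail x)) (tail (tail x)) g
    ... | n , n≤ , r = _ , fold≤ {d = deg s} f (≤-trans (≤-reflexive (lemma n)) (≤-trans (+-monoˡ-≤ 14 n≤) (≤-reflexive (+-assoc _ 2 14))))
                     , seq (cons hd (cons (seq tl hd) (seq tl tl))) (seq r (seq tl hd))
      where lemma : ∀ n → suc (9 + suc (n + 3)) ≡ n + 14
            lemma n = trans (cong (11 +_) (+-comm n 3)) (+-comm 14 n)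
    exec (primᶜ p)   x f with Primitive.exec p x
    ... | n , n≤ , r = n , ≤-trans n≤ (≤-trans f (≤-reflexive (sym (*-identityʳ B)))) , r
    exec (boxᶜ p)    x f = exec p x f

    execFold : ∀ s l a e → FitsFold B s l a e →
               foldLoop ⌜ s ⌝ ⊢ l ∙ a ∙ e ⇓ nil ∙ runFold s l a e ∙ e within len l * (B ^ deg s + 16) + 2
    execFold s nil     a e f = 2 , ≤-refl , stop hd
    execFold s (x ∙ l) a e (f , g) with exec s (x ∙ a ∙ e) f | execFold s l (run s (x ∙ a ∙ e)) e g
    ... | m , m≤ , r | n , n≤ , t =
      _ , bound , loop hd (cons (seq hd tl) (cons (seq (cons (seq hd hd) tl) r) (seq tl tl))) t
      where
      open ≤-Reasoning
      X = B ^ deg s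
      bound : suc (1 + suc (3 + suc (suc (5 + m) + 3)) + n) ≤ X + 16 + len l * (X + 16) + 2
      bound = begin
        suc (1 + suc (3 + suc (suc (5 + m) + 3)) + n) ≡⟨ cong (λ z → 13 + z + n) (+-comm m 3) ⟩
        16 + m + n                   ≤⟨ +-mono-≤ (+-monoʳ-≤ 16 m≤) n≤ ⟩
        16 + X + (len l * (X + 16) + 2) ≡⟨ cong (_+ (len l * (X + 16) + 2)) (+-comm 16 X) ⟩
        X + 16 + (len l * (X + 16) + 2) ≡⟨ +-assoc (X + 16) (len l * (X + 16)) 2 ⟨
        X + 16 + len l * (X + 16) + 2 ∎

-- Equality and serialization of trees

size : Tree → ℕ
size nil     = 1
size (a ∙ b) = suc (size a + size b)

∙-injectiveˡ : ∀ {a b c d} → a ∙ b ≡ c ∙ d → a ≡ c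
∙-injectiveˡ refl = refl

∙-injectiveʳ : ∀ {a b c d} → a ∙ b ≡ c ∙ d → b ≡ d
∙-injectiveʳ refl = refl

infix 4 _≟ᵗ_

_≟ᵗ_ : (a b : Tree) → Dec (a ≡ b)
nil ≟ᵗ nil = yes refl
nil ≟ᵗ (_ ∙ _) = no λ ()
(_ ∙ _) ≟ᵗ nil = no λ ()
(a ∙ b) ≟ᵗ (c ∙ d) with a ≟ᵗ c | b ≟ᵗ d
... | yes refl | yes refl = yes refl
... | no  a≢c  | _        = no λ e → a≢c (∙-injectiveˡ e)
... | yes _    | no b≢d   = no λ e → b≢d (∙-injectiveʳ e)

private
  perNode : ∀ {K c m} x y k → c ≤ K → m ≤ K * x + (K * y + k) → c + m ≤ K * suc (x + y) + k
  perNode {K} x y k c≤K m≤ =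
    ≤-trans (+-mono-≤ c≤K m≤) (≤-reflexive (lemma K x y k))
    where lemma : ∀ K x y k → K + (K * x + (K * y + k)) ≡ K * suc (x + y) + k
          lemma = solve-∀

  overhead : ∀ c {n k} → c ≤ 9 → n ≤ k + 2 → suc (c + suc (n + 1)) ≤ k + 16
  overhead c {n} {k} c≤9 n≤ = begin
    suc (c + suc (n + 1))       ≤⟨ s≤s (+-mono-≤ c≤9 (s≤s (+-monoˡ-≤ 1 n≤))) ⟩
    11 + (k + 2 + 1)            ≡⟨ lemma k ⟩
    k + 14                      ≤⟨ +-monoʳ-≤ k (m≤n+m 14 2) ⟩
    k + 16                      ∎
    where open ≤-Reasoning
          lemma : ∀ k → 11 + (k + 2 + 1) ≡ k + 14
          lemma = solve-∀

-- On ((a ∙ b) ∙ st) ∙ r, replaces the goal a ≟ b by the goals for its subtrees,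
-- and gives up by emptying both the stack and the result.
eqStep : Program
eqStep =
  if hd ⨾ hd ⨾ hd
  then (if hd ⨾ hd ⨾ tl
        then cons (cons (cons (hd ⨾ hd ⨾ hd ⨾ hd) (hd ⨾ hd ⨾ tl ⨾ hd))
                        (cons (cons (hd ⨾ hd ⨾ hd ⨾ tl) (hd ⨾ hd ⨾ tl ⨾ tl)) (hd ⨾ tl)))
                  tl
        else cons empty empty)
  else (if hd ⨾ hd ⨾ tl then cons empty empty else cons (hd ⨾ tl) tl)

eqLoop : Program
eqLoop = while hd loop eqStep

-- Stated with an arbitrary continuation: whatever the loop does with the remaining stack is passed
-- in as a derivation. The recursion through an explicit stack thus becomes induction on the tree,
-- and the times add up. The longest round costs 51, covered by 64 per node.
eqLoop-same : ∀ a {st r z k} → eqLoop ⊢ st ∙ r ⇓ z within k →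
              eqLoop ⊢ ((a ∙ a) ∙ st) ∙ r ⇓ z within 64 * size a + k
eqLoop-same nil {k = k} (n , n≤k , d) =
  19 + n , +-mono-≤ (≤ᵇ⇒≤ 19 64 tt) n≤k ,
  loop hd (else (seq hd (seq hd hd)) (else (seq hd (seq hd tl)) (cons (seq hd tl) tl))) d
eqLoop-same (a ∙ b) {k = k} h with eqLoop-same a (eqLoop-same b h)
... | n , n≤ , d = 51 + n , perNode (size a) (size b) k (≤ᵇ⇒≤ 51 64 tt) n≤ ,
  loop hd (then (seq hd (seq hd hd)) (then (seq hd (seq hd tl))
    (cons (cons (cons (seq hd (seq hd (seq hd hd))) (seq hd (seq hd (seq tl hd))))
                (cons (cons (seq hd (seq hd (seq hd tl))) (seq hd (seq hd (seq tl tl)))) (seq hd tl)))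
          tl))) d

eqLoop-differ : ∀ a b {st r} → a ≢ b →
                eqLoop ⊢ ((a ∙ b) ∙ st) ∙ r ⇓ nil ∙ nil within 64 * size a + 0
eqLoop-differ nil nil a≢b = ⊥-elim (a≢b refl)
eqLoop-differ nil (b ∙ b′) _ =
  _ , ≤ᵇ⇒≤ 19 64 tt ,
  loop hd (else (seq hd (seq hd hd)) (then (seq hd (seq hd tl)) (cons empty empty))) (stop hd)
eqLoop-differ (a ∙ a′) nil _ =
  19 , perNode {m = 0} (size a) (size a′) 0 (≤ᵇ⇒≤ 19 64 tt) z≤n ,
  loop hd (then (seq hd (seq hd hd)) (else (seq hd (seq hd tl)) (cons empty empty))) (stop hd)
eqLoop-differ (a ∙ a′) (b ∙ b′) {st} {r} ne with a ≟ᵗ b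
... | no a≢b with eqLoop-differ a b {(a′ ∙ b′) ∙ st} {r} a≢b
...   | n , n≤ , d =
  51 + n , perNode (size a) (size a′) 0 (≤ᵇ⇒≤ 51 64 tt) (≤-trans n≤ (+-monoʳ-≤ (64 * size a) z≤n)) ,
  loop hd (then (seq hd (seq hd hd)) (then (seq hd (seq hd tl))
    (cons (cons (cons (seq hd (seq hd (seq hd hd))) (seq hd (seq hd (seq tl hd))))
                (cons (cons (seq hd (seq hd (seq hd tl))) (seq hd (seq hd (seq tl tl)))) (seq hd tl)))
          tl))) d
eqLoop-differ (a ∙ a′) (.a ∙ b′) {st} {r} ne | yes refl
  with eqLoop-same a (eqLoop-differ a′ b′ {st} {r} λ e → ne (cong (a ∙_) e))
...   | n , n≤ , d =
  51 + n , perNode (size a) (size a′) 0 (≤ᵇ⇒≤ 51 64 tt) n≤ ,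
  loop hd (then (seq hd (seq hd hd)) (then (seq hd (seq hd tl))
    (cons (cons (cons (seq hd (seq hd (seq hd hd))) (seq hd (seq hd (seq tl hd))))
                (cons (cons (seq hd (seq hd (seq hd tl))) (seq hd (seq hd (seq tl tl)))) (seq hd tl)))
          tl))) d

eqᵗ : Tree → Tree → Bool
eqᵗ a b = does (a ≟ᵗ b)

-- The result starts as `nil ∙ nil`, that is true, and only a mismatch clears it. The walk never
-- goes deeper than the left tree, hence the time depends on that tree alone.
eqPrim : Primitive
eqPrim = record
  { prog = cons (cons (cons hd tl) empty) (cons empty empty) ⨾ eqLoop ⨾ tl
  ; fun  = λ x → encBool (eqᵗ (head x) (tail x))
  ; time = λ x → 64 * size (head x) + 16
  ; exec = λ x → finish (loop-exec (head x) (tail x))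
  }
  where
  finish : ∀ {x r k} → eqLoop ⊢ ((head x ∙ tail x) ∙ nil) ∙ nil ∙ nil ⇓ nil ∙ r within k + 2 →
           cons (cons (cons hd tl) empty) (cons empty empty) ⨾ eqLoop ⨾ tl ⊢ x ⇓ r within k + 16
  finish (n , n≤ , d) =
    _ , overhead 9 ≤-refl n≤ , seq (cons (cons (cons hd tl) empty) (cons empty empty)) (seq d tl)
  loop-exec : ∀ a b → eqLoop ⊢ ((a ∙ b) ∙ nil) ∙ nil ∙ nil ⇓ nil ∙ encBool (eqᵗ a b)
                        within 64 * size a + 2
  loop-exec a b with a ≟ᵗ b
  ... | yes refl = eqLoop-same a (2 , ≤-refl , stop hd)
  ... | no a≢b   = within-mono (+-monoʳ-≤ (64 * size a) z≤n) (eqLoop-differ a b a≢b)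

serStep : Program
serStep =
  if hd ⨾ hd
  then cons (cons (hd ⨾ hd ⨾ hd) (cons (hd ⨾ hd ⨾ tl) (hd ⨾ tl))) (cons (cons empty empty) tl)
  else cons (hd ⨾ tl) (cons empty tl)

serLoop : Program
serLoop = while hd loop serStep

-- The loop can only push onto the front of its output, so the word is the preorder code of the tree
-- written backwards.
serOnto : Tree → Bits → Bits
serOnto nil     bs = false ∷ bs
serOnto (a ∙ b) bs = serOnto b (serOnto a (true ∷ bs))

ser : Tree → Bits
ser t = serOnto t []

serLoop-exec : ∀ t bs {st z k} → serLoop ⊢ st ∙ encBits (serOnto t bs) ⇓ z within k →
               serLoop ⊢ (t ∙ st) ∙ encBits bs ⇓ z within 64 * size t + k
serLoop-exec nil bs (n , n≤k , d) =
  13 + n , +-mono-≤ (≤ᵇ⇒≤ 13 64 tt) n≤k ,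
  loop hd (else (seq hd hd) (cons (seq hd tl) (cons empty tl))) d
serLoop-exec (a ∙ b) bs {k = k} h with serLoop-exec a (true ∷ bs) (serLoop-exec b (serOnto a (true ∷ bs)) h)
... | n , n≤ , d = 27 + n , perNode (size a) (size b) k (≤ᵇ⇒≤ 27 64 tt) n≤ ,
  loop hd (then (seq hd hd)
    (cons (cons (seq hd (seq hd hd)) (cons (seq hd (seq hd tl)) (seq hd tl)))
          (cons (cons empty empty) tl))) d

serPrim : Primitive
serPrim = record
  { prog = cons (cons here empty) empty ⨾ serLoop ⨾ tl
  ; fun  = λ x → encBits (ser x)
  ; time = λ x → 64 * size x + 16
  ; exec = λ x → finish (serLoop-exec x [] (2 , ≤-refl , stop hd))
  }
  where
  finish : ∀ {x k} → serLoop ⊢ (x ∙ nil) ∙ nil ⇓ nil ∙ encBits (ser x) within k + 2 →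
           cons (cons here empty) empty ⨾ serLoop ⨾ tl ⊢ x ⇓ encBits (ser x) within k + 16
  finish {k = k} (n , n≤ , d) = _ , overhead 5 (≤ᵇ⇒≤ 5 9 tt) n≤ , seq (cons (cons here empty) empty) (seq d tl)

polish : Tree → Bits
polish nil     = false ∷ []
polish (a ∙ b) = true ∷ polish a ++ polish b

serOnto-polish : ∀ t bs → serOnto t bs ≡ polish t ʳ++ bs
serOnto-polish nil     bs = refl
serOnto-polish (a ∙ b) bs = begin
  serOnto b (serOnto a (true ∷ bs))          ≡⟨ serOnto-polish b _ ⟩
  polish b ʳ++ serOnto a (true ∷ bs)       ≡⟨ cong (polish b ʳ++_) (serOnto-polish a _) ⟩
  polish b ʳ++ (polish a ʳ++ true ∷ bs)  ≡⟨ List.++-ʳ++ (polish a) ⟨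
  (polish a ++ polish b) ʳ++ true ∷ bs   ∎
  where open ≡-Reasoning

reverse-ser : ∀ t → reverse (ser t) ≡ polish t
reverse-ser t = trans (cong reverse (serOnto-polish t [])) (List.reverse-involutive (polish t))

-- Polish notation is a prefix code. The trailing words make the induction work, as the codes of the
-- two subtrees are concatenated without a separator.
polish-prefix : ∀ a b {xs ys} → polish a ++ xs ≡ polish b ++ ys → a ≡ b × xs ≡ ys
polish-prefix nil     nil     refl = refl , refl
polish-prefix nil     (_ ∙ _) ()
polish-prefix (_ ∙ _) nil     ()
polish-prefix (a ∙ b) (c ∙ d) e
  with polish-prefix a c (trans (sym (List.++-assoc (polish a) _ _))
         (trans (List.∷-injectiveʳ e) (List.++-assoc (polish c) _ _)))
... | refl , e′ with polish-prefix b d e′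
... | refl , e″ = refl , e″

ser-injective : ∀ {a b} → ser a ≡ ser b → a ≡ b
ser-injective {a} {b} e = proj₁ (polish-prefix a b {[]} {[]}
  (cong (_++ []) (trans (sym (reverse-ser a)) (trans (cong reverse e) (reverse-ser b)))))

-- Trees as lists

-- A tree is read as the list of its left subtrees along the right spine.
infix 4 _∈ᵗ_

data _∈ᵗ_ (x : Tree) : Tree → Set where
  here  : ∀ {l} → x ∈ᵗ x ∙ l
  there : ∀ {y l} → x ∈ᵗ l → x ∈ᵗ y ∙ l

dropᶜ argᶜ : ℕ → Code
dropᶜ zero    = itᶜ
dropᶜ (suc k) = tlᶜ ▸ dropᶜ k
argᶜ k        = dropᶜ k ▸ hdᶜ

yesᶜ : Code
yesᶜ = consᶜ nilᶜ nilᶜ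

fitsFold : ∀ {B s e} l {a} → (∀ x a → x ∈ᵗ l → Fits B s (x ∙ a ∙ e)) → FitsFold B s l a e
fitsFold nil     h = tt
fitsFold (x ∙ l) h = h x _ here , fitsFold l λ y a y∈l → h y a (there y∈l)

row : (Tree → Tree) → Tree → Tree → Tree
row g nil      a = a
row g (y ∙ ys) a = row g ys (g y ∙ a)

-- The accumulator is a parameter so that several products can be chained into one list. With a
-- one-element list in one place this is a map.
pairs : (Tree → Tree → Tree) → Tree → Tree → Tree → Tree
pairs g nil      ys a = a
pairs g (x ∙ xs) ys a = pairs g xs ys (row (g x) ys a)

module _ {g : Tree → Tree} where

  ∈-row⁺ʳ : ∀ {z} ys {a} → z ∈ᵗ a → z ∈ᵗ row g ys a
  ∈-row⁺ʳ nil      z∈a = z∈a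
  ∈-row⁺ʳ (y ∙ ys) z∈a = ∈-row⁺ʳ ys (there z∈a)

  ∈-row⁺ : ∀ {y ys a} → y ∈ᵗ ys → g y ∈ᵗ row g ys a
  ∈-row⁺ {ys = _ ∙ ys} here      = ∈-row⁺ʳ ys here
  ∈-row⁺               (there p) = ∈-row⁺ p

  ∈-row⁻ : ∀ {z} ys {a} → z ∈ᵗ row g ys a → z ∈ᵗ a ⊎ ∃[ y ] (y ∈ᵗ ys × z ≡ g y)
  ∈-row⁻ nil      p = inj₁ p
  ∈-row⁻ (y ∙ ys) p with ∈-row⁻ ys p
  ... | inj₁ here             = inj₂ (y , here , refl)
  ... | inj₁ (there q)        = inj₁ q
  ... | inj₂ (y′ , y′∈ , z≡)  = inj₂ (y′ , there y′∈ , z≡)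

  len-row : ∀ ys a → len (row g ys a) ≡ len ys + len a
  len-row nil      a = refl
  len-row (y ∙ ys) a = trans (len-row ys (g y ∙ a)) (+-suc (len ys) (len a))

module _ {g : Tree → Tree → Tree} where

  ∈-pairs⁺ʳ : ∀ {z} xs {ys a} → z ∈ᵗ a → z ∈ᵗ pairs g xs ys a
  ∈-pairs⁺ʳ nil           z∈a = z∈a
  ∈-pairs⁺ʳ (x ∙ xs) {ys} z∈a = ∈-pairs⁺ʳ xs (∈-row⁺ʳ ys z∈a)

  ∈-pairs⁺ : ∀ {x y xs ys a} → x ∈ᵗ xs → y ∈ᵗ ys → g x y ∈ᵗ pairs g xs ys a
  ∈-pairs⁺ {xs = _ ∙ xs} here      q = ∈-pairs⁺ʳ xs (∈-row⁺ q)
  ∈-pairs⁺               (there p) q = ∈-pairs⁺ p q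

  ∈-pairs⁻ : ∀ {z} xs {ys a} → z ∈ᵗ pairs g xs ys a →
             z ∈ᵗ a ⊎ ∃[ x ] ∃[ y ] (x ∈ᵗ xs × y ∈ᵗ ys × z ≡ g x y)
  ∈-pairs⁻ nil           p = inj₁ p
  ∈-pairs⁻ (x ∙ xs) {ys} p with ∈-pairs⁻ xs p
  ... | inj₂ (x′ , y , x′∈ , y∈ , z≡) = inj₂ (x′ , y , there x′∈ , y∈ , z≡)
  ... | inj₁ q with ∈-row⁻ ys q
  ...   | inj₁ r             = inj₁ r
  ...   | inj₂ (y , y∈ , z≡) = inj₂ (x , y , here , y∈ , z≡)

  len-pairs : ∀ xs ys a → len (pairs g xs ys a) ≡ len xs * len ys + len a
  len-pairs nil      ys a = refl
  len-pairs (x ∙ xs) ys a = begin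
    len (pairs g xs ys (row (g x) ys a))    ≡⟨ len-pairs xs ys _ ⟩
    len xs * len ys + len (row (g x) ys a)  ≡⟨ cong (len xs * len ys +_) (len-row ys a) ⟩
    len xs * len ys + (len ys + len a)      ≡⟨ +-assoc (len xs * len ys) (len ys) (len a) ⟨
    len xs * len ys + len ys + len a        ≡⟨ cong (_+ len a) (+-comm (len xs * len ys) (len ys)) ⟩
    len ys + len xs * len ys + len a        ∎
    where open ≡-Reasoning

-- A fold body sees only the element, the accumulator and the environment. The element of the outer
-- fold therefore travels in the environment of the inner one, whose input is `ys ∙ a ∙ x ∙ e`.
rowᶜ : Code → Code
rowᶜ f = foldᶜ (consᶜ (consᶜ (argᶜ 2) (consᶜ (argᶜ 0) (dropᶜ 3)) ▸ boxᶜ f) (argᶜ 1))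

pairsᶜ : Code → Code
pairsᶜ f = consᶜ (argᶜ 0) (consᶜ (argᶜ 2) (consᶜ (argᶜ 1) (dropᶜ 3)))
         ▸ foldᶜ (consᶜ (argᶜ 2) (consᶜ (argᶜ 1) (consᶜ (argᶜ 0) (dropᶜ 3))) ▸ rowᶜ f)

run-row : ∀ f ys a x e → run (rowᶜ f) (ys ∙ a ∙ x ∙ e) ≡ row (λ y → run f (x ∙ y ∙ e)) ys a
run-row f nil      a x e = refl
run-row f (y ∙ ys) a x e = run-row f ys _ x e

run-pairs : ∀ f xs ys a e →
            run (pairsᶜ f) (xs ∙ ys ∙ a ∙ e) ≡ pairs (λ x y → run f (x ∙ y ∙ e)) xs ys a
run-pairs f nil      ys a e = refl
run-pairs f (x ∙ xs) ys a e =
  trans (cong (λ b → run (pairsᶜ f) (xs ∙ ys ∙ b ∙ e)) (run-row f ys a x e)) (run-pairs f xs ys _ e)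

-- Only the two given lists are folded over. The product list is merely accumulated; its length
-- matters only where a later code folds over it.
fits-pairs : ∀ {B f e} xs ys {a} → len xs ≤ B → len ys ≤ B →
             (∀ {x y} → x ∈ᵗ xs → y ∈ᵗ ys → Fits B f (x ∙ y ∙ e)) →
             Fits B (pairsᶜ f) (xs ∙ ys ∙ a ∙ e)
fits-pairs xs ys xs≤ ys≤ h =
  _ , xs≤ , fitsFold xs λ x a x∈ → _ , ys≤ , fitsFold ys λ y a y∈ → (_ , h x∈ y∈) , _

member : Tree → Tree → Bool
member x nil     = false
member x (y ∙ l) = eqᵗ x y ∨ member x l

member⁺ : ∀ {x l} → x ∈ᵗ l → member x l ≡ true
member⁺ {x} here with x ≟ᵗ x
... | yes _  = refl
... | no x≢x = ⊥-elim (x≢x refl)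
member⁺ {x} {y ∙ l} (there p) with x ≟ᵗ y
... | yes _ = refl
... | no  _ = member⁺ p

member⁻ : ∀ {x} l → member x l ≡ true → x ∈ᵗ l
member⁻ {x} (y ∙ l) e with x ≟ᵗ y
... | yes refl = here
... | no  _    = there (member⁻ l e)

memberᶜ : Code
memberᶜ = consᶜ tlᶜ (consᶜ nilᶜ hdᶜ)
     ▸ foldᶜ (ifᶜ (argᶜ 1) (argᶜ 1) (consᶜ (dropᶜ 2) hdᶜ ▸ primᶜ eqPrim))

run-member : ∀ x l → run memberᶜ (x ∙ l) ≡ encBool (member x l)
run-member x l = go l false
  where
  go : ∀ l b → runFold (ifᶜ (argᶜ 1) (argᶜ 1) (consᶜ (dropᶜ 2) hdᶜ ▸ primᶜ eqPrim)) l (encBool b) x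
               ≡ encBool (b ∨ member x l)
  go nil     true  = refl
  go nil     false = refl
  go (y ∙ l) true  = go l true
  go (y ∙ l) false = go l (eqᵗ x y)

fits-member : ∀ {B} x l → len l ≤ B → 64 * size x + 16 ≤ B → Fits B memberᶜ (x ∙ l)
fits-member {B} x l l≤ h = _ , l≤ , fitsFold l λ y a _ → _ , step y a
  where
  step : ∀ y a →
         FitsBranch B a (argᶜ 1) (consᶜ (dropᶜ 2) hdᶜ ▸ primᶜ eqPrim) (y ∙ a ∙ x)
  step y nil     = _ , h
  step y (_ ∙ _) = _

-- Filtering a list and enumerating its sublists.

filter : (Tree → Tree) → Tree → Tree → Tree
filter p nil     a = a
filter p (x ∙ l) a = filter p l (branch (p x) (x ∙ a) a)

filterᶜ : Code → Code
filterᶜ p = consᶜ hdᶜ (consᶜ nilᶜ tlᶜ)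
          ▸ foldᶜ (ifᶜ (consᶜ hdᶜ (dropᶜ 2) ▸ boxᶜ p) (consᶜ hdᶜ (argᶜ 1)) (argᶜ 1))

run-filter : ∀ p l e → run (filterᶜ p) (l ∙ e) ≡ filter (λ x → run p (x ∙ e)) l nil
run-filter p l e = go l nil
  where
  go : ∀ l a → runFold (ifᶜ (consᶜ hdᶜ (dropᶜ 2) ▸ boxᶜ p) (consᶜ hdᶜ (argᶜ 1)) (argᶜ 1)) l a e
               ≡ filter (λ x → run p (x ∙ e)) l a
  go nil     a = refl
  go (x ∙ l) a = go l _

fits-filter : ∀ {B p} l e → len l ≤ B → (∀ {x} → x ∈ᵗ l → Fits B p (x ∙ e)) →
              Fits B (filterᶜ p) (l ∙ e)
fits-filter {B} {p} l e l≤ h = _ , l≤ , fitsFold l λ x a x∈ → (_ , h x∈) , step x a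
  where
  step : ∀ x a → FitsBranch B (run p (x ∙ e)) (consᶜ hdᶜ (argᶜ 1)) (argᶜ 1) (x ∙ a ∙ e)
  step x a with run p (x ∙ e)
  ... | nil   = _
  ... | _ ∙ _ = _

filter-cong : ∀ {p q} l a → (∀ {x} → x ∈ᵗ l → p x ≡ q x) → filter p l a ≡ filter q l a
filter-cong nil a h = refl
filter-cong {p} {q} (x ∙ l) a h =
  trans (cong (λ b → filter p l (branch b (x ∙ a) a)) (h here)) (filter-cong l _ λ y∈ → h (there y∈))

module _ {p : Tree → Bool} where

  private
    f : Tree → Tree
    f x = encBool (p x)

  ∈-filter⁺ʳ : ∀ {z} l {a} → z ∈ᵗ a → z ∈ᵗ filter f l a
  ∈-filter⁺ʳ nil     z∈a = z∈a
  ∈-filter⁺ʳ (x ∙ l) z∈a with p x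
  ... | true  = ∈-filter⁺ʳ l (there z∈a)
  ... | false = ∈-filter⁺ʳ l z∈a

  ∈-filter⁺ : ∀ {x l a} → x ∈ᵗ l → p x ≡ true → x ∈ᵗ filter f l a
  ∈-filter⁺ {x} {_ ∙ l} here px rewrite px = ∈-filter⁺ʳ l here
  ∈-filter⁺ (there x∈) px = ∈-filter⁺ x∈ px

  ∈-filter⁻ : ∀ {x} l {a} → x ∈ᵗ filter f l a → x ∈ᵗ a ⊎ (x ∈ᵗ l × p x ≡ true)
  ∈-filter⁻ nil     x∈ = inj₁ x∈
  ∈-filter⁻ (y ∙ l) x∈ with p y in py
  ∈-filter⁻ (y ∙ l) x∈ | true with ∈-filter⁻ l x∈
  ... | inj₁ here             = inj₂ (here , py)
  ... | inj₁ (there x∈a)      = inj₁ x∈a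
  ... | inj₂ (x∈l , px)       = inj₂ (there x∈l , px)
  ∈-filter⁻ (y ∙ l) x∈ | false with ∈-filter⁻ l x∈
  ... | inj₁ x∈a              = inj₁ x∈a
  ... | inj₂ (x∈l , px)       = inj₂ (there x∈l , px)

len-filter : ∀ p l a → len (filter p l a) ≤ len l + len a
len-filter p nil     a = ≤-refl
len-filter p (x ∙ l) a with p x
... | nil   = ≤-trans (len-filter p l a) (n≤1+n _)
... | _ ∙ _ = ≤-trans (len-filter p l (x ∙ a)) (≤-reflexive (+-suc (len l) (len a)))

sublists : Tree → Tree → Tree
sublists nil     L = L
sublists (u ∙ l) L = sublists l (pairs _∙_ (u ∙ nil) L L)

∈-sublists⁺ʳ : ∀ {w} l {L} → w ∈ᵗ L → w ∈ᵗ sublists l L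
∈-sublists⁺ʳ nil     w∈ = w∈
∈-sublists⁺ʳ (u ∙ l) {L} w∈ = ∈-sublists⁺ʳ l (∈-pairs⁺ʳ {_∙_} (u ∙ nil) {ys = L} w∈)

-- Both functions walk through `l` in the same order and push kept elements onto the accumulator, so
-- a filtered list is literally an entry of the enumeration and no identification up to order or
-- repetition is required.
filter∈sublists : ∀ p l {a L} → a ∈ᵗ L → filter p l a ∈ᵗ sublists l L
filter∈sublists p nil     a∈ = a∈
filter∈sublists p (x ∙ l) {L = L} a∈ with p x
... | nil   = filter∈sublists p l (∈-pairs⁺ʳ {_∙_} (x ∙ nil) {ys = L} a∈)
... | _ ∙ _ = filter∈sublists p l (∈-pairs⁺ {_∙_} {x} {xs = x ∙ nil} {ys = L} here a∈)

-- An induction principle for the enumeration. The index of `Q` counts the elements considered so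
-- far, which suits bounds on the length as well as on the size of a sublist.
∈-sublists⁻ : ∀ {w} (Q : ℕ → Tree → Set) l {L k} →
              (∀ {w} → w ∈ᵗ L → Q k w) → (∀ {k w} → Q k w → Q (suc k) w) →
              (∀ {u k w} → u ∈ᵗ l → Q k w → Q (suc k) (u ∙ w)) →
              w ∈ᵗ sublists l L → Q (len l + k) w
∈-sublists⁻ Q nil     base weaken step w∈ = base w∈
∈-sublists⁻ {w} Q (u ∙ l) {L} {k} base weaken step w∈ =
  subst (λ n → Q n w) (+-suc (len l) k)
    (∈-sublists⁻ Q l base′ weaken (λ u∈ → step (there u∈)) w∈)
  where
  base′ : ∀ {w} → w ∈ᵗ pairs _∙_ (u ∙ nil) L L → Q (suc k) w
  base′ w∈ with ∈-pairs⁻ {_∙_} (u ∙ nil) {L} {L} w∈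
  ... | inj₁ w∈L                            = weaken (base w∈L)
  ... | inj₂ (_ , v , here , v∈ , refl)     = step here (base v∈)
  ... | inj₂ (_ , v , there () , v∈ , refl)

len-sublists : ∀ l L → len (sublists l L) ≡ 2 ^ len l * len L
len-sublists nil     L = sym (+-identityʳ (len L))
len-sublists (u ∙ l) L = begin
  len (sublists l (pairs _∙_ (u ∙ nil) L L))   ≡⟨ len-sublists l _ ⟩
  2 ^ len l * len (pairs _∙_ (u ∙ nil) L L)    ≡⟨ cong (2 ^ len l *_) (len-pairs {_∙_} (u ∙ nil) L L) ⟩
  2 ^ len l * (1 * len L + len L)              ≡⟨ lemma (2 ^ len l) (len L) ⟩
  2 * 2 ^ len l * len L                        ∎
  where open ≡-Reasoning
        lemma : ∀ a b → a * (1 * b + b) ≡ 2 * a * b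
        lemma = solve-∀

sublistsᶜ : Code
sublistsᶜ = consᶜ itᶜ (consᶜ yesᶜ nilᶜ)
          ▸ foldᶜ (consᶜ (consᶜ hdᶜ nilᶜ) (consᶜ (argᶜ 1) (consᶜ (argᶜ 1) nilᶜ))
                   ▸ pairsᶜ (consᶜ hdᶜ (argᶜ 1)))

run-sublists : ∀ l → run sublistsᶜ l ≡ sublists l (nil ∙ nil)
run-sublists l = go l (nil ∙ nil)
  where
  go : ∀ l L → runFold (consᶜ (consᶜ hdᶜ nilᶜ) (consᶜ (argᶜ 1) (consᶜ (argᶜ 1) nilᶜ))
                        ▸ pairsᶜ (consᶜ hdᶜ (argᶜ 1))) l L nil
               ≡ sublists l L
  go nil     L = refl
  go (u ∙ l) L = trans (cong (λ L → runFold _ l L nil) (run-pairs (consᶜ hdᶜ (argᶜ 1)) (u ∙ nil) L L nil))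
                       (go l _)

-- The accumulated list doubles whenever `l` loses an element, so `2 ^ len l * len L` is invariant
-- and bounds every intermediate list.
fits-sublists : ∀ {B} l → len l ≤ B → 1 ≤ B → 2 ^ len l ≤ B → Fits B sublistsᶜ l
fits-sublists {B} l l≤ 1≤ 2^≤ = _ , l≤ , go l (nil ∙ nil) (≤-trans (≤-reflexive (*-identityʳ _)) 2^≤)
  where
  s : Code
  s = consᶜ (consᶜ hdᶜ nilᶜ) (consᶜ (argᶜ 1) (consᶜ (argᶜ 1) nilᶜ)) ▸ pairsᶜ (consᶜ hdᶜ (argᶜ 1))
  go : ∀ l L → 2 ^ len l * len L ≤ B → FitsFold B s l L nil
  go nil     L h = tt
  go (u ∙ l) L h =
    (_ , fits-pairs (u ∙ nil) L 1≤
           (≤-trans (m≤n*m (len L) (2 ^ suc (len l)) {{m^n≢0 2 (suc (len l))}}) h) (λ _ _ → _)) ,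
    go l _ (≤-trans (≤-reflexive lemma) h)
    where
    lemma : 2 ^ len l * len (run (pairsᶜ (consᶜ hdᶜ (argᶜ 1))) ((u ∙ nil) ∙ L ∙ L ∙ nil))
            ≡ 2 ^ suc (len l) * len L
    lemma rewrite run-pairs (consᶜ hdᶜ (argᶜ 1)) (u ∙ nil) L L nil
                | len-pairs {_∙_} (u ∙ nil) L L = ring (2 ^ len l) (len L)
      where ring : ∀ a b → a * (1 * b + b) ≡ 2 * a * b
            ring = solve-∀

cartᶜ : Code → Code → Code
cartᶜ p q = consᶜ (boxᶜ p) (consᶜ (boxᶜ q) (consᶜ nilᶜ nilᶜ)) ▸ pairsᶜ (consᶜ hdᶜ (argᶜ 1))

cart : Tree → Tree → Tree
cart xs ys = pairs _∙_ xs ys nil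

run-cart : ∀ p q x → run (cartᶜ p q) x ≡ cart (run p x) (run q x)
run-cart p q x = run-pairs (consᶜ hdᶜ (argᶜ 1)) (run p x) (run q x) nil nil

fits-cart : ∀ {B} p q x → Fits B p x → Fits B q x → len (run p x) ≤ B → len (run q x) ≤ B →
            Fits B (cartᶜ p q) x
fits-cart p q x f g p≤ q≤ =
  (f , g , _) , fits-pairs (run p x) (run q x) p≤ q≤ (λ _ _ → _)

∈-cart⁻ : ∀ {z} xs {ys} → z ∈ᵗ cart xs ys → head z ∈ᵗ xs × tail z ∈ᵗ ys
∈-cart⁻ xs z∈ with ∈-pairs⁻ {_∙_} xs z∈
... | inj₂ (x , y , x∈ , y∈ , refl) = x∈ , y∈

-- Prenex formulas and the universes of their types

data Atom (i s : ℕ) : Set where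
  eqᵃ adjᵃ : Fin i → Fin i → Atom i s
  memᵃ     : Fin i → Fin s → Atom i s

#atoms : ℕ → ℕ → ℕ
#atoms i s = i * i + (i * i + i * s)

atom : ∀ {i s} → Fin (#atoms i s) → Atom i s
atom {i} {s} k =
  [ (λ k → uncurry eqᵃ (remQuot i k))
  , (λ k → [ (λ k → uncurry adjᵃ (remQuot i k))
           , (λ k → uncurry memᵃ (remQuot s k)) ]′ (splitAt (i * i) k))
  ]′ (splitAt (i * i) k)

index : ∀ {i s} → Atom i s → Fin (#atoms i s)
index {i} {s} (eqᵃ x y)  = combine x y ↑ˡ (i * i + i * s)
index {i} {s} (adjᵃ x y) = (i * i) ↑ʳ (combine x y ↑ˡ (i * s))
index {i} {s} (memᵃ x X) = (i * i) ↑ʳ ((i * i) ↑ʳ combine x X)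

atom-index : ∀ {i s} (a : Atom i s) → atom (index a) ≡ a
atom-index {i} {s} (eqᵃ x y)
  rewrite Fin.splitAt-↑ˡ (i * i) (combine x y) (i * i + i * s) = cong (uncurry eqᵃ) (Fin.remQuot-combine {i} {i} x y)
atom-index {i} {s} (adjᵃ x y)
  rewrite Fin.splitAt-↑ʳ (i * i) (i * i + i * s) (combine x y ↑ˡ (i * s))
        | Fin.splitAt-↑ˡ (i * i) (combine x y) (i * s) = cong (uncurry adjᵃ) (Fin.remQuot-combine {i} {i} x y)
atom-index {i} {s} (memᵃ x X)
  rewrite Fin.splitAt-↑ʳ (i * i) (i * i + i * s) ((i * i) ↑ʳ combine x X)
        | Fin.splitAt-↑ʳ (i * i) (i * s) (combine x X) = cong (uncurry memᵃ) (Fin.remQuot-combine {i} {s} x X)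

-- A prenex formula whose matrix is the truth function of its atoms; the flag of
-- a quantifier is true for ∃.
data Prefix : ℕ → ℕ → Set where
  matrix : ∀ {i s} → (Vec Bool (#atoms (suc i) s) → Bool) → Prefix (suc i) s
  vertex : ∀ {i s} → Bool → Prefix (suc i) s → Prefix i s
  set    : ∀ {i s} → Bool → Prefix i (suc s) → Prefix i s

-- The trees encℕ 0, …, encℕ (ω ∸ 1), pushed onto l in front of the counter n.
count : ℕ → Tree → Tree → Tree
count zero    n l = n ∙ l
count (suc w) n l = count w (nil ∙ n) (n ∙ l)

colors : ℕ → Tree
colors ω = tail (count ω nil nil)

colorsᶜ : Code
colorsᶜ = consᶜ itᶜ (consᶜ yesᶜ nilᶜ)
        ▸ foldᶜ (consᶜ (consᶜ nilᶜ (argᶜ 1 ▸ hdᶜ)) (argᶜ 1)) ▸ tlᶜ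

run-colors : ∀ ω → run colorsᶜ (encℕ ω) ≡ colors ω
run-colors ω = cong tail (go ω nil nil)
  where
  go : ∀ w n l → runFold (consᶜ (consᶜ nilᶜ (argᶜ 1 ▸ hdᶜ)) (argᶜ 1)) (encℕ w) (n ∙ l) nil ≡ count w n l
  go zero    n l = refl
  go (suc w) n l = go w (nil ∙ n) (n ∙ l)

len-encℕ : ∀ n → len (encℕ n) ≡ n
len-encℕ zero    = refl
len-encℕ (suc n) = cong suc (len-encℕ n)

size-encℕ : ∀ n → size (encℕ n) ≡ suc (n + n)
size-encℕ zero    = refl
size-encℕ (suc n) = cong (λ k → suc (suc k)) (trans (size-encℕ n) (sym (+-suc n n)))

encℕ-injective : ∀ m n → encℕ m ≡ encℕ n → m ≡ n
encℕ-injective m n e = trans (sym (len-encℕ m)) (trans (cong len e) (len-encℕ n))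

fits-colors : ∀ {B} ω → ω ≤ B → Fits B colorsᶜ (encℕ ω)
fits-colors ω ω≤ = _ , (≤-trans (≤-reflexive (len-encℕ ω)) ω≤ , fitsFold (encℕ ω) λ _ _ _ → _) , _

encℕ∈colors : ∀ {m ω} → m < ω → encℕ m ∈ᵗ colors ω
encℕ∈colors {m} {ω} m<ω = go ω 0 z≤n m<ω
  where
  weaken : ∀ {z} w n l → z ∈ᵗ l → z ∈ᵗ tail (count w n l)
  weaken zero    n l z∈ = z∈
  weaken (suc w) n l z∈ = weaken w _ _ (there z∈)
  go : ∀ w n {l} → n ≤ m → m < n + w → encℕ m ∈ᵗ tail (count w (encℕ n) l)
  go zero    n n≤m m< = ⊥-elim (<⇒≱ m< (≤-trans (≤-reflexive (+-identityʳ n)) n≤m))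
  go (suc w) n n≤m m< with m ≟ n
  ... | yes refl = weaken w _ _ here
  ... | no m≢n   = go w (suc n) (≤∧≢⇒< n≤m (m≢n ∘ sym)) (≤-trans m< (≤-reflexive (+-suc n w)))

∈-colors⁻ : ∀ {z} ω → z ∈ᵗ colors ω → ∃[ m ] (m < ω × z ≡ encℕ m)
∈-colors⁻ {z} ω = go ω 0 λ ()
  where
  go : ∀ w n {l} → (z ∈ᵗ l → ∃[ m ] (m < n + w × z ≡ encℕ m)) →
       z ∈ᵗ tail (count w (encℕ n) l) → ∃[ m ] (m < n + w × z ≡ encℕ m)
  go zero    n h z∈ = h z∈
  go (suc w) n {l} h z∈ with go w (suc n) {encℕ n ∙ l} h′ z∈
    where
    h′ : z ∈ᵗ encℕ n ∙ l → ∃[ m ] (m < suc n + w × z ≡ encℕ m)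
    h′ here       = n , s≤s (m≤m+n n w) , refl
    h′ (there z∈) with h z∈
    ... | m , m< , e = m , ≤-trans m< (≤-reflexive (+-suc n w)) , e
  ... | m , m< , e = m , ≤-trans m< (≤-reflexive (sym (+-suc n w))) , e

len-colors : ∀ ω → len (colors ω) ≡ ω
len-colors ω = trans (go ω nil nil) (+-identityʳ ω)
  where
  go : ∀ w n l → len (tail (count w n l)) ≡ w + len l
  go zero    n l = refl
  go (suc w) n l = trans (go w _ _) (+-suc w (len l))

size-colors : ∀ {z} ω → z ∈ᵗ colors ω → size z ≤ suc (ω + ω)
size-colors ω z∈ with ∈-colors⁻ ω z∈
... | m , m<ω , refl = ≤-trans (≤-reflexive (size-encℕ m)) (s≤s (+-mono-≤ (<⇒≤ m<ω) (<⇒≤ m<ω)))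

bools : Tree
bools = encBool false ∙ encBool true ∙ nil

encBool∈bools : ∀ b → encBool b ∈ᵗ bools
encBool∈bools false = here
encBool∈bools true  = there here

boolsᶜ : Code
boolsᶜ = consᶜ nilᶜ (consᶜ yesᶜ nilᶜ)

power : Tree → ℕ → Tree
power l zero    = nil ∙ nil
power l (suc n) = cart l (power l n)

powerᶜ : Code → ℕ → Code
powerᶜ c zero    = yesᶜ
powerᶜ c (suc n) = cartᶜ c (powerᶜ c n)

len-power : ∀ l n → len (power l n) ≡ len l ^ n
len-power l zero    = refl
len-power l (suc n) =
  trans (len-pairs {_∙_} l (power l n) nil) (trans (+-identityʳ _) (cong (len l *_) (len-power l n)))

run-power : ∀ c n x → run (powerᶜ c n) x ≡ power (run c x) n
run-power c zero    x = refl
run-power c (suc n) x =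
  trans (run-cart c (powerᶜ c n) x) (cong (cart (run c x)) (run-power c n x))

fits-power : ∀ {B} c x n → .{{_ : NonZero (len (run c x))}} → Fits B c x →
             len (run c x) ≤ B → len (run c x) ^ n ≤ B → Fits B (powerᶜ c n) x
fits-power c x zero    f l≤ h = _
fits-power {B} c x (suc n) f l≤ h =
  fits-cart c (powerᶜ c n) x f (fits-power c x n f l≤ h′) l≤
    (≤-trans (≤-reflexive (trans (cong len (run-power c n x)) (len-power (run c x) n))) h′)
  where
  h′ : len (run c x) ^ n ≤ B
  h′ = ≤-trans (m≤n*m _ (len (run c x))) h

size-power : ∀ {l k z} n → (∀ {y} → y ∈ᵗ l → size y ≤ k) → z ∈ᵗ power l n → size z ≤ suc (n * suc k)
size-power zero    h here = ≤-refl
size-power {l} {k} (suc n) h z∈ with ∈-pairs⁻ {_∙_} l {power l n} z∈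
... | inj₂ (x , y , x∈ , y∈ , refl) =
  s≤s (≤-trans (+-mono-≤ (h x∈) (size-power n h y∈)) (≤-reflexive (+-suc k (n * suc k))))

-- The last argument tells whether all individual variables are assigned.
univᶜ : ∀ {i s} → Prefix i s → Bool → Code
univᶜ (matrix g)             true  = boolsᶜ
univᶜ {suc i} {s} (matrix g) false = cartᶜ (powerᶜ colorsᶜ (suc i)) (powerᶜ boolsᶜ (#atoms (suc i) s))
univᶜ (vertex _ p)           all   = cartᶜ (univᶜ p false) (boxᶜ (univᶜ p all) ▸ sublistsᶜ)
univᶜ (set _ p)              all   = cartᶜ (univᶜ p all) (boxᶜ (univᶜ p all) ▸ sublistsᶜ)

-- For a vertex quantifier the head is the type with the vertex outside, which makes the flag false,
-- and the tail is the set of types with the vertex inside. A set variable always has a value, so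
-- its types form a nonempty list, stored as head and tail. This reads `nil` as the list consisting
-- of `nil` alone, as the empty structure demands.
univ : ∀ {i s} → Prefix i s → Bool → ℕ → Tree
univ (matrix g)             true  ω = bools
univ {suc i} {s} (matrix g) false ω = cart (power (colors ω) (suc i)) (power bools (#atoms (suc i) s))
univ (vertex _ p)           all   ω = cart (univ p false ω) (sublists (univ p all ω) (nil ∙ nil))
univ (set _ p)              all   ω = cart (univ p all ω) (sublists (univ p all ω) (nil ∙ nil))

run-univ : ∀ {i s} (p : Prefix i s) all ω → run (univᶜ p all) (encℕ ω) ≡ univ p all ω
run-univ (matrix g) true  ω = refl
run-univ {suc i} {s} (matrix g) false ω =
  trans (run-cart (powerᶜ colorsᶜ (suc i)) (powerᶜ boolsᶜ (#atoms (suc i) s)) (encℕ ω))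
        (cong₂ cart (trans (run-power colorsᶜ (suc i) (encℕ ω)) (cong (λ c → power c (suc i)) (run-colors ω)))
                    (run-power boolsᶜ (#atoms (suc i) s) (encℕ ω)))
run-univ (vertex _ p) all ω =
  trans (run-cart (univᶜ p false) (boxᶜ (univᶜ p all) ▸ sublistsᶜ) (encℕ ω))
        (cong₂ cart (run-univ p false ω)
          (trans (run-sublists (run (univᶜ p all) (encℕ ω))) (cong (λ l → sublists l (nil ∙ nil)) (run-univ p all ω))))
run-univ (set _ p) all ω =
  trans (run-cart (univᶜ p all) (boxᶜ (univᶜ p all) ▸ sublistsᶜ) (encℕ ω))
        (cong₂ cart (run-univ p all ω)
          (trans (run-sublists (run (univᶜ p all) (encℕ ω))) (cong (λ l → sublists l (nil ∙ nil)) (run-univ p all ω))))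

-- The type of a disjoint union

nth : ℕ → Tree → Tree
nth zero    t = head t
nth (suc k) t = nth k (tail t)

run-arg : ∀ k t → run (argᶜ k) t ≡ nth k t
run-arg zero    t = refl
run-arg (suc k) t = run-arg k (tail t)

tupleᶜ : ∀ n → (Fin n → Code) → Code
tupleᶜ zero    f = nilᶜ
tupleᶜ (suc n) f = consᶜ (boxᶜ (f zero)) (boxᶜ (tupleᶜ n (f ∘ suc)))

run-tuple : ∀ {n} f k {x} → nth (toℕ k) (run (tupleᶜ n f) x) ≡ run (f k) x
run-tuple f zero    = refl
run-tuple f (suc k) = run-tuple (f ∘ suc) k

tuple∈power : ∀ n f {l x} → (∀ k → run (f k) x ∈ᵗ l) → run (tupleᶜ n f) x ∈ᵗ power l n
tuple∈power zero    f h = here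
tuple∈power (suc n) f h = ∈-pairs⁺ {_∙_} (h zero) (tuple∈power n (f ∘ suc) (h ∘ suc))

-- A full binary decision tree. Its text is exponential in the number of atoms, but the text depends
-- on the formula only and is not charged; the time follows the depth, which is linear.
decideᶜ : ∀ n → (Vec Bool n → Bool) → Code
decideᶜ zero    g with g []
... | true  = yesᶜ
... | false = nilᶜ
decideᶜ (suc n) g =
  ifᶜ hdᶜ (tlᶜ ▸ boxᶜ (decideᶜ n (g ∘ (true ∷_)))) (tlᶜ ▸ boxᶜ (decideᶜ n (g ∘ (false ∷_))))

run-decide : ∀ n g {t} (v : Vec Bool n) → (∀ k → nth (toℕ k) t ≡ encBool (lookup v k)) →
             run (decideᶜ n g) t ≡ encBool (g v)
run-decide zero    g []      h with g []
... | true  = refl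
... | false = refl
run-decide (suc n) g (true ∷ v)  h rewrite h zero = run-decide n (g ∘ (true ∷_)) v (h ∘ suc)
run-decide (suc n) g (false ∷ v) h rewrite h zero = run-decide n (g ∘ (false ∷_)) v (h ∘ suc)

allᵛ : ∀ {A : Set} {n} → (A → Bool) → Vec A n → Bool
allᵛ f []      = true
allᵛ f (x ∷ v) = f x ∧ allᵛ f v

allᵛ-cong : ∀ {A B : Set} {n} {f : A → Bool} {g : B → Bool} (u : Vec A n) (v : Vec B n) →
            (∀ x → f (lookup u x) ≡ g (lookup v x)) → allᵛ f u ≡ allᵛ g v
allᵛ-cong []      []      h = refl
allᵛ-cong (a ∷ u) (b ∷ v) h = cong₂ _∧_ (h zero) (allᵛ-cong u v (h ∘ suc))

allᵛ-lookup : ∀ {A : Set} {n} {f : A → Bool} (u : Vec A n) → allᵛ f u ≡ true → ∀ x → f (lookup u x) ≡ true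
allᵛ-lookup {f = f} (a ∷ u) h x with f a in e
allᵛ-lookup (a ∷ u) h zero    | true = e
allᵛ-lookup (a ∷ u) h (suc x) | true = allᵛ-lookup u h x

-- Left part, right part, or outside of a disjoint union.
data Loc : Set where
  ˡ ʳ ° : Loc

isˡ isʳ inside : Loc → Bool
isˡ ˡ = true
isˡ _ = false
isʳ ʳ = true
isʳ _ = false
inside ° = false
inside _ = true

-- Where the truth value of an atom of the union comes from. Only adjacency across the two sides is
-- new information, and it is determined by the two colours; an equality across, or an atom with a
-- variable outside, is false.
data Source (i : ℕ) : Set where
  fromˡ fromʳ none : Source i
  cross            : Fin i → Fin i → Source i

source : ∀ {i s} → Vec Loc i → Atom i s → Source i
source st (eqᵃ x y) with lookup st x | lookup st y
... | ˡ | ˡ = fromˡ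
... | ʳ | ʳ = fromʳ
... | _ | _ = none
source st (adjᵃ x y) with lookup st x | lookup st y
... | ˡ | ˡ = fromˡ
... | ʳ | ʳ = fromʳ
... | ˡ | ʳ = cross x y
... | ʳ | ˡ = cross x y
... | ° | _ = none
... | ˡ | ° = none
... | ʳ | ° = none
source st (memᵃ x X) with lookup st x
... | ˡ = fromˡ
... | ʳ = fromʳ
... | ° = none

recolorᵗ : Tree → Tree → Tree
recolorᵗ r c = branch (encBool (eqᵗ c (head r))) (tail r) c

recolorᶜ : Code
recolorᶜ = ifᶜ (consᶜ (argᶜ 0) (argᶜ 1) ▸ primᶜ eqPrim) (dropᶜ 2) (argᶜ 0)

-- The codes below expect x ∙ y ∙ F ∙ r ∙ encℕ ω, where x and y describe the two sides of a
-- disjoint union, r is a recolouring of the left side and F lists the pairs of colours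
-- that are or will be joined.
colorᶜ : ∀ {i} → Vec Loc i → Fin i → Code
colorᶜ st x with lookup st x
... | ˡ = consᶜ (argᶜ 0 ▸ hdᶜ ▸ argᶜ (toℕ x)) (argᶜ 3) ▸ recolorᶜ
... | ʳ = argᶜ 1 ▸ hdᶜ ▸ argᶜ (toℕ x)
... | ° = nilᶜ

bitᶜ : ∀ {i} → Vec Loc i → ℕ → Source i → Code
bitᶜ st k fromˡ       = argᶜ 0 ▸ tlᶜ ▸ argᶜ k
bitᶜ st k fromʳ       = argᶜ 1 ▸ tlᶜ ▸ argᶜ k
bitᶜ st k none        = nilᶜ
bitᶜ st k (cross x y) = consᶜ (consᶜ (colorᶜ st x) (colorᶜ st y)) (argᶜ 2) ▸ memberᶜ

colorTupleᶜ : ∀ {i} → Vec Loc i → Code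
colorTupleᶜ {i} st = tupleᶜ i (colorᶜ st)

bitTupleᶜ : ∀ {i} s → Vec Loc i → Code
bitTupleᶜ {i} s st = tupleᶜ (#atoms i s) λ k → bitᶜ st (toℕ k) (source {s = s} st (atom k))

-- If one side holds all variables, its truth value is passed on; branching on it instead of copying
-- makes the result a boolean whatever the input. If the variables are all inside but spread over
-- both sides, this is the moment when the atoms become final and collapse to a truth value.
matrixᶜ : ∀ {i s} → (Vec Bool (#atoms i s) → Bool) → Vec Loc i → (allLeft allRight allInside : Bool) → Code
matrixᶜ     g st true  _     _     = ifᶜ (argᶜ 0) yesᶜ nilᶜ
matrixᶜ     g st false true  _     = ifᶜ (argᶜ 1) yesᶜ nilᶜ
matrixᶜ {s = s} g st false false true  = boxᶜ (bitTupleᶜ s st) ▸ boxᶜ (decideᶜ _ g)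
matrixᶜ {s = s} g st false false false = consᶜ (boxᶜ (colorTupleᶜ st)) (boxᶜ (bitTupleᶜ s st))

-- The locations are known when the code is generated, so there is one specialized code for each
-- vector of locations. At a vertex quantifier a vertex on one side meets the type of the other side
-- with that variable outside; at a set quantifier every type of the left meets every type of the
-- right.
joinᶜ : ∀ {i s} → Prefix i s → Vec Loc i → Code
joinᶜ (matrix {s = s} g) st = matrixᶜ {s = s} g st (allᵛ isˡ st) (allᵛ isʳ st) (allᵛ inside st)
joinᶜ (vertex _ p) st =
  consᶜ (consᶜ (argᶜ 0 ▸ hdᶜ) (consᶜ (argᶜ 1 ▸ hdᶜ) (dropᶜ 2)) ▸ boxᶜ (joinᶜ p (° ∷ st)))
        (consᶜ (dropᶜ 4 ▸ boxᶜ (univᶜ p (allᵛ inside st)))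
               (consᶜ (argᶜ 0 ▸ tlᶜ) (consᶜ (consᶜ (argᶜ 1 ▸ hdᶜ) nilᶜ) (consᶜ
                  (consᶜ (consᶜ (argᶜ 0 ▸ hdᶜ) nilᶜ) (consᶜ (argᶜ 1 ▸ tlᶜ) (consᶜ nilᶜ (dropᶜ 2)))
                    ▸ pairsᶜ (joinᶜ p (ʳ ∷ st)))
                  (dropᶜ 2)))
                ▸ pairsᶜ (joinᶜ p (ˡ ∷ st)))
         ▸ filterᶜ memberᶜ)
joinᶜ (set _ p) st =
  consᶜ (consᶜ (argᶜ 0 ▸ hdᶜ) (consᶜ (argᶜ 1 ▸ hdᶜ) (dropᶜ 2)) ▸ boxᶜ (joinᶜ p st))
        (consᶜ (dropᶜ 4 ▸ boxᶜ (univᶜ p (allᵛ inside st)))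
               (consᶜ (consᶜ (argᶜ 0 ▸ hdᶜ) (argᶜ 0 ▸ tlᶜ)) (consᶜ (consᶜ (argᶜ 1 ▸ hdᶜ) (argᶜ 1 ▸ tlᶜ))
                  (consᶜ nilᶜ (dropᶜ 2)))
                ▸ pairsᶜ (joinᶜ p st))
         ▸ filterᶜ memberᶜ)

join : ∀ {i s} → Prefix i s → Vec Loc i → Tree → Tree → Tree → Tree
join p st e x y = run (joinᶜ p st) (x ∙ y ∙ e)

vertexCandidates : ∀ {i s} → Prefix (suc i) s → Vec Loc i → Tree → Tree → Tree → Tree
vertexCandidates p st e x y =
  pairs (join p (ˡ ∷ st) e) (tail x) (head y ∙ nil)
    (pairs (join p (ʳ ∷ st) e) (head x ∙ nil) (tail y) nil)

setCandidates : ∀ {i s} → Prefix i (suc s) → Vec Loc i → Tree → Tree → Tree → Tree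
setCandidates p st e x y = pairs (join p st e) (head x ∙ tail x) (head y ∙ tail y) nil

-- Filtering the universe by the candidates, rather than listing the candidates, makes the result
-- depend only on which types occur, and puts it among the sublists of the universe.
restrict : Tree → Tree → Tree
restrict cs u = filter (λ z → encBool (member z cs)) u nil

run-restrict : ∀ u cs → run (filterᶜ memberᶜ) (u ∙ cs) ≡ restrict cs u
run-restrict u cs = trans (run-filter memberᶜ u cs) (filter-cong u nil λ {z} _ → run-member z cs)

join-vertex : ∀ {i s b} (p : Prefix (suc i) s) st F r ω x y →
  let e = F ∙ r ∙ encℕ ω in
  join (vertex b p) st e x y
    ≡ join p (° ∷ st) e (head x) (head y)
      ∙ restrict (vertexCandidates p st e x y) (univ p (allᵛ inside st) ω)
join-vertex p st F r ω x y = cong (join p (° ∷ st) e (head x) (head y) ∙_)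
  (trans (run-restrict (run (univᶜ p (allᵛ inside st)) (encℕ ω)) _)
         (cong₂ restrict
           (trans (cong (λ a → run (pairsᶜ (joinᶜ p (ˡ ∷ st))) (tail x ∙ (head y ∙ nil) ∙ a ∙ e))
                     (run-pairs (joinᶜ p (ʳ ∷ st)) (head x ∙ nil) (tail y) nil e))
                  (run-pairs (joinᶜ p (ˡ ∷ st)) (tail x) (head y ∙ nil) _ e))
           (run-univ p (allᵛ inside st) ω)))
  where e = F ∙ r ∙ encℕ ω

join-set : ∀ {i s b} (p : Prefix i (suc s)) st F r ω x y →
  let e = F ∙ r ∙ encℕ ω in
  join (set b p) st e x y
    ≡ join p st e (head x) (head y)
      ∙ restrict (setCandidates p st e x y) (univ p (allᵛ inside st) ω)
join-set p st F r ω x y = cong (join p st e (head x) (head y) ∙_)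
  (trans (run-restrict (run (univᶜ p (allᵛ inside st)) (encℕ ω)) _)
         (cong₂ restrict
           (run-pairs (joinᶜ p st) (head x ∙ tail x) (head y ∙ tail y) nil e)
           (run-univ p (allᵛ inside st) ω)))
  where e = F ∙ r ∙ encℕ ω

∈-restrict⁺ : ∀ {z cs u} → z ∈ᵗ u → z ∈ᵗ cs → z ∈ᵗ restrict cs u
∈-restrict⁺ z∈u z∈cs = ∈-filter⁺ z∈u (member⁺ z∈cs)

∈-restrict⁻ : ∀ {z} cs u → z ∈ᵗ restrict cs u → z ∈ᵗ cs
∈-restrict⁻ {z} cs u z∈ with ∈-filter⁻ {λ z → member z cs} u z∈
... | inj₂ (_ , h) = member⁻ cs h

restrict∈sublists : ∀ cs u → restrict cs u ∈ᵗ sublists u (nil ∙ nil)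
restrict∈sublists cs u = filter∈sublists (λ z → encBool (member z cs)) u here

-- Types describe structures

-- In the intended instances `linked` is adjacency in the finished graph, not the edges built so
-- far, whereas `hue` is the colour at the current node.
record Structure : Set₁ where
  field
    Vtx    : Set
    same   : Vtx → Vtx → Bool
    linked : Vtx → Vtx → Bool
    hue    : Vtx → Tree

on₂ : {V : Set} → (V → V → Bool) → Maybe V → Maybe V → Bool
on₂ f (just u) (just v) = f u v
on₂ f _        _        = false

module _ (A : Structure) where
  open Structure A

  value : ∀ {i s} → Vec (Maybe Vtx) i → Vec (Vtx → Bool) s → Atom i s → Bool
  value ρ σ (eqᵃ x y)  = on₂ same (lookup ρ x) (lookup ρ y)
  value ρ σ (adjᵃ x y) = on₂ linked (lookup ρ x) (lookup ρ y)
  value ρ σ (memᵃ x X) = maybe′ (lookup σ X) false (lookup ρ x)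

  values : ∀ {i s} → Vec (Maybe Vtx) i → Vec (Vtx → Bool) s → Vec Bool (#atoms i s)
  values ρ σ = tabulate (value ρ σ ∘ atom)

  hueᵐ : Maybe Vtx → Tree
  hueᵐ = maybe′ hue nil

  -- Once all variables are inside, their atoms are final and the truth value alone is kept.  This
  -- saves the exponential that separates the claimed bound from the naive count of types.
  DescribesMatrix : ∀ {i s} → (Vec Bool (#atoms i s) → Bool) → Bool →
                    Vec (Maybe Vtx) i → Vec (Vtx → Bool) s → Tree → Set
  DescribesMatrix g true  ρ σ t = t ≡ encBool (g (values ρ σ))
  DescribesMatrix g false ρ σ t =
    (∀ x → nth (toℕ x) (head t) ≡ hueᵐ (lookup ρ x)) ×
    (∀ k → nth (toℕ k) (tail t) ≡ encBool (value ρ σ (atom k)))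

  -- `nothing` marks the individual variables whose value lies outside of A.
  Describes : ∀ {i s} → Prefix i s → Vec (Maybe Vtx) i → Vec (Vtx → Bool) s → Tree → Set
  Describes (matrix g)   ρ σ t = DescribesMatrix g (allᵛ is-just ρ) ρ σ t
  Describes (vertex _ p) ρ σ t =
    Describes p (nothing ∷ ρ) σ (head t) ×
    (∀ v → ∃[ u ] (u ∈ᵗ tail t × Describes p (just v ∷ ρ) σ u)) ×
    (∀ {u} → u ∈ᵗ tail t → ∃[ v ] Describes p (just v ∷ ρ) σ u)
  Describes (set _ p)    ρ σ t =
    (∀ X → ∃[ u ] (u ∈ᵗ head t ∙ tail t × Describes p ρ (X ∷ σ) u)) ×
    (∀ {u} → u ∈ᵗ head t ∙ tail t → ∃[ X ] Describes p ρ (X ∷ σ) u)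

open Equivalence using () renaming (to to ⇒; from to ⇐)
open Structure

-- Disjoint union with the left side recoloured by `r` and with the cross edges read off from `F`
-- and the colours in `C`. The operations with one child are the instances in which `B` is empty.
record IsJoin (A B C : Structure) (F r : Tree) (ω : ℕ) : Set where
  field
    inl       : Vtx A → Vtx C
    inr       : Vtx B → Vtx C
    split     : Vtx C → Vtx A ⊎ Vtx B
    split-inl : ∀ a → split (inl a) ≡ inj₁ a
    split-inr : ∀ b → split (inr b) ≡ inj₂ b
    unsplit   : ∀ c → [ inl , inr ]′ (split c) ≡ c
    same-ll   : ∀ u v → same C (inl u) (inl v) ≡ same A u v
    same-rr   : ∀ u v → same C (inr u) (inr v) ≡ same B u v
    same-lr   : ∀ u v → same C (inl u) (inr v) ≡ false
    same-rl   : ∀ u v → same C (inr u) (inl v) ≡ false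
    linked-ll : ∀ u v → linked C (inl u) (inl v) ≡ linked A u v
    linked-rr : ∀ u v → linked C (inr u) (inr v) ≡ linked B u v
    linked-lr : ∀ u v → linked C (inl u) (inr v) ≡ member (hue C (inl u) ∙ hue C (inr v)) F
    linked-rl : ∀ u v → linked C (inr u) (inl v) ≡ member (hue C (inr u) ∙ hue C (inl v)) F
    hue-l     : ∀ u → hue C (inl u) ≡ recolorᵗ r (hue A u)
    hue-r     : ∀ v → hue C (inr v) ≡ hue B v
    hue∈      : ∀ c → hue C c ∈ᵗ colors ω
    nil∈      : nil ∈ᵗ colors ω

module _ {A B C : Structure} {F r : Tree} {ω : ℕ} (J : IsJoin A B C F r ω) where
  open IsJoin J

  private
    e : Tree
    e = F ∙ r ∙ encℕ ω

  data Part : Maybe (Vtx A) → Maybe (Vtx B) → Maybe (Vtx C) → Loc → Set where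
    onˡ : ∀ {a} → Part (just a) nothing (just (inl a)) ˡ
    onʳ : ∀ {b} → Part nothing (just b) (just (inr b)) ʳ
    outside : Part nothing nothing nothing °

  record Splitting {i s} (st : Vec Loc i) (ρA : Vec (Maybe (Vtx A)) i) (ρB : Vec (Maybe (Vtx B)) i)
                   (ρC : Vec (Maybe (Vtx C)) i) (σA : Vec (Vtx A → Bool) s)
                   (σB : Vec (Vtx B → Bool) s) (σC : Vec (Vtx C → Bool) s) : Set where
    field
      part  : ∀ x → Part (lookup ρA x) (lookup ρB x) (lookup ρC x) (lookup st x)
      set-l : ∀ X a → lookup σC X (inl a) ≡ lookup σA X a
      set-r : ∀ X b → lookup σC X (inr b) ≡ lookup σB X b

  extend : ∀ {i s} {st : Vec Loc i} {ρA ρB ρC} {σA : Vec _ s} {σB σC} {a b c l} → Part a b c l →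
           Splitting st ρA ρB ρC σA σB σC → Splitting (l ∷ st) (a ∷ ρA) (b ∷ ρB) (c ∷ ρC) σA σB σC
  extend q S = record { part = λ { zero → q ; (suc x) → part x } ; set-l = set-l ; set-r = set-r }
    where open Splitting S

  extendSet : ∀ {i s} {st : Vec Loc i} {ρA ρB ρC} {σA : Vec _ s} {σB σC} {X Y Z} →
              (∀ a → Z (inl a) ≡ X a) → (∀ b → Z (inr b) ≡ Y b) →
              Splitting st ρA ρB ρC σA σB σC → Splitting st ρA ρB ρC (X ∷ σA) (Y ∷ σB) (Z ∷ σC)
  extendSet hl hr S = record
    { part  = part
    ; set-l = λ { zero → hl ; (suc X) → set-l X }
    ; set-r = λ { zero → hr ; (suc X) → set-r X } }
    where open Splitting S

  module _ {i s} {st : Vec Loc i} {ρA ρB ρC} {σA : Vec _ s} {σB σC}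
           (S : Splitting st ρA ρB ρC σA σB σC) where
    open Splitting S

    sourceValue : Source i → Atom i s → Bool
    sourceValue fromˡ       a = value A ρA σA a
    sourceValue fromʳ       a = value B ρB σB a
    sourceValue none        a = false
    sourceValue (cross x y) a = member (hueᵐ C (lookup ρC x) ∙ hueᵐ C (lookup ρC y)) F

    value-source : ∀ a → value C ρC σC a ≡ sourceValue (source st a) a
    value-source (eqᵃ x y)
      with lookup ρA x in ax | lookup ρB x in bx | lookup ρC x | lookup st x | part x
         | lookup ρA y in ay | lookup ρB y in by | lookup ρC y | lookup st y | part y
    ... | _ | _ | _ | _ | onˡ {u} | _ | _ | _ | _ | onˡ {v} rewrite ax | ay = same-ll u v
    ... | _ | _ | _ | _ | onˡ {u} | _ | _ | _ | _ | onʳ {v} = same-lr u v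
    ... | _ | _ | _ | _ | onʳ {u} | _ | _ | _ | _ | onˡ {v} = same-rl u v
    ... | _ | _ | _ | _ | onʳ {u} | _ | _ | _ | _ | onʳ {v} rewrite bx | by = same-rr u v
    ... | _ | _ | _ | _ | outside     | _ | _ | _ | _ | onˡ     = refl
    ... | _ | _ | _ | _ | outside     | _ | _ | _ | _ | onʳ     = refl
    ... | _ | _ | _ | _ | outside     | _ | _ | _ | _ | outside     = refl
    ... | _ | _ | _ | _ | onˡ     | _ | _ | _ | _ | outside     = refl
    ... | _ | _ | _ | _ | onʳ     | _ | _ | _ | _ | outside     = refl
    value-source (adjᵃ x y)
      with lookup ρA x in ax | lookup ρB x in bx | lookup ρC x in cx | lookup st x | part x
         | lookup ρA y in ay | lookup ρB y in by | lookup ρC y in cy | lookup st y | part y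
    ... | _ | _ | _ | _ | onˡ {u} | _ | _ | _ | _ | onˡ {v} rewrite ax | ay = linked-ll u v
    ... | _ | _ | _ | _ | onˡ {u} | _ | _ | _ | _ | onʳ {v} rewrite cx | cy = linked-lr u v
    ... | _ | _ | _ | _ | onʳ {u} | _ | _ | _ | _ | onˡ {v} rewrite cx | cy = linked-rl u v
    ... | _ | _ | _ | _ | onʳ {u} | _ | _ | _ | _ | onʳ {v} rewrite bx | by = linked-rr u v
    ... | _ | _ | _ | _ | outside     | _ | _ | _ | _ | onˡ     = refl
    ... | _ | _ | _ | _ | outside     | _ | _ | _ | _ | onʳ     = refl
    ... | _ | _ | _ | _ | outside     | _ | _ | _ | _ | outside     = refl
    ... | _ | _ | _ | _ | onˡ     | _ | _ | _ | _ | outside     = refl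
    ... | _ | _ | _ | _ | onʳ     | _ | _ | _ | _ | outside     = refl
    value-source (memᵃ x X)
      with lookup ρA x in ax | lookup ρB x in bx | lookup ρC x | lookup st x | part x
    ... | _ | _ | _ | _ | onˡ {u} rewrite ax = set-l X u
    ... | _ | _ | _ | _ | onʳ {u} rewrite bx = set-r X u
    ... | _ | _ | _ | _ | outside     = refl

    all-is-justA : allᵛ is-just ρA ≡ allᵛ isˡ st
    all-is-justA = allᵛ-cong ρA st λ x → go (part x)
      where go : ∀ {a b c l} → Part a b c l → is-just a ≡ isˡ l
            go onˡ = refl
            go onʳ = refl
            go outside = refl

    all-is-justB : allᵛ is-just ρB ≡ allᵛ isʳ st
    all-is-justB = allᵛ-cong ρB st λ x → go (part x)
      where go : ∀ {a b c l} → Part a b c l → is-just b ≡ isʳ l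
            go onˡ = refl
            go onʳ = refl
            go outside = refl

    all-is-justC : allᵛ is-just ρC ≡ allᵛ inside st
    all-is-justC = allᵛ-cong ρC st λ x → go (part x)
      where go : ∀ {a b c l} → Part a b c l → is-just c ≡ inside l
            go onˡ = refl
            go onʳ = refl
            go outside = refl

    values-l : allᵛ isˡ st ≡ true → values C ρC σC ≡ values A ρA σA
    values-l h = Vec.tabulate-cong λ k →
      trans (value-source (atom k)) (cong (λ src → sourceValue src (atom k)) (go (atom k)))
      where
      go : ∀ a → source st a ≡ fromˡ
      go (eqᵃ x y) with lookup st x | allᵛ-lookup st h x | lookup st y | allᵛ-lookup st h y
      ... | ˡ | _ | ˡ | _ = refl
      go (adjᵃ x y) with lookup st x | allᵛ-lookup st h x | lookup st y | allᵛ-lookup st h y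
      ... | ˡ | _ | ˡ | _ = refl
      go (memᵃ x X) with lookup st x | allᵛ-lookup st h x
      ... | ˡ | _ = refl

    values-r : allᵛ isʳ st ≡ true → values C ρC σC ≡ values B ρB σB
    values-r h = Vec.tabulate-cong λ k →
      trans (value-source (atom k)) (cong (λ src → sourceValue src (atom k)) (go (atom k)))
      where
      go : ∀ a → source st a ≡ fromʳ
      go (eqᵃ x y) with lookup st x | allᵛ-lookup st h x | lookup st y | allᵛ-lookup st h y
      ... | ʳ | _ | ʳ | _ = refl
      go (adjᵃ x y) with lookup st x | allᵛ-lookup st h x | lookup st y | allᵛ-lookup st h y
      ... | ʳ | _ | ʳ | _ = refl
      go (memᵃ x X) with lookup st x | allᵛ-lookup st h x
      ... | ʳ | _ = refl

    module _ {g : Vec Bool (#atoms i s) → Bool} {t u : Tree}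
             (DA : DescribesMatrix A g false ρA σA t) (DB : DescribesMatrix B g false ρB σB u) where

      run-color : ∀ x → run (colorᶜ st x) (t ∙ u ∙ e) ≡ hueᵐ C (lookup ρC x)
      run-color x with lookup ρA x | lookup ρB x | lookup ρC x | lookup st x | part x
                     | proj₁ DA x | proj₁ DB x
      ... | _ | _ | _ | _ | onˡ {a} | ha | hb =
        trans (cong (recolorᵗ r) (trans (run-arg (toℕ x) (head t)) ha)) (sym (hue-l a))
      ... | _ | _ | _ | _ | onʳ {b} | ha | hb =
        trans (run-arg (toℕ x) (head u)) (trans hb (sym (hue-r b)))
      ... | _ | _ | _ | _ | outside     | ha | hb = refl

      run-bit : ∀ k → run (bitᶜ st (toℕ k) (source st (atom k))) (t ∙ u ∙ e)
                      ≡ encBool (value C ρC σC (atom k))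
      run-bit k = trans (go (source st (atom k))) (cong encBool (sym (value-source (atom k))))
        where
        go : ∀ src → run (bitᶜ st (toℕ k) src) (t ∙ u ∙ e) ≡ encBool (sourceValue src (atom k))
        go fromˡ       = trans (run-arg (toℕ k) (tail t)) (proj₂ DA k)
        go fromʳ       = trans (run-arg (toℕ k) (tail u)) (proj₂ DB k)
        go none        = refl
        go (cross x y) =
          trans (cong₂ (λ c d → run memberᶜ ((c ∙ d) ∙ F)) (run-color x) (run-color y))
                (run-member (hueᵐ C (lookup ρC x) ∙ hueᵐ C (lookup ρC y)) F)

    run-bits : ∀ {g t u} → DescribesMatrix A g false ρA σA t → DescribesMatrix B g false ρB σB u →
               ∀ k → nth (toℕ k) (run (bitTupleᶜ s st) (t ∙ u ∙ e)) ≡ encBool (value C ρC σC (atom k))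
    run-bits {g} {t} {u} DA DB k =
      trans (run-tuple (λ k → bitᶜ st (toℕ k) (source {s = s} st (atom k))) k) (run-bit {g} DA DB k)

    hueᵐ∈ : ∀ m → hueᵐ C m ∈ᵗ colors ω
    hueᵐ∈ (just c) = hue∈ c
    hueᵐ∈ nothing  = nil∈

  -- The three flags are variables tied to `st` by equations, so the cases of `matrixᶜ` split by
  -- plain matching. The last two implications say that a side holding all variables leaves none
  -- outside the union; they exclude the inconsistent flags.
  describes-matrix : ∀ {i s} (g : Vec Bool (#atoms (suc i) s) → Bool) {st ρA ρB ρC σA σB σC} →
    (S : Splitting st ρA ρB ρC σA σB σC) → ∀ bA bB bC → allᵛ isˡ st ≡ bA → allᵛ isʳ st ≡ bB →
    (allᵛ isˡ st ≡ true → bC ≡ true) → (allᵛ isʳ st ≡ true → bC ≡ true) → ∀ {t u} →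
    DescribesMatrix A g bA ρA σA t → DescribesMatrix B g bB ρB σB u →
    let v = run (matrixᶜ {s = s} g st bA bB bC) (t ∙ u ∙ e) in
    DescribesMatrix C g bC ρC σC v × v ∈ᵗ univ (matrix {i} {s} g) bC ω
  describes-matrix g {ρA = ρA} {σA = σA} S true bB bC eA eB hA hB {t} DA DB with hA eA
  ... | refl = subst₂ (λ v w → v ≡ encBool (g w) × v ∈ᵗ bools) (sym (go _ DA)) (sym (values-l S eA))
                      (refl , encBool∈bools (g (values A ρA σA)))
    where
    go : ∀ b → t ≡ encBool b → branch t (nil ∙ nil) nil ≡ encBool b
    go true  refl = refl
    go false refl = refl
  describes-matrix g {ρB = ρB} {σB = σB} S false true bC eA eB hA hB {t} {u} DA DB with hB eB
  ... | refl = subst₂ (λ v w → v ≡ encBool (g w) × v ∈ᵗ bools) (sym (go _ DB)) (sym (values-r S eB))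
                      (refl , encBool∈bools (g (values B ρB σB)))
    where
    go : ∀ b → u ≡ encBool b → branch u (nil ∙ nil) nil ≡ encBool b
    go true  refl = refl
    go false refl = refl
  describes-matrix g {ρC = ρC} {σC = σC} S false false true eA eB hA hB DA DB =
    eq′ , subst (_∈ᵗ bools) (sym eq′) (encBool∈bools (g (values C ρC σC)))
    where
    eq′ = run-decide _ g (values C ρC σC) λ k →
      trans (run-bits S {g} DA DB k) (cong encBool (sym (Vec.lookup∘tabulate (value C ρC σC ∘ atom) k)))
  describes-matrix {i} {s} g {st} {ρC = ρC} {σC = σC} S false false false eA eB hA hB DA DB =
    ( (λ x → trans (run-tuple (colorᶜ st) x) (run-color S {g} DA DB x)) , run-bits S {g} DA DB ) ,
    ∈-pairs⁺ {_∙_}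
      (tuple∈power (suc i) (colorᶜ st) λ x →
        subst (_∈ᵗ colors ω) (sym (run-color S {g} DA DB x)) (hueᵐ∈ S (lookup ρC x)))
      (tuple∈power (#atoms (suc i) s) (λ k → bitᶜ st (toℕ k) (source {s = s} st (atom k))) λ k →
        subst (_∈ᵗ bools) (sym (run-bit S {g} DA DB k)) (encBool∈bools (value C ρC σC (atom k))))

  -- The composition argument of Feferman and Vaught: a vertex of the union lies on exactly one
  -- side, and a set is a pair of traces. Membership in the universe has to be proved in the same
  -- induction, because `restrict` would otherwise lose candidates that the description needs.
  describes-join : ∀ {i s} (p : Prefix i s) {st ρA ρB ρC σA σB σC} →
    Splitting st ρA ρB ρC σA σB σC → ∀ {t u} → Describes A p ρA σA t → Describes B p ρB σB u →
    Describes C p ρC σC (join p st e t u) × join p st e t u ∈ᵗ univ p (allᵛ inside st) ω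
  describes-join (matrix {i} {s} g) {st} S {t} {u} DA DB
    rewrite all-is-justC S | all-is-justA S | all-is-justB S =
    describes-matrix g S (allᵛ isˡ st) (allᵛ isʳ st) (allᵛ inside st) refl refl
      (imply isˡ st λ { ˡ _ → refl }) (imply isʳ st λ { ʳ _ → refl }) {t} {u} DA DB
    where
    imply : ∀ {n} (f : Loc → Bool) (v : Vec Loc n) → (∀ l → f l ≡ true → inside l ≡ true) →
            allᵛ f v ≡ true → allᵛ inside v ≡ true
    imply f []      h e = refl
    imply f (l ∷ v) h e with f l in fl
    imply f (l ∷ v) h e | true rewrite h l fl = imply f v h e
  describes-join (vertex b p) {st} {ρA} {ρB} {ρC} {σA} {σB} {σC} S {t} {u} (A₀ , A⁺ , A⁻) (B₀ , B⁺ , B⁻) =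
    subst (λ v → Describes C (vertex b p) ρC σC v × v ∈ᵗ univ (vertex b p) (allᵛ inside st) ω)
      (sym (join-vertex {b = b} p st F r ω t u))
      ((C₀ , C⁺ , C⁻) , ∈-pairs⁺ {_∙_} C₀∈ (restrict∈sublists cs (univ p (allᵛ inside st) ω)))
    where
    cs = vertexCandidates p st e t u
    C₀ = proj₁ (describes-join p (extend outside S) A₀ B₀)
    C₀∈ = proj₂ (describes-join p (extend outside S) A₀ B₀)
    C⁺ : ∀ c → ∃[ w ] (w ∈ᵗ restrict cs (univ p (allᵛ inside st) ω) × Describes C p (just c ∷ ρC) σC w)
    C⁺ c with split c in sc | unsplit c
    ... | inj₁ a | refl with A⁺ a
    ...   | w , w∈ , Dw with describes-join p (extend onˡ S) Dw B₀
    ...     | D , D∈ = _ , ∈-restrict⁺ D∈ (∈-pairs⁺ w∈ here) , D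
    C⁺ c | inj₂ b | refl with B⁺ b
    ...   | w , w∈ , Dw with describes-join p (extend onʳ S) A₀ Dw
    ...     | D , D∈ = _ , ∈-restrict⁺ D∈ (∈-pairs⁺ʳ (tail t)
        (∈-pairs⁺ {join p (ʳ ∷ st) e} {xs = head t ∙ nil} here w∈)) , D
    C⁻ : ∀ {w} → w ∈ᵗ restrict cs (univ p (allᵛ inside st) ω) → ∃[ c ] Describes C p (just c ∷ ρC) σC w
    C⁻ w∈ with ∈-pairs⁻ {join p (ˡ ∷ st) e} (tail t) (∈-restrict⁻ cs (univ p (allᵛ inside st) ω) w∈)
    ... | inj₂ (x , _ , x∈ , here , refl) with A⁻ x∈
    ...   | a , Dx = inl a , proj₁ (describes-join p (extend onˡ S) Dx B₀)
    C⁻ w∈ | inj₁ w∈′ with ∈-pairs⁻ {join p (ʳ ∷ st) e} (head t ∙ nil) w∈′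
    ... | inj₂ (_ , x , here , x∈ , refl) with B⁻ x∈
    ...   | b , Dx = inr b , proj₁ (describes-join p (extend onʳ S) A₀ Dx)
  describes-join (set b p) {st} {ρA} {ρB} {ρC} {σA} {σB} {σC} S {t} {u} (A⁺ , A⁻) (B⁺ , B⁻) =
    subst (λ v → Describes C (set b p) ρC σC v × v ∈ᵗ univ (set b p) (allᵛ inside st) ω)
      (sym (join-set {b = b} p st F r ω t u))
      ((C⁺ , C⁻) , ∈-pairs⁺ {_∙_} (proj₂ C₀) (restrict∈sublists cs (univ p (allᵛ inside st) ω)))
    where
    cs = setCandidates p st e t u
    U  = univ p (allᵛ inside st) ω
    -- Listed types on the two sides come from sets `X` and `Y`; gluing them along `split` gives a
    -- set of the union with exactly these traces.
    combine′ : ∀ {x y} → x ∈ᵗ head t ∙ tail t → y ∈ᵗ head u ∙ tail u →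
               (∃[ Z ] Describes C p ρC (Z ∷ σC) (join p st e x y)) × join p st e x y ∈ᵗ U
    combine′ x∈ y∈ with A⁻ x∈ | B⁻ y∈
    ... | X , DX | Y , DY with describes-join p (extendSet {Z = [ X , Y ]′ ∘ split}
                                 (λ a → cong [ X , Y ]′ (split-inl a)) (λ b → cong [ X , Y ]′ (split-inr b)) S) DX DY
    ...   | D , D∈ = (_ , D) , D∈
    C₀ = combine′ here here
    C⁺ : ∀ Z → ∃[ w ] (w ∈ᵗ join p st e (head t) (head u) ∙ restrict cs U × Describes C p ρC (Z ∷ σC) w)
    C⁺ Z with A⁺ (Z ∘ inl) | B⁺ (Z ∘ inr)
    ... | x , x∈ , DX | y , y∈ , DY with describes-join p (extendSet (λ _ → refl) (λ _ → refl) S) DX DY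
    ...   | D , D∈ = _ , there (∈-restrict⁺ D∈ (∈-pairs⁺ x∈ y∈)) , D
    C⁻ : ∀ {w} → w ∈ᵗ join p st e (head t) (head u) ∙ restrict cs U → ∃[ Z ] Describes C p ρC (Z ∷ σC) w
    C⁻ here       = proj₁ C₀
    C⁻ (there w∈) with ∈-pairs⁻ {join p st e} (head t ∙ tail t) (∈-restrict⁻ cs (univ p (allᵛ inside st) ω) w∈)
    ... | inj₂ (x , y , x∈ , y∈ , refl) = proj₁ (combine′ x∈ y∈)

-- Single vertices, the empty structure, and evaluation

∅ : Structure
∅ = record { Vtx = ⊥ ; same = λ () ; linked = λ () ; hue = λ () }

nth-nil : ∀ k → nth k nil ≡ nil
nth-nil zero    = refl
nth-nil (suc k) = nth-nil k

-- The tree nil describes the empty structure since head nil = tail nil = nil.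
describes-∅ : ∀ {i s} (p : Prefix i s) ρ σ → Describes ∅ p ρ σ nil
describes-∅ (matrix {i} {s} g) (nothing ∷ ρ) σ =
  (λ x → trans (nth-nil (toℕ x)) (hue-nil (lookup (nothing ∷ ρ) x))) ,
  (λ k → trans (nth-nil (toℕ k)) (cong encBool (sym (value-false (atom k)))))
  where
  hue-nil : ∀ m → nil ≡ hueᵐ ∅ m
  hue-nil nothing = refl
  value-false : ∀ a → value ∅ (nothing ∷ ρ) σ a ≡ false
  value-false (eqᵃ x y) with lookup (nothing ∷ ρ) x
  ... | nothing = refl
  value-false (adjᵃ x y) with lookup (nothing ∷ ρ) x
  ... | nothing = refl
  value-false (memᵃ x X) with lookup (nothing ∷ ρ) x
  ... | nothing = refl
describes-∅ (vertex b p) ρ σ = describes-∅ p (nothing ∷ ρ) σ , (λ ()) , (λ ())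
describes-∅ (set b p)    ρ σ =
  (λ X → nil , here , describes-∅ p ρ (X ∷ σ)) ,
  (λ { here → (λ ()) , describes-∅ p ρ _ ; (there ()) })

single : Tree → Structure
single c = record { Vtx = ⊤ ; same = λ _ _ → true ; linked = λ _ _ → false ; hue = λ _ → c }

boolᶜ : Bool → Code
boolᶜ true  = yesᶜ
boolᶜ false = nilᶜ

run-bool : ∀ b {x} → run (boolᶜ b) x ≡ encBool b
run-bool true  = refl
run-bool false = refl

-- Atoms of a single vertex do not look at its colour, so their values are computed at generation
-- time with the dummy colour `nil`; only the colour itself is taken from the input.
singleMatrixᶜ : ∀ {i s} → (Vec Bool (#atoms i s) → Bool) → Bool →
                Vec (Maybe ⊤) i → Vec (⊤ → Bool) s → Code
singleMatrixᶜ g true  ρ σ = boolᶜ (g (values (single nil) ρ σ))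
singleMatrixᶜ {i} {s} g false ρ σ =
  consᶜ (boxᶜ (tupleᶜ i λ x → maybe′ (λ _ → itᶜ) nilᶜ (lookup ρ x)))
        (boxᶜ (tupleᶜ (#atoms i s) λ k → boolᶜ (value (single nil) ρ σ (atom k))))

singleᶜ : ∀ {i s} → Prefix i s → Vec (Maybe ⊤) i → Vec (⊤ → Bool) s → Code
singleᶜ (matrix {i} {s} g) ρ σ = singleMatrixᶜ {suc i} {s} g (allᵛ is-just ρ) ρ σ
singleᶜ (vertex _ p) ρ σ =
  consᶜ (boxᶜ (singleᶜ p (nothing ∷ ρ) σ)) (consᶜ (boxᶜ (singleᶜ p (just tt ∷ ρ) σ)) nilᶜ)
singleᶜ (set _ p)    ρ σ =
  consᶜ (boxᶜ (singleᶜ p ρ ((λ _ → false) ∷ σ))) (consᶜ (boxᶜ (singleᶜ p ρ ((λ _ → true) ∷ σ))) nilᶜ)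

value-single : ∀ {i s c d} (ρ : Vec _ i) (σ : Vec _ s) a → value (single c) ρ σ a ≡ value (single d) ρ σ a
value-single ρ σ (eqᵃ x y)  = refl
value-single ρ σ (adjᵃ x y) = refl
value-single ρ σ (memᵃ x X) = refl

describes-single : ∀ {i s} (p : Prefix i s) ρ σ c → Describes (single c) p ρ σ (run (singleᶜ p ρ σ) c)
describes-single (matrix {i} {s} g) ρ σ c = go (allᵛ is-just ρ)
  where
  go : ∀ b → DescribesMatrix (single c) g b ρ σ (run (singleMatrixᶜ {suc i} {s} g b ρ σ) c)
  go true  = trans (run-bool (g (values (single nil) ρ σ)))
                   (cong (encBool ∘ g) (Vec.tabulate-cong λ k → value-single {c = nil} {c} ρ σ (atom k)))
  go false =
    (λ x → trans (run-tuple (λ x → maybe′ (λ _ → itᶜ) nilᶜ (lookup ρ x)) x) (hue-run (lookup ρ x))) ,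
    (λ k → trans (run-tuple (λ k → boolᶜ (value (single nil) ρ σ (atom k))) k)
                 (trans (run-bool (value (single nil) ρ σ (atom k)))
                        (cong encBool (value-single ρ σ (atom k)))))
    where
    hue-run : ∀ m → run (maybe′ (λ _ → itᶜ) nilᶜ m) c ≡ hueᵐ (single c) m
    hue-run (just _) = refl
    hue-run nothing  = refl
describes-single (vertex b p) ρ σ c =
  describes-single p (nothing ∷ ρ) σ c ,
  (λ v → _ , here , describes-single p (just tt ∷ ρ) σ c) ,
  (λ { here → tt , describes-single p (just tt ∷ ρ) σ c ; (there ()) })
describes-single (set b p) ρ σ c =
  (λ X → find X (X tt) refl) ,
  (λ { here         → _ , describes-single p ρ ((λ _ → false) ∷ σ) c
     ; (there here) → _ , describes-single p ρ ((λ _ → true) ∷ σ) c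
     ; (there (there ())) })
  where
  t₀ = run (singleᶜ p ρ ((λ _ → false) ∷ σ)) c
  t₁ = run (singleᶜ p ρ ((λ _ → true) ∷ σ)) c
  -- By η for `⊤`, `X` is definitionally the constant function with value `X tt`, so the two listed
  -- types cover all sets.
  find : ∀ X d → X tt ≡ d → ∃[ u ] (u ∈ᵗ t₀ ∙ t₁ ∙ nil × Describes (single c) p ρ (X ∷ σ) u)
  find X false e = t₀ , here , subst (λ d → Describes (single c) p ρ ((λ _ → d) ∷ σ) t₀) (sym e)
                                     (describes-single p ρ ((λ _ → false) ∷ σ) c)
  find X true  e = t₁ , there here , subst (λ d → Describes (single c) p ρ ((λ _ → d) ∷ σ) t₁) (sym e)
                                     (describes-single p ρ ((λ _ → true) ∷ σ) c)

singleton∈sublists : ∀ {u} l {L} → nil ∈ᵗ L → u ∈ᵗ l → u ∙ nil ∈ᵗ sublists l L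
singleton∈sublists (u ∙ l) {L} nil∈ here =
  ∈-sublists⁺ʳ l (∈-pairs⁺ {_∙_} {xs = u ∙ nil} {L} here nil∈)
singleton∈sublists (v ∙ l) {L} nil∈ (there u∈) =
  singleton∈sublists l (∈-pairs⁺ʳ {_∙_} (v ∙ nil) {L} nil∈) u∈

single∈univ : ∀ {i s ω c} (p : Prefix i s) ρ σ → c ∈ᵗ colors ω → nil ∈ᵗ colors ω →
              run (singleᶜ p ρ σ) c ∈ᵗ univ p (allᵛ is-just ρ) ω
single∈univ {ω = ω} {c} (matrix {i} {s} g) ρ σ c∈ nil∈ = go (allᵛ is-just ρ)
  where
  bool∈ : ∀ b {x} → run (boolᶜ b) x ∈ᵗ bools
  bool∈ b {x} = subst (_∈ᵗ bools) (sym (run-bool b {x})) (encBool∈bools b)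
  hue∈ : ∀ m → run (maybe′ (λ _ → itᶜ) nilᶜ m) c ∈ᵗ colors ω
  hue∈ (just _) = c∈
  hue∈ nothing  = nil∈
  go : ∀ b → run (singleMatrixᶜ {suc i} {s} g b ρ σ) c ∈ᵗ univ (matrix {i} {s} g) b ω
  go true  = bool∈ (g (values (single nil) ρ σ))
  go false = ∈-pairs⁺ {_∙_}
    (tuple∈power (suc i) (λ x → maybe′ (λ _ → itᶜ) nilᶜ (lookup ρ x)) λ x → hue∈ (lookup ρ x))
    (tuple∈power (#atoms (suc i) s) (λ k → boolᶜ (value (single nil) ρ σ (atom k)))
                 λ k → bool∈ (value (single nil) ρ σ (atom k)))
single∈univ {ω = ω} {c} (vertex b p) ρ σ c∈ nil∈ =
  ∈-pairs⁺ {_∙_} (single∈univ p (nothing ∷ ρ) σ c∈ nil∈)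
    (singleton∈sublists (univ p (allᵛ is-just ρ) ω) here (single∈univ p (just tt ∷ ρ) σ c∈ nil∈))
single∈univ {ω = ω} {c} (set b p) ρ σ c∈ nil∈ =
  ∈-pairs⁺ {_∙_} (single∈univ p ρ ((λ _ → false) ∷ σ) c∈ nil∈)
    (singleton∈sublists (univ p (allᵛ is-just ρ) ω) here (single∈univ p ρ ((λ _ → true) ∷ σ) c∈ nil∈))

-- Evaluating a formula on the type of a structure.

Holds : (A : Structure) → ∀ {i s} → Prefix i s → Vec (Vtx A) i → Vec (Vtx A → Bool) s → Set
Holds A (matrix g)       ρ σ = g (values A (Vec.map just ρ) σ) ≡ true
Holds A (vertex true p)  ρ σ = ∃[ v ] Holds A p (v ∷ ρ) σ
Holds A (vertex false p) ρ σ = ∀ v → Holds A p (v ∷ ρ) σ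
Holds A (set true p)     ρ σ = ∃[ X ] Holds A p ρ (X ∷ σ)
Holds A (set false p)    ρ σ = ∀ X → Holds A p ρ (X ∷ σ)

truth : Tree → Bool
truth nil     = false
truth (_ ∙ _) = true

truth-encBool : ∀ b → truth (encBool b) ≡ b
truth-encBool true  = refl
truth-encBool false = refl

quantify : Bool → (Tree → Bool) → Tree → Bool
quantify b     f nil     = not b
quantify true  f (u ∙ l) = f u ∨ quantify true f l
quantify false f (u ∙ l) = f u ∧ quantify false f l

-- At the root all vertices are inside, so the alternative of an outside vertex, stored in the head
-- at a vertex quantifier, is skipped. At a set quantifier the head is a type like the others.
eval : ∀ {i s} → Prefix i s → Tree → Bool
eval (matrix g)   t = truth t
eval (vertex b p) t = quantify b (eval p) (tail t)
eval (set b p)    t = quantify b (eval p) (head t ∙ tail t)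

quantifyᶜ : Bool → Code → Code
quantifyᶜ true  c =
  consᶜ itᶜ (consᶜ nilᶜ nilᶜ) ▸ foldᶜ (ifᶜ (hdᶜ ▸ boxᶜ c) yesᶜ (argᶜ 1))
quantifyᶜ false c =
  consᶜ itᶜ (consᶜ yesᶜ nilᶜ) ▸ foldᶜ (ifᶜ (hdᶜ ▸ boxᶜ c) (argᶜ 1) nilᶜ)

evalᶜ : ∀ {i s} → Prefix i s → Code
evalᶜ (matrix g)   = ifᶜ itᶜ yesᶜ nilᶜ
evalᶜ (vertex b p) = tlᶜ ▸ quantifyᶜ b (evalᶜ p)
evalᶜ (set b p)    = consᶜ hdᶜ tlᶜ ▸ quantifyᶜ b (evalᶜ p)

run-quantify : ∀ b {c f} → (∀ t → run c t ≡ encBool (f t)) → ∀ l →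
               run (quantifyᶜ b c) l ≡ encBool (quantify b f l)
run-quantify true {c} {f} h l = go l false
  where
  go : ∀ l b → runFold (ifᶜ (hdᶜ ▸ boxᶜ c) yesᶜ (argᶜ 1)) l (encBool b) nil ≡ encBool (b ∨ quantify true f l)
  go nil     true  = refl
  go nil     false = refl
  go (u ∙ l) b rewrite h u with f u
  go (u ∙ l) true  | true  = go l true
  go (u ∙ l) false | true  = go l true
  go (u ∙ l) b     | false = go l b
run-quantify false {c} {f} h l = go l true
  where
  go : ∀ l b → runFold (ifᶜ (hdᶜ ▸ boxᶜ c) (argᶜ 1) nilᶜ) l (encBool b) nil ≡ encBool (b ∧ quantify false f l)
  go nil     true  = refl
  go nil     false = refl
  go (u ∙ l) b rewrite h u with f u
  go (u ∙ l) b     | true  = go l b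
  go (u ∙ l) true  | false = go l false
  go (u ∙ l) false | false = go l false

run-eval : ∀ {i s} (p : Prefix i s) t → run (evalᶜ p) t ≡ encBool (eval p t)
run-eval (matrix g)   nil     = refl
run-eval (matrix g)   (_ ∙ _) = refl
run-eval (vertex b p) t = run-quantify b (run-eval p) (tail t)
run-eval (set b p)    t = run-quantify b (run-eval p) (head t ∙ tail t)

any⁺ : ∀ {f u l} → u ∈ᵗ l → f u ≡ true → quantify true f l ≡ true
any⁺ here fu rewrite fu = refl
any⁺ {f} {l = v ∙ l} (there u∈) fu with f v
... | true  = refl
... | false = any⁺ u∈ fu

any⁻ : ∀ {f} l → quantify true f l ≡ true → ∃[ u ] (u ∈ᵗ l × f u ≡ true)
any⁻ {f} (v ∙ l) h with f v in fv
... | true  = v , here , fv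
... | false with any⁻ l h
...   | u , u∈ , fu = u , there u∈ , fu

all⁺ : ∀ {f} l → (∀ {u} → u ∈ᵗ l → f u ≡ true) → quantify false f l ≡ true
all⁺ nil     h = refl
all⁺ (v ∙ l) h rewrite h here = all⁺ l (h ∘ there)

all⁻ : ∀ {f u l} → quantify false f l ≡ true → u ∈ᵗ l → f u ≡ true
all⁻ {f} {l = v ∙ l} h u∈ with f v in fv
all⁻ h here       | true = fv
all⁻ h (there u∈) | true = all⁻ h u∈

is-just-map : ∀ {V : Set} {n} (ρ : Vec V n) → allᵛ is-just (Vec.map just ρ) ≡ true
is-just-map []      = refl
is-just-map (v ∷ ρ) = is-just-map ρ

-- `Describes` goes back and forth: every value has its type listed, and every listed type has a
-- value. Soundness uses the second clause for ∃ and the first for ∀; `eval-complete` uses them the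
-- other way round.
eval-sound : ∀ {A i s} (p : Prefix i s) ρ σ {t} → Describes A p (Vec.map just ρ) σ t →
             eval p t ≡ true → Holds A p ρ σ
eval-complete : ∀ {A i s} (p : Prefix i s) ρ σ {t} → Describes A p (Vec.map just ρ) σ t →
                Holds A p ρ σ → eval p t ≡ true
eval-sound {A} (matrix g) ρ σ D h rewrite is-just-map ρ | D = trans (sym (truth-encBool _)) h
eval-sound (vertex true p) ρ σ {t} (_ , _ , D⁻) h with any⁻ (tail t) h
... | u , u∈ , hu with D⁻ u∈
...   | v , Dv = v , eval-sound p (v ∷ ρ) σ Dv hu
eval-sound (vertex false p) ρ σ (_ , D⁺ , _) h v with D⁺ v
... | u , u∈ , Dv = eval-sound p (v ∷ ρ) σ Dv (all⁻ h u∈)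
eval-sound (set true p) ρ σ {t} (_ , D⁻) h with any⁻ (head t ∙ tail t) h
... | u , u∈ , hu with D⁻ u∈
...   | X , DX = X , eval-sound p ρ (X ∷ σ) DX hu
eval-sound (set false p) ρ σ (D⁺ , _) h X with D⁺ X
... | u , u∈ , DX = eval-sound p ρ (X ∷ σ) DX (all⁻ h u∈)
eval-complete (matrix g) ρ σ D h rewrite is-just-map ρ | D = trans (truth-encBool _) h
eval-complete (vertex true p) ρ σ (_ , D⁺ , _) (v , hv) with D⁺ v
... | u , u∈ , Dv = any⁺ u∈ (eval-complete p (v ∷ ρ) σ Dv hv)
eval-complete (vertex false p) ρ σ {t} (_ , _ , D⁻) h = all⁺ (tail t) λ u∈ →
  let v , Dv = D⁻ u∈ in eval-complete p (v ∷ ρ) σ Dv (h v)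
eval-complete (set true p) ρ σ (D⁺ , _) (X , hX) with D⁺ X
... | u , u∈ , DX = any⁺ u∈ (eval-complete p ρ (X ∷ σ) DX hX)
eval-complete (set false p) ρ σ {t} (_ , D⁻) h = all⁺ (head t ∙ tail t) λ u∈ →
  let X , DX = D⁻ u∈ in eval-complete p ρ (X ∷ σ) DX (h X)

-- The graph built by a decomposition

module _ {ω : ℕ} where

  0<ω : Fin ω → 0 < ω
  0<ω a = ≤-trans (s≤s z≤n) (Fin.toℕ<n a)

  encFin-injective : ∀ {a b : Fin ω} → encFin a ≡ encFin b → a ≡ b
  encFin-injective {a} {b} e = Fin.toℕ-injective (encℕ-injective (toℕ a) (toℕ b) e)

  encFin∈colors : ∀ (a : Fin ω) → encFin a ∈ᵗ colors ω
  encFin∈colors a = encℕ∈colors (Fin.toℕ<n a)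

  hueᴰ : ∀ D → Vertex {ω} D → Tree
  hueᴰ D v = encFin (color D v)

  -- Colour 0 is replaced by colour 0, so this is the identity.
  noRecolor : Tree
  noRecolor = nil ∙ nil

  recolorᵗ-≢ : ∀ {a b c} → c ≢ a → recolorᵗ (a ∙ b) c ≡ c
  recolorᵗ-≢ {a} {b} {c} c≢a with c ≟ᵗ a
  ... | yes e = ⊥-elim (c≢a e)
  ... | no  _ = refl

  recolorᵗ-≡ : ∀ a b → recolorᵗ (a ∙ b) a ≡ b
  recolorᵗ-≡ a b with a ≟ᵗ a
  ... | yes _ = refl
  ... | no ne = ⊥-elim (ne refl)

  recolorᵗ-id : ∀ a c → recolorᵗ (a ∙ a) c ≡ c
  recolorᵗ-id a c with c ≟ᵗ a
  ... | yes refl = refl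
  ... | no  _    = refl

  hue-recolor : ∀ t a b v → hueᴰ (recolor t a b) v ≡ recolorᵗ (encFin a ∙ encFin b) (hueᴰ t v)
  hue-recolor t a b v with color t v Fin.≟ a
  ... | yes refl = sym (recolorᵗ-≡ (encFin a) (encFin b))
  ... | no ne    = sym (recolorᵗ-≢ (ne ∘ encFin-injective))

  -- Translates the pairs joined above a node into the colours of its child. Filtering the fixed
  -- list of all pairs keeps the length at most ω² at any depth. For this reason `addEdges` also
  -- pulls back, along the identity: its two new pairs would otherwise accumulate on the way down.
  pullback : Tree → Tree → Tree
  pullback r F =
    filter (λ c → encBool (member (recolorᵗ r (head c) ∙ recolorᵗ r (tail c)) F)) (cart (colors ω) (colors ω)) nil

  bool-ext : ∀ {a b} → (a ≡ true → b ≡ true) → (b ≡ true → a ≡ true) → a ≡ b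
  bool-ext {true}  {true}  f g = refl
  bool-ext {true}  {false} f g = sym (f refl)
  bool-ext {false} {true}  f g = g refl
  bool-ext {false} {false} f g = refl

  member-pullback : ∀ r F {c d} → c ∈ᵗ colors ω → d ∈ᵗ colors ω →
    member (c ∙ d) (pullback r F) ≡ member (recolorᵗ r c ∙ recolorᵗ r d) F
  member-pullback r F {c} {d} c∈ d∈ = bool-ext to from
    where
    P : Tree → Bool
    P c = member (recolorᵗ r (head c) ∙ recolorᵗ r (tail c)) F
    to : member (c ∙ d) (pullback r F) ≡ true → P (c ∙ d) ≡ true
    to h with ∈-filter⁻ {P} (cart (colors ω) (colors ω)) (member⁻ (pullback r F) h)
    ... | inj₂ (_ , e) = e
    from : P (c ∙ d) ≡ true → member (c ∙ d) (pullback r F) ≡ true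
    from h = member⁺ (∈-filter⁺ {P} {c ∙ d} {cart (colors ω) (colors ω)} (∈-pairs⁺ {_∙_} c∈ d∈) h)

  joined : Fin ω → Fin ω → Tree → Tree
  joined a b F = (encFin a ∙ encFin b) ∙ (encFin b ∙ encFin a) ∙ F

  -- F lists the pairs of colours of D that are joined by the operations above D.
  linkedᴰ : ∀ D → Tree → Vertex {ω} D → Vertex D → Bool
  linkedᴰ (intro a)        F _        _        = false
  linkedᴰ (t₁ ⊕ t₂)        F (inj₁ u) (inj₁ v) = linkedᴰ t₁ F u v
  linkedᴰ (t₁ ⊕ t₂)        F (inj₁ u) (inj₂ v) = member (hueᴰ t₁ u ∙ hueᴰ t₂ v) F
  linkedᴰ (t₁ ⊕ t₂)        F (inj₂ u) (inj₁ v) = member (hueᴰ t₂ u ∙ hueᴰ t₁ v) F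
  linkedᴰ (t₁ ⊕ t₂)        F (inj₂ u) (inj₂ v) = linkedᴰ t₂ F u v
  linkedᴰ (recolor t a b)  F                   = linkedᴰ t (pullback (encFin a ∙ encFin b) F)
  linkedᴰ (addEdges t a b) F                   = linkedᴰ t (pullback (encFin a ∙ encFin a) (joined a b F))

  sameᴰ : ∀ D → Vertex {ω} D → Vertex D → Bool
  sameᴰ (intro a)        _        _        = true
  sameᴰ (t₁ ⊕ t₂)        (inj₁ u) (inj₁ v) = sameᴰ t₁ u v
  sameᴰ (t₁ ⊕ t₂)        (inj₁ u) (inj₂ v) = false
  sameᴰ (t₁ ⊕ t₂)        (inj₂ u) (inj₁ v) = false
  sameᴰ (t₁ ⊕ t₂)        (inj₂ u) (inj₂ v) = sameᴰ t₂ u v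
  sameᴰ (recolor t a b)                    = sameᴰ t
  sameᴰ (addEdges t a b)                   = sameᴰ t

  structure : Decomp ω → Tree → Structure
  structure D F = record { Vtx = Vertex D ; same = sameᴰ D ; linked = linkedᴰ D F ; hue = hueᴰ D }

  sameᴰ-sound : ∀ D {u v} → sameᴰ D u v ≡ true → u ≡ v
  sameᴰ-sound (intro a)        e = refl
  sameᴰ-sound (t₁ ⊕ t₂)        {inj₁ u} {inj₁ v} e = cong inj₁ (sameᴰ-sound t₁ e)
  sameᴰ-sound (t₁ ⊕ t₂)        {inj₂ u} {inj₂ v} e = cong inj₂ (sameᴰ-sound t₂ e)
  sameᴰ-sound (recolor t a b)  e = sameᴰ-sound t e
  sameᴰ-sound (addEdges t a b) e = sameᴰ-sound t e

  sameᴰ-refl : ∀ D v → sameᴰ D v v ≡ true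
  sameᴰ-refl (intro a)        v        = refl
  sameᴰ-refl (t₁ ⊕ t₂)        (inj₁ v) = sameᴰ-refl t₁ v
  sameᴰ-refl (t₁ ⊕ t₂)        (inj₂ v) = sameᴰ-refl t₂ v
  sameᴰ-refl (recolor t a b)  v        = sameᴰ-refl t v
  sameᴰ-refl (addEdges t a b) v        = sameᴰ-refl t v

  Joinable : ∀ D → Tree → Vertex {ω} D → Vertex D → Set
  Joinable D F u v = u ≢ v × member (hueᴰ D u ∙ hueᴰ D v) F ≡ true

  member-addEdges : ∀ (t : Decomp ω) a b F u v →
    member (hueᴰ t u ∙ hueᴰ t v) (pullback (encFin a ∙ encFin a) (joined a b F))
      ≡ member (hueᴰ t u ∙ hueᴰ t v) (joined a b F)
  member-addEdges t a b F u v =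
    trans (member-pullback (encFin a ∙ encFin a) (joined a b F)
             (encFin∈colors (color t u)) (encFin∈colors (color t v)))
          (cong₂ (λ c d → member (c ∙ d) (joined a b F))
                 (recolorᵗ-id (encFin a) (hueᴰ t u)) (recolorᵗ-id (encFin a) (hueᴰ t v)))

  member-recolor : ∀ (t : Decomp ω) a b F u v →
    member (hueᴰ t u ∙ hueᴰ t v) (pullback (encFin a ∙ encFin b) F)
      ≡ member (hueᴰ (recolor t a b) u ∙ hueᴰ (recolor t a b) v) F
  member-recolor t a b F u v =
    trans (member-pullback (encFin a ∙ encFin b) F
             (encFin∈colors (color t u)) (encFin∈colors (color t v)))
          (cong₂ (λ c d → member (c ∙ d) F) (sym (hue-recolor t a b u)) (sym (hue-recolor t a b v)))

  -- The general `F` makes the induction possible: a pair is adjacent in the end if its edge is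
  -- already built or if its present colours are joined later. At the root `F` is `nil`, and only
  -- the edges of the decomposition remain.
  linkedᴰ-sound : ∀ D F {u v} → linkedᴰ D F u v ≡ true → Edge D u v ⊎ Joinable D F u v
  linkedᴰ-sound (t₁ ⊕ t₂) F {inj₁ u} {inj₁ v} e with linkedᴰ-sound t₁ F e
  ... | inj₁ uv       = inj₁ (inˡ uv)
  ... | inj₂ (ne , m) = inj₂ ((λ { refl → ne refl }) , m)
  linkedᴰ-sound (t₁ ⊕ t₂) F {inj₁ u} {inj₂ v} e = inj₂ ((λ ()) , e)
  linkedᴰ-sound (t₁ ⊕ t₂) F {inj₂ u} {inj₁ v} e = inj₂ ((λ ()) , e)
  linkedᴰ-sound (t₁ ⊕ t₂) F {inj₂ u} {inj₂ v} e with linkedᴰ-sound t₂ F e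
  ... | inj₁ uv       = inj₁ (inʳ uv)
  ... | inj₂ (ne , m) = inj₂ ((λ { refl → ne refl }) , m)
  linkedᴰ-sound (recolor t a b) F {u} {v} e with linkedᴰ-sound t _ e
  ... | inj₁ uv       = inj₁ (inRec uv)
  ... | inj₂ (ne , m) = inj₂ (ne , trans (sym (member-recolor t a b F u v)) m)
  linkedᴰ-sound (addEdges t a b) F {u} {v} e with linkedᴰ-sound t _ e
  ... | inj₁ uv       = inj₁ (inAdd uv)
  ... | inj₂ (ne , m) = go (member⁻ (joined a b F) (trans (sym (member-addEdges t a b F u v)) m)) refl
    where
    go : ∀ {c} → c ∈ᵗ joined a b F → c ≡ hueᴰ t u ∙ hueᴰ t v →
         Edge (addEdges t a b) u v ⊎ Joinable (addEdges t a b) F u v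
    go here             e = inj₁ (new ne (encFin-injective (sym (∙-injectiveˡ e))) (encFin-injective (sym (∙-injectiveʳ e))))
    go (there here)     e = inj₁ (new′ ne (encFin-injective (sym (∙-injectiveˡ e))) (encFin-injective (sym (∙-injectiveʳ e))))
    go (there (there m)) refl = inj₂ (ne , member⁺ m)

  linkedᴰ-complete : ∀ D F {u v} → Edge D u v ⊎ Joinable D F u v → linkedᴰ D F u v ≡ true
  linkedᴰ-complete (intro a) F (inj₂ (ne , _)) = ⊥-elim (ne refl)
  linkedᴰ-complete (t₁ ⊕ t₂) F (inj₁ (inˡ uv)) = linkedᴰ-complete t₁ F (inj₁ uv)
  linkedᴰ-complete (t₁ ⊕ t₂) F (inj₁ (inʳ uv)) = linkedᴰ-complete t₂ F (inj₁ uv)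
  linkedᴰ-complete (t₁ ⊕ t₂) F {inj₁ u} {inj₁ v} (inj₂ (ne , m)) =
    linkedᴰ-complete t₁ F (inj₂ (ne ∘ cong inj₁ , m))
  linkedᴰ-complete (t₁ ⊕ t₂) F {inj₁ u} {inj₂ v} (inj₂ (ne , m)) = m
  linkedᴰ-complete (t₁ ⊕ t₂) F {inj₂ u} {inj₁ v} (inj₂ (ne , m)) = m
  linkedᴰ-complete (t₁ ⊕ t₂) F {inj₂ u} {inj₂ v} (inj₂ (ne , m)) =
    linkedᴰ-complete t₂ F (inj₂ (ne ∘ cong inj₂ , m))
  linkedᴰ-complete (recolor t a b) F (inj₁ (inRec uv)) = linkedᴰ-complete t _ (inj₁ uv)
  linkedᴰ-complete (recolor t a b) F {u} {v} (inj₂ (ne , m)) =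
    linkedᴰ-complete t _ (inj₂ (ne , trans (member-recolor t a b F u v) m))
  linkedᴰ-complete (addEdges t a b) F (inj₁ (inAdd uv)) = linkedᴰ-complete t _ (inj₁ uv)
  linkedᴰ-complete (addEdges t a b) F {u} {v} (inj₁ (new ne refl refl)) =
    linkedᴰ-complete t _ (inj₂ (ne , trans (member-addEdges t a b F u v) (member⁺ {l = joined a b F} here)))
  linkedᴰ-complete (addEdges t a b) F {u} {v} (inj₁ (new′ ne refl refl)) =
    linkedᴰ-complete t _ (inj₂ (ne , trans (member-addEdges t a b F u v) (member⁺ {l = joined a b F} (there here))))
  linkedᴰ-complete (addEdges t a b) F {u} {v} (inj₂ (ne , m)) =
    linkedᴰ-complete t _ (inj₂ (ne , trans (member-addEdges t a b F u v)
      (member⁺ {l = joined a b F} (there (there (member⁻ F m))))))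

  linkedᴰ-edge : ∀ D {u v} → linkedᴰ D nil u v ≡ true ⇔ Edge D u v
  linkedᴰ-edge D = mk⇔ to (linkedᴰ-complete D nil ∘ inj₁)
    where
    to : ∀ {u v} → linkedᴰ D nil u v ≡ true → Edge D u v
    to e with linkedᴰ-sound D nil e
    ... | inj₁ uv = uv

-- The automaton

-- List versions of `row` and `pairs`. They produce the same elements in the same order, so the
-- output of the program is exactly the encoding of the process sets.
rowₗ : {A : Set} → (Tree → A) → Tree → List A → List A
rowₗ g nil      as = as
rowₗ g (y ∙ ys) as = rowₗ g ys (g y ∷ as)

pairsₗ : {A : Set} → (Tree → Tree → A) → Tree → Tree → List A → List A
pairsₗ g nil      ys as = as
pairsₗ g (x ∙ xs) ys as = pairsₗ g xs ys (rowₗ (g x) ys as)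

module _ {A : Set} where

  ∈-rowₗ⁺ʳ : ∀ {g : Tree → A} {z} ys {as} → z ∈ₗ as → z ∈ₗ rowₗ g ys as
  ∈-rowₗ⁺ʳ nil      z∈ = z∈
  ∈-rowₗ⁺ʳ (y ∙ ys) z∈ = ∈-rowₗ⁺ʳ ys (thereₗ z∈)

  ∈-rowₗ⁺ : ∀ {g : Tree → A} {y ys as} → y ∈ᵗ ys → g y ∈ₗ rowₗ g ys as
  ∈-rowₗ⁺ {ys = _ ∙ ys} here       = ∈-rowₗ⁺ʳ ys (hereₗ refl)
  ∈-rowₗ⁺               (there y∈) = ∈-rowₗ⁺ y∈

  ∈-rowₗ⁻ : ∀ {g : Tree → A} {z} ys {as} → z ∈ₗ rowₗ g ys as → z ∈ₗ as ⊎ ∃[ y ] (y ∈ᵗ ys × z ≡ g y)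
  ∈-rowₗ⁻ nil      z∈ = inj₁ z∈
  ∈-rowₗ⁻ (y ∙ ys) z∈ with ∈-rowₗ⁻ ys z∈
  ... | inj₁ (hereₗ e)        = inj₂ (y , here , e)
  ... | inj₁ (thereₗ z∈′)     = inj₁ z∈′
  ... | inj₂ (y′ , y′∈ , z≡)  = inj₂ (y′ , there y′∈ , z≡)

  ∈-pairsₗ⁺ʳ : ∀ {g : Tree → Tree → A} {z} xs {ys as} → z ∈ₗ as → z ∈ₗ pairsₗ g xs ys as
  ∈-pairsₗ⁺ʳ nil           z∈ = z∈
  ∈-pairsₗ⁺ʳ (x ∙ xs) {ys} z∈ = ∈-pairsₗ⁺ʳ xs (∈-rowₗ⁺ʳ ys z∈)

  ∈-pairsₗ⁺ : ∀ {g : Tree → Tree → A} {x y xs ys as} → x ∈ᵗ xs → y ∈ᵗ ys → g x y ∈ₗ pairsₗ g xs ys as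
  ∈-pairsₗ⁺ {xs = _ ∙ xs} here       y∈ = ∈-pairsₗ⁺ʳ xs (∈-rowₗ⁺ y∈)
  ∈-pairsₗ⁺               (there x∈) y∈ = ∈-pairsₗ⁺ x∈ y∈

  ∈-pairsₗ⁻ : ∀ {g : Tree → Tree → A} {z} xs {ys as} → z ∈ₗ pairsₗ g xs ys as →
              z ∈ₗ as ⊎ ∃[ x ] ∃[ y ] (x ∈ᵗ xs × y ∈ᵗ ys × z ≡ g x y)
  ∈-pairsₗ⁻ nil           z∈ = inj₁ z∈
  ∈-pairsₗ⁻ (x ∙ xs) {ys} z∈ with ∈-pairsₗ⁻ xs z∈
  ... | inj₂ (x′ , y , x′∈ , y∈ , z≡) = inj₂ (x′ , y , there x′∈ , y∈ , z≡)
  ... | inj₁ z∈′ with ∈-rowₗ⁻ ys z∈′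
  ...   | inj₁ z∈″           = inj₁ z∈″
  ...   | inj₂ (y , y∈ , z≡) = inj₂ (x , y , here , y∈ , z≡)

  encList-row : ∀ (enc : A → Tree) g ys as →
                encList enc (rowₗ g ys as) ≡ row (enc ∘ g) ys (encList enc as)
  encList-row enc g nil      as = refl
  encList-row enc g (y ∙ ys) as = encList-row enc g ys (g y ∷ as)

  encList-pairs : ∀ (enc : A → Tree) g xs ys as →
                  encList enc (pairsₗ g xs ys as) ≡ pairs (λ x y → enc (g x y)) xs ys (encList enc as)
  encList-pairs enc g nil      ys as = refl
  encList-pairs enc g (x ∙ xs) ys as =
    trans (encList-pairs enc g xs ys _) (cong (pairs (λ x y → enc (g x y)) xs ys) (encList-row enc (g x) ys as))

-- A state is a pair of a membership bit and a type. In Polish notation its first letter announces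
-- the pair and the second is the bit; the word is reversed because `ser` writes backwards.
bitOf : Bits → Bool
bitOf bs with reverse bs
... | _ ∷ b ∷ _ = b
... | _         = false

bitOf-ser : ∀ b t → bitOf (ser (encBool b ∙ t)) ≡ b
bitOf-ser b t rewrite reverse-ser (encBool b ∙ t) with b
... | true  = refl
... | false = refl

module _ {ω : ℕ} where

  extendByEmpty : ∀ {A : Structure} {hue′ : Vtx A → Tree} F r → nil ∈ᵗ colors ω →
                  (∀ v → hue′ v ∈ᵗ colors ω) → (∀ v → hue′ v ≡ recolorᵗ r (hue A v)) →
                  IsJoin A ∅ (record { Vtx = Vtx A ; same = same A ; linked = linked A ; hue = hue′ }) F r ω
  extendByEmpty F r nil∈ hue∈ hue≡ = record
    { inl = λ v → v ; inr = λ () ; split = inj₁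
    ; split-inl = λ _ → refl ; split-inr = λ () ; unsplit = λ _ → refl
    ; same-ll = λ _ _ → refl ; same-rr = λ () ; same-lr = λ _ () ; same-rl = λ ()
    ; linked-ll = λ _ _ → refl ; linked-rr = λ () ; linked-lr = λ _ () ; linked-rl = λ ()
    ; hue-l = hue≡ ; hue-r = λ () ; hue∈ = hue∈ ; nil∈ = nil∈ }

  recolorᵗ-noRecolor : ∀ c → c ≡ recolorᵗ (nil ∙ nil) c
  recolorᵗ-noRecolor c = sym (recolorᵗ-id {ω} nil c)

  ⊕-isJoin : ∀ (t₁ t₂ : Decomp ω) F → nil ∈ᵗ colors ω →
             IsJoin (structure t₁ F) (structure t₂ F) (structure (t₁ ⊕ t₂) F) F (noRecolor {ω}) ω
  ⊕-isJoin t₁ t₂ F nil∈ = record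
    { inl = inj₁ ; inr = inj₂ ; split = λ v → v
    ; split-inl = λ _ → refl ; split-inr = λ _ → refl
    ; unsplit = λ { (inj₁ _) → refl ; (inj₂ _) → refl }
    ; same-ll = λ _ _ → refl ; same-rr = λ _ _ → refl ; same-lr = λ _ _ → refl ; same-rl = λ _ _ → refl
    ; linked-ll = λ _ _ → refl ; linked-rr = λ _ _ → refl ; linked-lr = λ _ _ → refl ; linked-rl = λ _ _ → refl
    ; hue-l = λ u → recolorᵗ-noRecolor (hueᴰ t₁ u) ; hue-r = λ _ → refl
    ; hue∈ = λ v → encFin∈colors (color (t₁ ⊕ t₂) v) ; nil∈ = nil∈ }

  0<width : Decomp ω → 0 < ω
  0<width (intro a)        = 0<ω a
  0<width (t₁ ⊕ t₂)        = 0<width t₁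
  0<width (recolor t a b)  = 0<ω a
  0<width (addEdges t a b) = 0<ω a

module _ (p : Prefix 0 1) where

  module _ {ω : ℕ} where

    -- The bit is set at leaves whose vertex is chosen and is `nil` at inner nodes. It doubles the
    -- universe, hence the factor 2 in the count of states.
    states : Tree
    states = cart bools (univ p true ω)

    plainEnv : Tree → Tree
    plainEnv F = F ∙ (nil ∙ nil) ∙ encℕ ω

    recolorEnv addEdgesEnv : Fin ω → Fin ω → Tree → Tree
    recolorEnv  a b F = F ∙ (encFin a ∙ encFin b) ∙ encℕ ω
    addEdgesEnv a b F = joined a b F ∙ (encFin a ∙ encFin a) ∙ encℕ ω

    -- The environment of a node with one child contains all that is needed to compute the context
    -- of the child. Recolouring and edge insertion therefore share one step of the program and
    -- differ only in their environments.
    childContext : Tree → Tree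
    childContext e = pullback {ω} (head (tail e)) (head e)

    leafState : Fin ω → Bool → Tree
    leafState a b = encBool b ∙ run (singleᶜ p [] ((λ _ → b) ∷ [])) (encFin a)

    unaryState : Tree → Tree → Tree
    unaryState e s = nil ∙ join p [] e (tail s) nil

    binaryState : Tree → Tree → Tree → Tree
    binaryState e s s′ = nil ∙ join p [] e (tail s) (tail s′)

    stateᴰ : ∀ D → Tree → (Vertex {ω} D → Bool) → Tree
    stateᴰ (intro a)        F S = leafState a (S tt)
    stateᴰ (t₁ ⊕ t₂)        F S =
      binaryState (plainEnv F) (stateᴰ t₁ F (S ∘ inj₁)) (stateᴰ t₂ F (S ∘ inj₂))
    stateᴰ (recolor t a b)  F S = unaryState e (stateᴰ t (childContext e) S)
      where e = recolorEnv a b F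
    stateᴰ (addEdges t a b) F S = unaryState e (stateᴰ t (childContext e) S)
      where e = addEdgesEnv a b F

    private
      noVariables : ∀ {A B C : Structure} {F r} (J : IsJoin A B C F r ω) {X Y Z} →
                    (∀ a → Z (IsJoin.inl J a) ≡ X a) → (∀ b → Z (IsJoin.inr J b) ≡ Y b) →
                    Splitting J [] [] [] [] (X ∷ []) (Y ∷ []) (Z ∷ [])
      noVariables J hl hr = record { part = λ () ; set-l = λ { zero → hl } ; set-r = λ { zero → hr } }

    stateᴰ-describes : ∀ D F S → Describes (structure D F) p [] (S ∷ []) (tail (stateᴰ D F S)) ×
                                 tail (stateᴰ D F S) ∈ᵗ univ p true ω
    stateᴰ-describes (intro a) F S =
      describes-single p [] (S ∷ []) (encFin a) ,
      single∈univ p [] (S ∷ []) (encFin∈colors a) (encℕ∈colors (0<ω a))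
    stateᴰ-describes (t₁ ⊕ t₂) F S =
      describes-join j p (noVariables j (λ _ → refl) (λ _ → refl))
        (proj₁ (stateᴰ-describes t₁ F (S ∘ inj₁))) (proj₁ (stateᴰ-describes t₂ F (S ∘ inj₂)))
      where j = ⊕-isJoin t₁ t₂ F (encℕ∈colors (0<width t₁))
    stateᴰ-describes (recolor t a b) F S =
      describes-join j p (noVariables j {Y = λ ()} (λ _ → refl) (λ ()))
        (proj₁ (stateᴰ-describes t (childContext (recolorEnv a b F)) S)) (describes-∅ p [] ((λ ()) ∷ []))
      where j = extendByEmpty {A = structure t (childContext (recolorEnv a b F))} F (encFin a ∙ encFin b)
                  (encℕ∈colors (0<ω a)) (λ v → encFin∈colors (color (recolor t a b) v)) (hue-recolor t a b)
    stateᴰ-describes (addEdges t a b) F S =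
      describes-join j p (noVariables j {Y = λ ()} (λ _ → refl) (λ ()))
        (proj₁ (stateᴰ-describes t (childContext (addEdgesEnv a b F)) S)) (describes-∅ p [] ((λ ()) ∷ []))
      where j = extendByEmpty {A = structure t (childContext (addEdgesEnv a b F))} (joined a b F)
                  (encFin a ∙ encFin a) (encℕ∈colors (0<ω a)) (λ v → encFin∈colors (color t v))
                  (λ v → sym (recolorᵗ-id {ω} (encFin a) (hueᴰ t v)))

    stateᴰ∈states : ∀ D F S → stateᴰ D F S ∈ᵗ states
    stateᴰ∈states D F S = go D (proj₂ (stateᴰ-describes D F S))
      where
      go : ∀ D {F S} → tail (stateᴰ D F S) ∈ᵗ univ p true ω → stateᴰ D F S ∈ᵗ states
      go (intro a) {S = S}  = ∈-pairs⁺ {_∙_} {xs = bools} {univ p true ω} (encBool∈bools (S tt))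
      go (t₁ ⊕ t₂)          = ∈-pairs⁺ {_∙_} {xs = bools} {univ p true ω} here
      go (recolor t a b)    = ∈-pairs⁺ {_∙_} {xs = bools} {univ p true ω} here
      go (addEdges t a b)   = ∈-pairs⁺ {_∙_} {xs = bools} {univ p true ω} here

    leafWord : Fin ω → Bool → Vec Bits 1
    leafWord a b = ser (leafState a b) ∷ []

    -- The last argument receives the element of the one-element list that turns `pairsₗ` into a
    -- map.
    unaryWord : Tree → Tree → Tree → Vec Bits 2
    unaryWord e s _ = ser (unaryState e s) ∷ ser s ∷ []

    binaryWord : Tree → Tree → Tree → Vec Bits 3
    binaryWord e s s′ = ser (binaryState e s s′) ∷ ser s ∷ ser s′ ∷ []

    -- Child states range over the whole universe, whether realized or not, so no reachability has
    -- to be computed. Each process set at an inner node is the graph of a function of the child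
    -- states.
    processᴰ : (D : Decomp ω) → Tree → (t : Node D) → List (Vec Bits (suc (δ t)))
    processᴰ (intro a)        F root      = leafWord a false ∷ leafWord a true ∷ []
    processᴰ (t₁ ⊕ t₂)        F root      = pairsₗ (binaryWord (plainEnv F)) states states []
    processᴰ (t₁ ⊕ t₂)        F (left n)  = processᴰ t₁ F n
    processᴰ (t₁ ⊕ t₂)        F (right n) = processᴰ t₂ F n
    processᴰ (recolor t a b)  F root      = pairsₗ (unaryWord (recolorEnv a b F)) states (nil ∙ nil) []
    processᴰ (recolor t a b)  F (inRec n) = processᴰ t (childContext (recolorEnv a b F)) n
    processᴰ (addEdges t a b) F root      = pairsₗ (unaryWord (addEdgesEnv a b F)) states (nil ∙ nil) []
    processᴰ (addEdges t a b) F (inAdd n) = processᴰ t (childContext (addEdgesEnv a b F)) n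

    acceptedStates : Tree
    acceptedStates = filter (λ s → encBool (eval p (tail s))) states nil

    acceptᴰ : List Bits
    acceptᴰ = pairsₗ (λ s _ → ser s) acceptedStates (nil ∙ nil) []

    Local : (D : Decomp ω) → Tree → (Node D → Bits) → Set
    Local D F α = ∀ t → (α t ∷ Vec.map α (children t)) ∈ₗ processᴰ D F t

    private
      inside-child : ∀ {D D′ : Decomp ω} (f : Node D → Node D′) {α : Node D′ → Bits} n →
        ∀ {ws : List (Vec Bits (suc (δ n)))} →
        (α (f n) ∷ Vec.map α (Vec.map f (children n))) ∈ₗ ws →
        (α (f n) ∷ Vec.map (α ∘ f) (children n)) ∈ₗ ws
      inside-child f {α} n {ws} = subst (λ v → (α (f n) ∷ v) ∈ₗ ws) (sym (Vec.map-∘ α f (children n)))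

      inside-child⁻ : ∀ {D D′ : Decomp ω} (f : Node D → Node D′) {α : Node D′ → Bits} n →
        ∀ {ws : List (Vec Bits (suc (δ n)))} →
        (α (f n) ∷ Vec.map (α ∘ f) (children n)) ∈ₗ ws →
        (α (f n) ∷ Vec.map α (Vec.map f (children n))) ∈ₗ ws
      inside-child⁻ f {α} n {ws} = subst (λ v → (α (f n) ∷ v) ∈ₗ ws) (Vec.map-∘ α f (children n))

    -- The automaton is deterministic once the bits at the leaves are fixed: a word names its child
    -- states, `ser` is injective, and by induction these are the true states of the subtrees. Hence
    -- a witness cannot contain junk.
    local⇒state : ∀ D F α → Local D F α → α root ≡ ser (stateᴰ D F (bitOf ∘ α ∘ leaf D))
    local⇒state (intro a) F α h = leaf-case (h root)
      where
      leaf-case : (α root ∷ []) ∈ₗ processᴰ (intro a) F root → α root ≡ ser (leafState a (bitOf (α root)))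
      leaf-case (hereₗ e) = trans e₀ (cong (ser ∘ leafState a) (sym (trans (cong bitOf e₀) (bitOf-ser false (tail (leafState a false))))))
        where e₀ = Vec.∷-injectiveˡ e
      leaf-case (thereₗ (hereₗ e)) =
        trans e₀ (cong (ser ∘ leafState a) (sym (trans (cong bitOf e₀) (bitOf-ser true (tail (leafState a true))))))
        where e₀ = Vec.∷-injectiveˡ e
    local⇒state (t₁ ⊕ t₂) F α h with ∈-pairsₗ⁻ states (h root)
    ... | inj₂ (s , s′ , _ , _ , e) =
      trans (Vec.∷-injectiveˡ e) (cong₂ (λ x y → ser (binaryState (plainEnv F) x y)) s≡ s′≡)
      where
      s≡ : s ≡ stateᴰ t₁ F (bitOf ∘ α ∘ left ∘ leaf t₁)
      s≡ = ser-injective (trans (sym (Vec.∷-injectiveˡ (Vec.∷-injectiveʳ e)))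
             (local⇒state t₁ F (α ∘ left) λ n → inside-child left {α} n (h (left n))))
      s′≡ : s′ ≡ stateᴰ t₂ F (bitOf ∘ α ∘ right ∘ leaf t₂)
      s′≡ = ser-injective (trans (sym (Vec.∷-injectiveˡ (Vec.∷-injectiveʳ (Vec.∷-injectiveʳ e))))
              (local⇒state t₂ F (α ∘ right) λ n → inside-child right {α} n (h (right n))))
    local⇒state (recolor t a b) F α h with ∈-pairsₗ⁻ states (h root)
    ... | inj₂ (s , _ , _ , _ , e) =
      trans (Vec.∷-injectiveˡ e) (cong (ser ∘ unaryState (recolorEnv a b F))
        (ser-injective {s} {stateᴰ t (childContext (recolorEnv a b F)) (bitOf ∘ α ∘ inRec ∘ leaf t)} (trans (sym (Vec.∷-injectiveˡ (Vec.∷-injectiveʳ e)))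
          (local⇒state t (childContext (recolorEnv a b F)) (α ∘ inRec) λ n → inside-child inRec {α} n (h (inRec n))))))
    local⇒state (addEdges t a b) F α h with ∈-pairsₗ⁻ states (h root)
    ... | inj₂ (s , _ , _ , _ , e) =
      trans (Vec.∷-injectiveˡ e) (cong (ser ∘ unaryState (addEdgesEnv a b F))
        (ser-injective {s} {stateᴰ t (childContext (addEdgesEnv a b F)) (bitOf ∘ α ∘ inAdd ∘ leaf t)} (trans (sym (Vec.∷-injectiveˡ (Vec.∷-injectiveʳ e)))
          (local⇒state t (childContext (addEdgesEnv a b F)) (α ∘ inAdd) λ n → inside-child inAdd {α} n (h (inAdd n))))))

    codes : ∀ D → Tree → (Vertex {ω} D → Bool) → Node D → Bits
    codes D                F S root      = ser (stateᴰ D F S)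
    codes (t₁ ⊕ t₂)        F S (left n)  = codes t₁ F (S ∘ inj₁) n
    codes (t₁ ⊕ t₂)        F S (right n) = codes t₂ F (S ∘ inj₂) n
    codes (recolor t a b)  F S (inRec n) = codes t (childContext (recolorEnv a b F)) S n
    codes (addEdges t a b) F S (inAdd n) = codes t (childContext (addEdgesEnv a b F)) S n

    bitOf-leaf : ∀ D F S v → bitOf (codes D F S (leaf D v)) ≡ S v
    bitOf-leaf (intro a)        F S tt       = bitOf-ser (S tt) (tail (leafState a (S tt)))
    bitOf-leaf (t₁ ⊕ t₂)        F S (inj₁ v) = bitOf-leaf t₁ F (S ∘ inj₁) v
    bitOf-leaf (t₁ ⊕ t₂)        F S (inj₂ v) = bitOf-leaf t₂ F (S ∘ inj₂) v
    bitOf-leaf (recolor t a b)  F S v        = bitOf-leaf t _ S v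
    bitOf-leaf (addEdges t a b) F S v        = bitOf-leaf t _ S v

    codes-local : ∀ D F S → Local D F (codes D F S)
    codes-local (intro a) F S root with S tt
    ... | false = hereₗ refl
    ... | true  = thereₗ (hereₗ refl)
    codes-local (t₁ ⊕ t₂) F S root =
      ∈-pairsₗ⁺ {g = binaryWord (plainEnv F)} {xs = states} {states}
        (stateᴰ∈states t₁ F (S ∘ inj₁)) (stateᴰ∈states t₂ F (S ∘ inj₂))
    codes-local (t₁ ⊕ t₂) F S (left n)  = inside-child⁻ left {codes (t₁ ⊕ t₂) F S} n (codes-local t₁ F (S ∘ inj₁) n)
    codes-local (t₁ ⊕ t₂) F S (right n) = inside-child⁻ right {codes (t₁ ⊕ t₂) F S} n (codes-local t₂ F (S ∘ inj₂) n)
    codes-local (recolor t a b) F S root =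
      ∈-pairsₗ⁺ {g = unaryWord (recolorEnv a b F)} {xs = states} {nil ∙ nil}
        (stateᴰ∈states t (childContext (recolorEnv a b F)) S) here
    codes-local (recolor t a b) F S (inRec n) =
      inside-child⁻ inRec {codes (recolor t a b) F S} n (codes-local t _ S n)
    codes-local (addEdges t a b) F S root =
      ∈-pairsₗ⁺ {g = unaryWord (addEdgesEnv a b F)} {xs = states} {nil ∙ nil}
        (stateᴰ∈states t (childContext (addEdgesEnv a b F)) S) here
    codes-local (addEdges t a b) F S (inAdd n) =
      inside-child⁻ inAdd {codes (addEdges t a b) F S} n (codes-local t _ S n)

    accept⁺ : ∀ {s} → s ∈ᵗ states → eval p (tail s) ≡ true → ser s ∈ₗ acceptᴰ
    accept⁺ s∈ h = ∈-pairsₗ⁺ {g = λ s _ → ser s} {xs = acceptedStates} {ys = nil ∙ nil}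
      (∈-filter⁺ {λ s → eval p (tail s)} s∈ h) here

    accept⁻ : ∀ {s} → ser s ∈ₗ acceptᴰ → eval p (tail s) ≡ true
    accept⁻ {s} h with ∈-pairsₗ⁻ acceptedStates h
    ... | inj₂ (s′ , _ , s′∈ , _ , e) with ∈-filter⁻ {λ s → eval p (tail s)} states s′∈
    ...   | inj₂ (_ , h′) = subst (λ s → eval p (tail s) ≡ true) (sym (ser-injective {s} {s′} e)) h′

    Accepts : (D : Decomp ω) → (Node D → Bits) → Set
    Accepts D α = Local D nil α × α root ∈ₗ acceptᴰ

    accepts⇒holds : ∀ D α → Accepts D α → Holds (structure D nil) p [] (bitOf ∘ α ∘ leaf D ∷ [])
    accepts⇒holds D α (l , g) =
      eval-sound p [] (S ∷ []) (proj₁ (stateᴰ-describes D nil S))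
        (accept⁻ {stateᴰ D nil S} (subst (_∈ₗ acceptᴰ) (local⇒state D nil α l) g))
      where S = bitOf ∘ α ∘ leaf D

    holds⇒accepts : ∀ D S → Holds (structure D nil) p [] (S ∷ []) → Accepts D (codes D nil S)
    holds⇒accepts D S h =
      codes-local D nil S ,
      accept⁺ (stateᴰ∈states D nil S) (eval-complete p [] (S ∷ []) (proj₁ (stateᴰ-describes D nil S)) h)

-- Satisfaction in the decomposed graph

evalQF : ∀ {i s} {φ : Formula i s} → QuantifierFree φ → (Atom i s → Bool) → Bool
evalQF (eq {x} {y})  f = f (eqᵃ x y)
evalQF (adj {x} {y}) f = f (adjᵃ x y)
evalQF (mem {x} {X}) f = f (memᵃ x X)
evalQF (neg a)       f = not (evalQF a f)
evalQF (and a b)     f = evalQF a f ∧ evalQF b f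
evalQF (or a b)      f = evalQF a f ∨ evalQF b f
evalQF (imp a b)     f = not (evalQF a f) ∨ evalQF b f
evalQF (iff a b)     f = (not (evalQF a f) ∨ evalQF b f) ∧ (not (evalQF b f) ∨ evalQF a f)

-- Every atom mentions an individual variable. This is why `Prefix` offers a matrix only at `suc i`,
-- and why a closed prenex formula quantifies at least one vertex.
no-closed-matrix : ∀ {s} {φ : Formula 0 s} → QuantifierFree φ → ⊥
no-closed-matrix (eq {()})
no-closed-matrix (adj {()})
no-closed-matrix (mem {()})
no-closed-matrix (neg a)   = no-closed-matrix a
no-closed-matrix (and a _) = no-closed-matrix a
no-closed-matrix (or a _)  = no-closed-matrix a
no-closed-matrix (imp a _) = no-closed-matrix a
no-closed-matrix (iff a _) = no-closed-matrix a

matrixOf : ∀ {i s} {φ : Formula i s} → QuantifierFree φ → Vec Bool (#atoms i s) → Bool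
matrixOf a v = evalQF a (lookup v ∘ index)

matrixPrefix : ∀ {i s} {φ : Formula i s} → QuantifierFree φ → Prefix i s
matrixPrefix {zero}  a = ⊥-elim (no-closed-matrix a)
matrixPrefix {suc i} a = matrix (matrixOf a)

prefix : ∀ {i s} {φ : Formula i s} → Prenex φ → Prefix i s
prefix (matrix a) = matrixPrefix a
prefix (∃v a) = vertex true (prefix a)
prefix (∀v a) = vertex false (prefix a)
prefix (∃s a) = set true (prefix a)
prefix (∀s a) = set false (prefix a)

#levels #vertices #sets : ∀ {i s} → Prefix i s → ℕ
#levels (matrix _)   = 0
#levels (vertex _ p) = suc (#levels p)
#levels (set _ p)    = suc (#levels p)

#vertices (matrix {i} _) = suc i
#vertices (vertex _ p)   = #vertices p
#vertices (set _ p)      = #vertices p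

#sets (matrix {_} {s} _) = s
#sets (vertex _ p)       = #sets p
#sets (set _ p)          = #sets p

#individual-free : ∀ {i s} {φ : Formula i s} → QuantifierFree φ → #individual φ ≡ 0
#individual-free eq        = refl
#individual-free adj       = refl
#individual-free mem       = refl
#individual-free (neg a)   = #individual-free a
#individual-free (and a b) = cong₂ _+_ (#individual-free a) (#individual-free b)
#individual-free (or a b)  = cong₂ _+_ (#individual-free a) (#individual-free b)
#individual-free (imp a b) = cong₂ _+_ (#individual-free a) (#individual-free b)
#individual-free (iff a b) = cong₂ _+_ (#individual-free a) (#individual-free b)

#set-free : ∀ {i s} {φ : Formula i s} → QuantifierFree φ → #set φ ≡ 0
#set-free eq        = refl
#set-free adj       = refl
#set-free mem       = refl
#set-free (neg a)   = #set-free a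
#set-free (and a b) = cong₂ _+_ (#set-free a) (#set-free b)
#set-free (or a b)  = cong₂ _+_ (#set-free a) (#set-free b)
#set-free (imp a b) = cong₂ _+_ (#set-free a) (#set-free b)
#set-free (iff a b) = cong₂ _+_ (#set-free a) (#set-free b)

#levels-prefix : ∀ {i s} {φ : Formula i s} (a : Prenex φ) → #levels (prefix a) ≡ #quantified φ
#levels-prefix {zero}  (matrix a) = ⊥-elim (no-closed-matrix a)
#levels-prefix {suc i} (matrix a) = sym (cong₂ _+_ (#individual-free a) (#set-free a))
#levels-prefix (∃v a) = cong suc (#levels-prefix a)
#levels-prefix (∀v a) = cong suc (#levels-prefix a)
#levels-prefix (∃s_ {φ} a) = trans (cong suc (#levels-prefix a)) (sym (+-suc (#individual φ) (#set φ)))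
#levels-prefix (∀s_ {φ} a) = trans (cong suc (#levels-prefix a)) (sym (+-suc (#individual φ) (#set φ)))

#vertices-prefix : ∀ {i s} {φ : Formula i s} (a : Prenex φ) → #vertices (prefix a) ≡ #individual φ + i
#vertices-prefix {zero}  (matrix a) = ⊥-elim (no-closed-matrix a)
#vertices-prefix {suc i} (matrix a) = cong (_+ suc i) (sym (#individual-free a))
#vertices-prefix {i} (∃v_ {φ} a) = trans (#vertices-prefix a) (+-suc (#individual φ) i)
#vertices-prefix {i} (∀v_ {φ} a) = trans (#vertices-prefix a) (+-suc (#individual φ) i)
#vertices-prefix (∃s a) = #vertices-prefix a
#vertices-prefix (∀s a) = #vertices-prefix a

#sets-prefix : ∀ {i s} {φ : Formula i s} (a : Prenex φ) → #sets (prefix a) ≡ #set φ + s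
#sets-prefix {zero}  (matrix a) = ⊥-elim (no-closed-matrix a)
#sets-prefix {suc i} {s} (matrix a) = cong (_+ s) (sym (#set-free a))
#sets-prefix (∃v a) = #sets-prefix a
#sets-prefix (∀v a) = #sets-prefix a
#sets-prefix {s = s} (∃s_ {φ} a) = trans (#sets-prefix a) (+-suc (#set φ) s)
#sets-prefix {s = s} (∀s_ {φ} a) = trans (#sets-prefix a) (+-suc (#set φ) s)

Reflects : Set → Bool → Set
Reflects P b = (P → b ≡ true) × (b ≡ true → P)

private
  reflects-¬ : ∀ {P b} → Reflects P b → Reflects (¬ P) (not b)
  reflects-¬ {b = true}  (f , g) = (λ ¬p → ⊥-elim (¬p (g refl))) , (λ ())
  reflects-¬ {b = false} (f , g) = (λ _ → refl) , (λ _ p → case-⊥ (f p))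
    where case-⊥ : false ≡ true → ⊥
          case-⊥ ()

  reflects-× : ∀ {P Q a b} → Reflects P a → Reflects Q b → Reflects (P × Q) (a ∧ b)
  reflects-× {a = true}  (f , g) (h , k) = (λ { (p , q) → h q }) , (λ e → g refl , k e)
  reflects-× {a = false} (f , g) (h , k) = (λ { (p , q) → f p }) , (λ ())

  reflects-⊎ : ∀ {P Q a b} → Reflects P a → Reflects Q b → Reflects (P ⊎ Q) (a ∨ b)
  reflects-⊎ {a = true}  (f , g) (h , k) = (λ _ → refl) , (λ _ → inj₁ (g refl))
  reflects-⊎ {a = false} (f , g) (h , k) =
    (λ { (inj₁ p) → h′ (f p) ; (inj₂ q) → h q }) , (λ e → inj₂ (k e))
    where h′ : ∀ {b} → false ≡ true → b ≡ true
          h′ ()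

  reflects-→ : ∀ {P Q a b} → Reflects P a → Reflects Q b → Reflects (P → Q) (not a ∨ b)
  reflects-→ {a = true}  (f , g) (h , k) = (λ pq → h (pq (g refl))) , (λ e _ → k e)
  reflects-→ {a = false} (f , g) (h , k) = (λ _ → refl) , (λ _ p → absurd (f p))
    where absurd : {A : Set} → false ≡ true → A
          absurd ()

  reflects-⇔ : ∀ {P Q a b} → Reflects P a → Reflects Q b →
               Reflects (P ⇔ Q) ((not a ∨ b) ∧ (not b ∨ a))
  reflects-⇔ p q with reflects-× (reflects-→ p q) (reflects-→ q p)
  ... | f , g = (λ e → f (⇒ e , ⇐ e)) , (λ e → mk⇔ (proj₁ (g e)) (proj₂ (g e)))

module _ {G : Graph} {ω : ℕ} {D : Decomp ω} (iso : D DecompositionOf G) where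
  open Graph G
  open _DecompositionOf_ iso

  private
    A : Structure
    A = structure D nil

    from : Vertex D → V
    from = Inverse.from vertices

    from-at : ∀ v → from (at v) ≡ v
    from-at = Inverse.strictlyInverseʳ vertices

    at-from : ∀ w → at (from w) ≡ w
    at-from = Inverse.strictlyInverseˡ vertices

  -- Subsets of the graph are vectors, sets of the structure are functions. Pointwise agreement is
  -- enough because atoms only look up values, so equality of functions never arises.
  SameSets : ∀ {s} → Vec (Subset order) s → Vec (Vertex D → Bool) s → Set
  SameSets σ σ′ = ∀ X v → lookup (lookup σ X) v ≡ lookup σ′ X (at v)

  consSame : ∀ {s} {σ : Vec _ s} {σ′ X X′} → (∀ v → lookup X v ≡ X′ (at v)) → SameSets σ σ′ →
             SameSets (X ∷ σ) (X′ ∷ σ′)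
  consSame h hs zero    = h
  consSame h hs (suc X) = hs X

  atoms-reflect : ∀ {i s} (ρ : Vec V i) {σ : Vec _ s} {σ′} → SameSets σ σ′ →
    let f = value A (Vec.map just (Vec.map at ρ)) σ′ in
    (∀ x y → Reflects (lookup ρ x ≡ lookup ρ y) (f (eqᵃ x y))) ×
    (∀ x y → Reflects (Adj (lookup ρ x) (lookup ρ y)) (f (adjᵃ x y))) ×
    (∀ x X → Reflects (lookup ρ x ∈ₛ lookup σ X) (f (memᵃ x X)))
  atoms-reflect ρ {σ} {σ′} h = eqs , adjs , mems
    where
    lookup-ρ : ∀ x → lookup (Vec.map just (Vec.map at ρ)) x ≡ just (at (lookup ρ x))
    lookup-ρ x = trans (Vec.lookup-map x just (Vec.map at ρ)) (cong just (Vec.lookup-map x at ρ))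
    eqs : ∀ x y → Reflects (lookup ρ x ≡ lookup ρ y) (value A (Vec.map just (Vec.map at ρ)) σ′ (eqᵃ x y))
    eqs x y rewrite lookup-ρ x | lookup-ρ y =
      (λ e → trans (cong (λ v → sameᴰ D (at (lookup ρ x)) (at v)) (sym e)) (sameᴰ-refl D _)) ,
      (λ e → trans (sym (from-at _)) (trans (cong from (sameᴰ-sound D e)) (from-at _)))
    adjs : ∀ x y → Reflects (Adj (lookup ρ x) (lookup ρ y)) (value A (Vec.map just (Vec.map at ρ)) σ′ (adjᵃ x y))
    adjs x y rewrite lookup-ρ x | lookup-ρ y =
      (λ e → ⇐ (linkedᴰ-edge D) (⇒ (edges _ _) e)) , (λ e → ⇐ (edges _ _) (⇒ (linkedᴰ-edge D) e))
    mems : ∀ x X → Reflects (lookup ρ x ∈ₛ lookup σ X) (value A (Vec.map just (Vec.map at ρ)) σ′ (memᵃ x X))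
    mems x X rewrite lookup-ρ x =
      (λ e → trans (sym (h X (lookup ρ x))) (Vec.[]=⇒lookup e)) ,
      (λ e → Vec.lookup⇒[]= _ _ (trans (h X (lookup ρ x)) e))

  evalQF-reflects : ∀ {i s} {φ : Formula i s} (a : QuantifierFree φ) (f : Atom i s → Bool) {ρ : Vec V i} {σ} →
    (∀ x y → Reflects (lookup ρ x ≡ lookup ρ y) (f (eqᵃ x y))) ×
    (∀ x y → Reflects (Adj (lookup ρ x) (lookup ρ y)) (f (adjᵃ x y))) ×
    (∀ x X → Reflects (lookup ρ x ∈ₛ lookup σ X) (f (memᵃ x X))) →
    Reflects (⟦_⟧ G φ ρ σ) (evalQF a f)
  evalQF-reflects eq        f (h , _ , _) = h _ _
  evalQF-reflects adj       f (_ , h , _) = h _ _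
  evalQF-reflects mem       f (_ , _ , h) = h _ _
  evalQF-reflects (neg a)   f h = reflects-¬ (evalQF-reflects a f h)
  evalQF-reflects (and a b) f h = reflects-× (evalQF-reflects a f h) (evalQF-reflects b f h)
  evalQF-reflects (or a b)  f h = reflects-⊎ (evalQF-reflects a f h) (evalQF-reflects b f h)
  evalQF-reflects (imp a b) f h = reflects-→ (evalQF-reflects a f h) (evalQF-reflects b f h)
  evalQF-reflects (iff a b) f h = reflects-⇔ (evalQF-reflects a f h) (evalQF-reflects b f h)

  evalQF-cong : ∀ {i s} {φ : Formula i s} (a : QuantifierFree φ) {f g : Atom i s → Bool} →
                (∀ x → f x ≡ g x) → evalQF a f ≡ evalQF a g
  evalQF-cong eq        h = h _
  evalQF-cong adj       h = h _
  evalQF-cong mem       h = h _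
  evalQF-cong (neg a)   h = cong not (evalQF-cong a h)
  evalQF-cong (and a b) h = cong₂ _∧_ (evalQF-cong a h) (evalQF-cong b h)
  evalQF-cong (or a b)  h = cong₂ _∨_ (evalQF-cong a h) (evalQF-cong b h)
  evalQF-cong (imp a b) h = cong₂ (λ x y → not x ∨ y) (evalQF-cong a h) (evalQF-cong b h)
  evalQF-cong (iff a b) h =
    cong₂ (λ x y → (not x ∨ y) ∧ (not y ∨ x)) (evalQF-cong a h) (evalQF-cong b h)

  lookup-values : ∀ {i s} (ρ : Vec _ i) (σ : Vec _ s) a → lookup (values A ρ σ) (index a) ≡ value A ρ σ a
  lookup-values ρ σ a =
    trans (Vec.lookup∘tabulate (value A ρ σ ∘ atom) (index a)) (cong (value A ρ σ) (atom-index a))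

  private
    subsetOf : (Vertex D → Bool) → Subset order
    subsetOf X = tabulate (X ∘ at)

    setOf : Subset order → Vertex D → Bool
    setOf X = lookup X ∘ from

    setOf-at : ∀ X v → lookup X v ≡ setOf X (at v)
    setOf-at X v = cong (lookup X) (sym (from-at v))

  holds⁺ : ∀ {i s} {φ : Formula i s} (a : Prenex φ) {ρ σ σ′} → SameSets σ σ′ →
           ⟦_⟧ G φ ρ σ → Holds A (prefix a) (Vec.map at ρ) σ′
  holds⁻ : ∀ {i s} {φ : Formula i s} (a : Prenex φ) {ρ σ σ′} → SameSets σ σ′ →
           Holds A (prefix a) (Vec.map at ρ) σ′ → ⟦_⟧ G φ ρ σ
  holds⁺ {zero}  (matrix a) = ⊥-elim (no-closed-matrix a)
  holds⁺ {suc i} (matrix a) {ρ} {σ} {σ′} hs h =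
    trans (evalQF-cong a (lookup-values (Vec.map just (Vec.map at ρ)) σ′))
          (proj₁ (evalQF-reflects a _ (atoms-reflect ρ {σ} {σ′} hs)) h)
  holds⁺ (∃v a) hs (v , h)      = at v , holds⁺ a hs h
  -- The quantifier now ranges over vertices of the decomposition, so surjectivity of `at` is what
  -- carries the claim over.
  holds⁺ (∀v a) {ρ} {σ′ = σ′} hs h w =
    subst (λ w → Holds A (prefix a) (w ∷ Vec.map at ρ) σ′) (at-from w) (holds⁺ a hs (h (from w)))
  holds⁺ (∃s a) hs (X , h)      = setOf X , holds⁺ a (consSame (setOf-at X) hs) h
  holds⁺ (∀s a) hs h X          =
    holds⁺ a (consSame (Vec.lookup∘tabulate (X ∘ at)) hs) (h (subsetOf X))
  holds⁻ {zero}  (matrix a) = ⊥-elim (no-closed-matrix a)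
  holds⁻ {suc i} (matrix a) {ρ} {σ} {σ′} hs h =
    proj₂ (evalQF-reflects a _ (atoms-reflect ρ {σ} {σ′} hs))
          (trans (sym (evalQF-cong a (lookup-values (Vec.map just (Vec.map at ρ)) σ′))) h)
  holds⁻ (∃v a) {ρ} {σ′ = σ′} hs (w , h) =
    from w , holds⁻ a hs (subst (λ w → Holds A (prefix a) (w ∷ Vec.map at ρ) σ′) (sym (at-from w)) h)
  holds⁻ (∀v a) hs h v          = holds⁻ a hs (h (at v))
  holds⁻ (∃s a) hs (X , h)      =
    subsetOf X , holds⁻ a (consSame (Vec.lookup∘tabulate (X ∘ at)) hs) h
  holds⁻ (∀s a) hs h X          = holds⁻ a (consSame (setOf-at X) hs) (h (setOf X))

  accepts-iff : ∀ {φ : Formula 0 1} (a : Prenex φ) S →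
    ⟦_⟧ G φ [] (S ∷ []) ⇔
    (∃[ α ] Accepts (prefix a) D α × (∀ v → v ∈ₛ S ⇔ bitOf (α (leaf D (at v))) ≡ true))
  accepts-iff a S = mk⇔ to′ from′
    where
    to′ : _
    to′ h = codes (prefix a) D nil (setOf S) ,
            holds⇒accepts (prefix a) D (setOf S) (holds⁺ a (λ { zero → setOf-at S }) h) ,
            λ v → let e = trans (bitOf-leaf (prefix a) D nil (setOf S) (at v)) (sym (setOf-at S v)) in
                  mk⇔ (λ v∈ → trans e (Vec.[]=⇒lookup v∈)) (λ b → Vec.lookup⇒[]= v S (trans (sym e) b))
    from′ : _
    from′ (α , acc , h) = holds⁻ a (λ { zero → same′ }) (accepts⇒holds (prefix a) D α acc)
      where
      same′ : ∀ v → lookup S v ≡ bitOf (α (leaf D (at v)))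
      same′ v = bool-ext {ω} (λ e → ⇒ (h v) (Vec.lookup⇒[]= v S e)) (λ e → Vec.[]=⇒lookup (⇐ (h v) e))

-- The cost of joining types

-- Colours and types have size at most ℓ, and `B` caps folds and primitives. `2+ℓ≤B` allows for the
-- two pairs added by `joined`, `square≤B` for the candidate list at a set quantifier with heads
-- included, and `compare≤B` for testing a pair of colours or serializing a state.
record Budget (ℓ B ω : ℕ) : Set where
  field
    0<ω′       : 0 < ω
    color≤     : suc (ω + ω) ≤ ℓ
    ω*ω≤       : ω * ω ≤ ℓ
    2+ℓ≤B      : 2 + ℓ ≤ B
    square≤B   : suc ℓ * suc ℓ ≤ B
    compare≤B  : 64 * (4 + (ℓ + ℓ)) + 16 ≤ B

-- What makes the universe codes and joins affordable. Even when all variables are inside the union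
-- they may be spread over both sides; the lists found in the children then come from
-- `univ p false`, which is why its length is bounded at every quantifier.
Tame : ∀ (ℓ ω : ℕ) {i s} → Prefix i s → Bool → Set
Tame ℓ ω (matrix {i} {s} g) all = all ≡ false → ω ^ suc i ≤ ℓ × 2 ^ #atoms (suc i) s ≤ ℓ
Tame ℓ ω (vertex _ p)       all =
  Tame ℓ ω p false × Tame ℓ ω p all × 2 ^ len (univ p all ω) ≤ ℓ ×
  len (univ p false ω) ≤ ℓ × (∀ {z} → z ∈ᵗ univ p all ω → size z ≤ ℓ)
Tame ℓ ω (set _ p)          all =
  Tame ℓ ω p all × 2 ^ len (univ p all ω) ≤ ℓ ×
  len (univ p false ω) ≤ ℓ × (∀ {z} → z ∈ᵗ univ p all ω → size z ≤ ℓ)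

n≤2^n : ∀ n → n ≤ 2 ^ n
n≤2^n zero    = z≤n
n≤2^n (suc n) = ≤-trans (+-mono-≤ (m^n>0 2 n) (n≤2^n n))
                        (≤-reflexive (cong (2 ^ n +_) (sym (+-identityʳ (2 ^ n)))))

fitsBranch : ∀ {B p q x} t → Fits B p x → Fits B q x → FitsBranch B t p q x
fitsBranch nil     f g = g
fitsBranch (_ ∙ _) f g = f

fits-drop : ∀ {B} k x → Fits B (dropᶜ k) x
fits-drop zero    x = tt
fits-drop (suc k) x = tt , fits-drop k (tail x)

fits-arg : ∀ {B} k x → Fits B (argᶜ k) x
fits-arg k x = fits-drop k x , tt

fits-tuple : ∀ {B n} (f : Fin n → Code) {x} → (∀ k → Fits B (f k) x) → Fits B (tupleᶜ n f) x
fits-tuple {n = zero}  f h = tt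
fits-tuple {n = suc n} f h = h zero , fits-tuple (f ∘ suc) (h ∘ suc)

fits-decide : ∀ {B} n g t → Fits B (decideᶜ n g) t
fits-decide zero    g t with g []
... | true  = _
... | false = _
fits-decide (suc n) g t = _ , fitsBranch (head t) (_ , fits-decide n _ (tail t)) (_ , fits-decide n _ (tail t))

branch∈ : ∀ {x y l} t → x ∈ᵗ l → y ∈ᵗ l → branch t x y ∈ᵗ l
branch∈ nil     x∈ y∈ = y∈
branch∈ (_ ∙ _) x∈ y∈ = x∈

decide∈bools : ∀ n g t → run (decideᶜ n g) t ∈ᵗ bools
decide∈bools zero    g t with g []
... | true  = there here
... | false = here
decide∈bools (suc n) g t = branch∈ (head t) (decide∈bools n _ (tail t)) (decide∈bools n _ (tail t))

module _ {ℓ B ω : ℕ} (budget : Budget ℓ B ω) where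
  open Budget budget

  ℓ≤B : ℓ ≤ B
  ℓ≤B = ≤-trans (m≤n+m ℓ 2) 2+ℓ≤B

  ω≤ℓ : ω ≤ ℓ
  ω≤ℓ = ≤-trans (≤-trans (m≤m+n ω ω) (n≤1+n _)) color≤

  1≤ℓ : 1 ≤ ℓ
  1≤ℓ = ≤-trans (s≤s z≤n) color≤

  2≤ℓ : 2 ≤ ℓ
  2≤ℓ = ≤-trans (s≤s (≤-trans 0<ω′ (m≤m+n ω ω))) color≤

  compare≤ : ∀ {n} → n ≤ 4 + (ℓ + ℓ) → 64 * n + 16 ≤ B
  compare≤ n≤ = ≤-trans (+-monoˡ-≤ 16 (*-monoʳ-≤ 64 n≤)) compare≤B

  color-size : ∀ {c} → c ∈ᵗ colors ω → size c ≤ ℓ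
  color-size c∈ = ≤-trans (size-colors ω c∈) color≤

  nil∈colors : nil ∈ᵗ colors ω
  nil∈colors = encℕ∈colors 0<ω′

  ω≢0 : NonZero ω
  ω≢0 = >-nonZero 0<ω′

  len-run-colors : len (run colorsᶜ (encℕ ω)) ≡ ω
  len-run-colors = trans (cong len (run-colors ω)) (len-colors ω)

  fits-colorPower : ∀ n → ω ^ suc n ≤ ℓ → Fits B (powerᶜ colorsᶜ (suc n)) (encℕ ω)
  fits-colorPower n h =
    fits-power colorsᶜ (encℕ ω) (suc n) {{subst NonZero (sym len-run-colors) ω≢0}}
      (fits-colors ω (≤-trans ω≤ℓ ℓ≤B)) (≤-trans (≤-reflexive len-run-colors) (≤-trans ω≤ℓ ℓ≤B))
      (≤-trans (≤-reflexive (cong (_^ suc n) len-run-colors)) (≤-trans h ℓ≤B))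

  fits-sublists-univ : ∀ {i s} (p : Prefix i s) all → 2 ^ len (univ p all ω) ≤ ℓ →
                       Fits B sublistsᶜ (run (univᶜ p all) (encℕ ω))
  fits-sublists-univ p all 2^≤ rewrite run-univ p all ω =
    fits-sublists (univ p all ω) (≤-trans (n≤2^n _) (≤-trans 2^≤ ℓ≤B)) (≤-trans 1≤ℓ ℓ≤B) (≤-trans 2^≤ ℓ≤B)

  len-sublists-univ : ∀ {i s} (p : Prefix i s) all → 2 ^ len (univ p all ω) ≤ ℓ →
                      len (run sublistsᶜ (run (univᶜ p all) (encℕ ω))) ≤ B
  len-sublists-univ p all 2^≤ rewrite run-univ p all ω =
    ≤-trans (≤-reflexive (trans (cong len (run-sublists (univ p all ω)))
              (trans (len-sublists (univ p all ω) (nil ∙ nil)) (*-identityʳ _))))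
            (≤-trans 2^≤ ℓ≤B)

  fits-univ : ∀ {i s} (p : Prefix i s) all → Tame ℓ ω p all → Fits B (univᶜ p all) (encℕ ω)
  fits-univ (matrix g) true h = _
  fits-univ (matrix {i} {s} g) false h =
    fits-cart (powerᶜ colorsᶜ (suc i)) (powerᶜ boolsᶜ (#atoms (suc i) s)) (encℕ ω)
      (fits-colorPower i ω^≤)
      (fits-power boolsᶜ (encℕ ω) (#atoms (suc i) s) _ (≤-trans 2≤ℓ ℓ≤B) (≤-trans 2^≤ ℓ≤B))
      (≤-trans (≤-reflexive (trans (cong len (run-power colorsᶜ (suc i) (encℕ ω)))
                 (trans (len-power (run colorsᶜ (encℕ ω)) (suc i)) (cong (_^ suc i) len-run-colors)))) (≤-trans ω^≤ ℓ≤B))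
      (≤-trans (≤-reflexive (trans (cong len (run-power boolsᶜ (#atoms (suc i) s) (encℕ ω)))
                 (len-power bools (#atoms (suc i) s)))) (≤-trans 2^≤ ℓ≤B))
    where ω^≤ = proj₁ (h refl)
          2^≤ = proj₂ (h refl)
  fits-univ (vertex _ p) all (tame₀ , tame , 2^≤ , len≤ , _) =
    fits-cart (univᶜ p false) (boxᶜ (univᶜ p all) ▸ sublistsᶜ) (encℕ ω)
      (fits-univ p false tame₀)
      (fits-univ p all tame , fits-sublists-univ p all 2^≤)
      (≤-trans (≤-reflexive (cong len (run-univ p false ω))) (≤-trans len≤ ℓ≤B))
      (len-sublists-univ p all 2^≤)
  fits-univ (set _ p) all (tame , 2^≤ , _ , _) =
    fits-cart (univᶜ p all) (boxᶜ (univᶜ p all) ▸ sublistsᶜ) (encℕ ω)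
      (fits-univ p all tame)
      (fits-univ p all tame , fits-sublists-univ p all 2^≤)
      (≤-trans (≤-reflexive (cong len (run-univ p all ω))) (≤-trans (n≤2^n _) (≤-trans 2^≤ ℓ≤B)))
      (len-sublists-univ p all 2^≤)

  -- Junk states listed by the processes need not describe anything, hence this weaker invariant.
  InUniv : ∀ {i s} → Prefix i s → Bool → Tree → Set
  InUniv p all t = t ∈ᵗ univ p all ω ⊎ t ≡ nil

  private
    SublistOf : Tree → ℕ → Tree → Set
    SublistOf u k w = len w ≤ k × (∀ {x} → x ∈ᵗ w → x ∈ᵗ u)

    ∈-sublists : ∀ {w} u → w ∈ᵗ sublists u (nil ∙ nil) → SublistOf u (len u) w
    ∈-sublists {w} u w∈ = subst (λ k → SublistOf u k w) (+-identityʳ (len u))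
      (∈-sublists⁻ (SublistOf u) u (λ { here → z≤n , (λ ()) ; (there ()) })
        (λ { (l , e) → ≤-trans l (n≤1+n _) , e })
        (λ { u∈ (l , e) → s≤s l , λ { here → u∈ ; (there x∈) → e x∈ } }) w∈)

  vertex-univ : ∀ {i s b} (p : Prefix (suc i) s) all {t} → InUniv (vertex b p) all t →
    InUniv p false (head t) × len (tail t) ≤ len (univ p all ω) × (∀ {x} → x ∈ᵗ tail t → InUniv p all x)
  vertex-univ p all (inj₂ refl) = inj₂ refl , z≤n , λ ()
  vertex-univ p all (inj₁ t∈) with ∈-cart⁻ (univ p false ω) t∈
  ... | h∈ , l∈ with ∈-sublists (univ p all ω) l∈
  ...   | len≤ , sub = inj₁ h∈ , len≤ , inj₁ ∘ sub

  set-univ : ∀ {i s b} (p : Prefix i (suc s)) all {t} → InUniv (set b p) all t →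
    InUniv p all (head t) × len (tail t) ≤ len (univ p all ω) ×
    (∀ {x} → x ∈ᵗ head t ∙ tail t → InUniv p all x)
  set-univ p all (inj₂ refl) = inj₂ refl , z≤n , λ { here → inj₂ refl ; (there ()) }
  set-univ p all (inj₁ t∈) with ∈-cart⁻ (univ p all ω) t∈
  ... | h∈ , l∈ with ∈-sublists (univ p all ω) l∈
  ...   | len≤ , sub = inj₁ h∈ , len≤ , λ { here → inj₁ h∈ ; (there x∈) → inj₁ (sub x∈) }

  nth∈power : ∀ {l n} (k : Fin n) {z} → z ∈ᵗ power l n → nth (toℕ k) z ∈ᵗ l
  nth∈power {l} {suc n} zero    z∈ = proj₁ (∈-cart⁻ l z∈)
  nth∈power {l} {suc n} (suc k) z∈ = nth∈power k (proj₂ (∈-cart⁻ l z∈))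

  matrix-univ : ∀ {i s} (g : Vec Bool (#atoms (suc i) s) → Bool) {t} → InUniv (matrix {i} {s} g) false t →
    (∀ (k : Fin (suc i)) → nth (toℕ k) (head t) ∈ᵗ colors ω) ×
    (∀ (k : Fin (#atoms (suc i) s)) → nth (toℕ k) (tail t) ∈ᵗ bools)
  matrix-univ g (inj₂ refl) =
    (λ k → subst (_∈ᵗ colors ω) (sym (nth-nil (toℕ k))) nil∈colors) ,
    (λ k → subst (_∈ᵗ bools) (sym (nth-nil (toℕ k))) here)
  matrix-univ {i} {s} g (inj₁ t∈) with ∈-cart⁻ (power (colors ω) (suc i)) t∈
  ... | c∈ , b∈ = (λ k → nth∈power k c∈) , (λ k → nth∈power k b∈)

  module _ {F r : Tree} (F≤ : len F ≤ B) (r∈ : tail r ∈ᵗ colors ω) where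

    private
      e : Tree
      e = F ∙ r ∙ encℕ ω

    recolor∈colors : ∀ {c} → c ∈ᵗ colors ω → recolorᵗ r c ∈ᵗ colors ω
    recolor∈colors {c} c∈ with eqᵗ c (head r)
    ... | true  = r∈
    ... | false = c∈

    fits-recolor : ∀ {c} → c ∈ᵗ colors ω → Fits B recolorᶜ (c ∙ r)
    fits-recolor {c} c∈ =
      (_ , compare≤ (≤-trans (color-size c∈) (≤-trans (m≤m+n ℓ ℓ) (m≤n+m _ 4)))) ,
      fitsBranch (encBool (eqᵗ c (head r))) _ _

    compare-pair≤ : ∀ {c d} → c ∈ᵗ colors ω → d ∈ᵗ colors ω → 64 * size (c ∙ d) + 16 ≤ B
    compare-pair≤ c∈ d∈ =
      compare≤ (≤-trans (s≤s (+-mono-≤ (color-size c∈) (color-size d∈))) (m≤n+m _ 3))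

    module _ {i s} (st : Vec Loc (suc i)) (g : Vec Bool (#atoms (suc i) s) → Bool) {t u}
             (t∈ : InUniv (matrix {i} {s} g) false t) (u∈ : InUniv (matrix {i} {s} g) false u) where

      color-code : ∀ x → Fits B (colorᶜ st x) (t ∙ u ∙ e) × run (colorᶜ st x) (t ∙ u ∙ e) ∈ᵗ colors ω
      color-code x with lookup st x
      ... | ˡ = (((_ , _ , fits-arg (toℕ x) (head t)) , _) , fits-recolor c∈) , recolor∈colors c∈
        where c∈ = subst (_∈ᵗ colors ω) (sym (run-arg (toℕ x) (head t))) (proj₁ (matrix-univ {i} {s} g t∈) x)
      ... | ʳ = (_ , _ , fits-arg (toℕ x) (head u)) ,
                subst (_∈ᵗ colors ω) (sym (run-arg (toℕ x) (head u))) (proj₁ (matrix-univ {i} {s} g u∈) x)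
      ... | ° = _ , nil∈colors

      bit-code : ∀ (k : Fin (#atoms (suc i) s)) src →
                 Fits B (bitᶜ st (toℕ k) src) (t ∙ u ∙ e) × run (bitᶜ st (toℕ k) src) (t ∙ u ∙ e) ∈ᵗ bools
      bit-code k fromˡ = (_ , _ , fits-arg (toℕ k) (tail t)) ,
        subst (_∈ᵗ bools) (sym (run-arg (toℕ k) (tail t))) (proj₂ (matrix-univ {i} {s} g t∈) k)
      bit-code k fromʳ = (_ , _ , fits-arg (toℕ k) (tail u)) ,
        subst (_∈ᵗ bools) (sym (run-arg (toℕ k) (tail u))) (proj₂ (matrix-univ {i} {s} g u∈) k)
      bit-code k none = _ , here
      bit-code k (cross x y) with color-code x | color-code y
      ... | fx , cx | fy , cy =
        (((fx , fy) , _) , fits-member _ F F≤ (compare-pair≤ cx cy)) ,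
        subst (_∈ᵗ bools) (sym (run-member _ F)) (encBool∈bools (member _ F))

    matrix-code : ∀ {i s} (g : Vec Bool (#atoms (suc i) s) → Bool) st bA bB bC → (bC ≡ false → bA ≡ false × bB ≡ false) → ∀ {t u} →
      InUniv (matrix {i} {s} g) bA t → InUniv (matrix {i} {s} g) bB u →
      let c = matrixᶜ {s = s} g st bA bB bC in
      Fits B c (t ∙ u ∙ e) × run c (t ∙ u ∙ e) ∈ᵗ univ (matrix {i} {s} g) bC ω
    matrix-code g st true  bB false h t∈ u∈ with h refl
    ... | () , _
    matrix-code g st false true false h t∈ u∈ with h refl
    ... | _ , ()
    matrix-code g st true bB true h {t} t∈ u∈ = (_ , fitsBranch t _ _) , branch∈ t (there here) here
    matrix-code g st false true true h {u = u} t∈ u∈ = (_ , fitsBranch u _ _) , branch∈ u (there here) here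
    matrix-code {i} {s} g st false false true h {t} {u} t∈ u∈ =
      (fits-tuple (λ k → bitᶜ st (toℕ k) (source {s = s} st (atom k))) (λ k → proj₁ (bit-code {i} {s} st g t∈ u∈ k (source {s = s} st (atom k)))) , fits-decide (#atoms (suc i) s) g (run (bitTupleᶜ s st) (t ∙ u ∙ e))) ,
      decide∈bools (#atoms (suc i) s) g (run (bitTupleᶜ s st) (t ∙ u ∙ e))
    matrix-code {i} {s} g st false false false h {t} {u} t∈ u∈ =
      (fits-tuple (colorᶜ st) (λ x → proj₁ (color-code {i} {s} st g t∈ u∈ x)) ,
       fits-tuple (λ k → bitᶜ st (toℕ k) (source {s = s} st (atom k))) (λ k → proj₁ (bit-code {i} {s} st g t∈ u∈ k (source {s = s} st (atom k))))) ,
      ∈-pairs⁺ {_∙_}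
        (tuple∈power (suc i) (colorᶜ st) λ x → proj₂ (color-code {i} {s} st g t∈ u∈ x))
        (tuple∈power (#atoms (suc i) s) (λ k → bitᶜ st (toℕ k) (source {s = s} st (atom k))) λ k →
          proj₂ (bit-code {i} {s} st g t∈ u∈ k (source {s = s} st (atom k))))

    inside-⊇ : ∀ {n} {f : Loc → Bool} (st : Vec Loc n) → (∀ l → f l ≡ true → inside l ≡ true) →
               allᵛ f st ≡ true → allᵛ inside st ≡ true
    inside-⊇ []       h e = refl
    inside-⊇ {f = f} (l ∷ st) h e with f l in fl
    inside-⊇ (l ∷ st) h e | true rewrite h l fl = inside-⊇ st h e

    isˡ⇒inside : ∀ l → isˡ l ≡ true → inside l ≡ true
    isˡ⇒inside ˡ _ = refl

    isʳ⇒inside : ∀ l → isʳ l ≡ true → inside l ≡ true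
    isʳ⇒inside ʳ _ = refl

    private
      absorb : ∀ {b all} → (b ≡ true → all ≡ true) → all ≡ false → b ≡ false
      absorb {false} h e = refl
      absorb {true}  h e = trans (sym (h refl)) e

      -- If one side holds all variables, then so does the union, and the length is at most its own
      -- power of two.
      len-univ≤ : ∀ {i s} (p : Prefix i s) b {all} → (b ≡ true → all ≡ true) →
        2 ^ len (univ p all ω) ≤ ℓ → len (univ p false ω) ≤ ℓ → len (univ p b ω) ≤ ℓ
      len-univ≤ p false h 2^≤ len≤ = len≤
      len-univ≤ p true  h 2^≤ len≤ with h refl
      ... | refl = ≤-trans (n≤2^n _) 2^≤

      fits-restrict : ∀ {i s} (p : Prefix i s) all {cs} → 2 ^ len (univ p all ω) ≤ ℓ →
        (∀ {z} → z ∈ᵗ univ p all ω → size z ≤ ℓ) → len cs ≤ B →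
        Fits B (filterᶜ memberᶜ) (run (univᶜ p all) (encℕ ω) ∙ cs)
      fits-restrict p all {cs} 2^≤ size≤ cs≤ rewrite run-univ p all ω =
        fits-filter (univ p all ω) cs (≤-trans (n≤2^n _) (≤-trans 2^≤ ℓ≤B)) λ {z} z∈ →
          fits-member z cs cs≤ (compare≤ (≤-trans (size≤ z∈) (≤-trans (m≤m+n ℓ ℓ) (m≤n+m _ 4))))

    -- The program joins all pairs of states, including those that describe no structure, so this
    -- induction must do without structures. It succeeds because the inside types of a join are
    -- filtered from the universe and its matrix part is rebuilt from colours and booleans.
    join-code : ∀ {i s} (p : Prefix i s) st → Tame ℓ ω p (allᵛ inside st) → ∀ {t u} →
      InUniv p (allᵛ isˡ st) t → InUniv p (allᵛ isʳ st) u →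
      Fits B (joinᶜ p st) (t ∙ u ∙ e) × join p st e t u ∈ᵗ univ p (allᵛ inside st) ω
    join-code (matrix g) st tame t∈ u∈ =
      matrix-code g st (allᵛ isˡ st) (allᵛ isʳ st) (allᵛ inside st)
        (λ h → absorb (inside-⊇ st isˡ⇒inside) h , absorb (inside-⊇ st isʳ⇒inside) h) t∈ u∈
    join-code (vertex b p) st (tame₀ , tame , 2^≤ , len≤ , size≤) {t} {u} t∈ u∈
      with vertex-univ {b = b} p (allᵛ isˡ st) t∈ | vertex-univ {b = b} p (allᵛ isʳ st) u∈
    ... | ht∈ , lt , tt∈ | hu∈ , lu , tu∈ =
      ( (_ , proj₁ first) ,
        ((_ , fits-univ p all tame) , ((_ , _ , (_ , fits-R) , _) , fits-L)) ,
        fits-restrict p all 2^≤ size≤ cs≤ ) ,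
      subst (_∈ᵗ univ (vertex b p) all ω) (sym (join-vertex {b = b} p st F r ω t u))
        (∈-pairs⁺ {_∙_} (proj₂ first) (restrict∈sublists (vertexCandidates p st e t u) (univ p all ω)))
      where
      all    = allᵛ inside st
      first  = join-code p (° ∷ st) tame₀ ht∈ hu∈
      lt≤    = ≤-trans lt (len-univ≤ p (allᵛ isˡ st) (inside-⊇ st isˡ⇒inside) 2^≤ len≤)
      lu≤    = ≤-trans lu (len-univ≤ p (allᵛ isʳ st) (inside-⊇ st isʳ⇒inside) 2^≤ len≤)
      1≤B    = ≤-trans 1≤ℓ ℓ≤B
      fits-R = fits-pairs {f = joinᶜ p (ʳ ∷ st)} {e} (head t ∙ nil) (tail u) {nil} 1≤B (≤-trans lu≤ ℓ≤B)
                 λ { here y∈ → proj₁ (join-code p (ʳ ∷ st) tame ht∈ (tu∈ y∈)) ; (there ()) _ }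
      fits-L = fits-pairs {f = joinᶜ p (ˡ ∷ st)} {e} (tail t) (head u ∙ nil) (≤-trans lt≤ ℓ≤B) 1≤B
                 λ { x∈ here → proj₁ (join-code p (ˡ ∷ st) tame (tt∈ x∈) hu∈) ; _ (there ()) }
      cs≤ : len (run (pairsᶜ (joinᶜ p (ˡ ∷ st))) (tail t ∙ (head u ∙ nil) ∙
                  run (pairsᶜ (joinᶜ p (ʳ ∷ st))) ((head t ∙ nil) ∙ tail u ∙ nil ∙ e) ∙ e)) ≤ B
      cs≤ = begin
        _                                        ≡⟨ cong len (run-pairs (joinᶜ p (ˡ ∷ st)) (tail t) (head u ∙ nil) _ e) ⟩
        _                                        ≡⟨ len-pairs (tail t) (head u ∙ nil) _ ⟩
        len (tail t) * 1 + len (run (pairsᶜ (joinᶜ p (ʳ ∷ st))) ((head t ∙ nil) ∙ tail u ∙ nil ∙ e))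
          ≡⟨ cong₂ _+_ (*-identityʳ (len (tail t)))
               (trans (cong len (run-pairs (joinᶜ p (ʳ ∷ st)) (head t ∙ nil) (tail u) nil e))
                      (len-pairs {join p (ʳ ∷ st) e} (head t ∙ nil) (tail u) nil)) ⟩
        len (tail t) + (len (tail u) + 0 + 0)    ≤⟨ +-mono-≤ lt≤ (+-monoˡ-≤ 0 (+-monoˡ-≤ 0 lu≤)) ⟩
        ℓ + (ℓ + 0 + 0)                          ≤⟨ m≤n+m _ 1 ⟩
        1 + (ℓ + (ℓ + 0 + 0))                    ≤⟨ m≤m+n _ (ℓ * ℓ) ⟩
        1 + (ℓ + (ℓ + 0 + 0)) + ℓ * ℓ            ≡⟨ ring ℓ ⟩
        suc ℓ * suc ℓ                            ≤⟨ square≤B ⟩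
        B                                        ∎
        where open ≤-Reasoning
              ring : ∀ ℓ → 1 + (ℓ + (ℓ + 0 + 0)) + ℓ * ℓ ≡ suc ℓ * suc ℓ
              ring = solve-∀
    join-code (set b p) st (tame , 2^≤ , len≤ , size≤) {t} {u} t∈ u∈
      with set-univ {b = b} p (allᵛ isˡ st) t∈ | set-univ {b = b} p (allᵛ isʳ st) u∈
    ... | ht∈ , lt , tt∈ | hu∈ , lu , tu∈ =
      ( (_ , proj₁ first) ,
        ((_ , fits-univ p all tame) , (_ , fits-C)) ,
        fits-restrict p all 2^≤ size≤ cs≤ ) ,
      subst (_∈ᵗ univ (set b p) all ω) (sym (join-set {b = b} p st F r ω t u))
        (∈-pairs⁺ {_∙_} (proj₂ first) (restrict∈sublists (setCandidates p st e t u) (univ p all ω)))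
      where
      all    = allᵛ inside st
      first  = join-code p st tame ht∈ hu∈
      lt≤    = ≤-trans lt (len-univ≤ p (allᵛ isˡ st) (inside-⊇ st isˡ⇒inside) 2^≤ len≤)
      lu≤    = ≤-trans lu (len-univ≤ p (allᵛ isʳ st) (inside-⊇ st isʳ⇒inside) 2^≤ len≤)
      1+ℓ≤B  = ≤-trans (n≤1+n (suc ℓ)) 2+ℓ≤B
      fits-C = fits-pairs {f = joinᶜ p st} {e} (head t ∙ tail t) (head u ∙ tail u) {nil}
                 (≤-trans (s≤s lt≤) 1+ℓ≤B) (≤-trans (s≤s lu≤) 1+ℓ≤B)
                 λ x∈ y∈ → proj₁ (join-code p st tame (tt∈ x∈) (tu∈ y∈))
      cs≤ : len (run (pairsᶜ (joinᶜ p st)) ((head t ∙ tail t) ∙ (head u ∙ tail u) ∙ nil ∙ e)) ≤ B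
      cs≤ = begin
        _                                        ≡⟨ cong len (run-pairs (joinᶜ p st) (head t ∙ tail t) (head u ∙ tail u) nil e) ⟩
        _                                        ≡⟨ len-pairs (head t ∙ tail t) (head u ∙ tail u) nil ⟩
        suc (len (tail t)) * suc (len (tail u)) + 0  ≡⟨ +-identityʳ _ ⟩
        suc (len (tail t)) * suc (len (tail u))  ≤⟨ *-mono-≤ (s≤s lt≤) (s≤s lu≤) ⟩
        suc ℓ * suc ℓ                            ≤⟨ square≤B ⟩
        B                                        ∎
        where open ≤-Reasoning

-- The program

sequence : ∀ {p q r x y z w a b c} → p ⊢ x ⇓ y within a → q ⊢ y ⇓ z within b → r ⊢ z ⇓ w within c →
           p ⨾ q ⨾ r ⊢ x ⇓ w within b + (a + c + 2)
sequence {a = a} {b} {c} (m , m≤ , s) (n , n≤ , t) (k , k≤ , u) =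
  suc (m + suc (n + k)) ,
  ≤-trans (s≤s (+-mono-≤ m≤ (s≤s (+-mono-≤ n≤ k≤)))) (≤-reflexive (ring a b c)) ,
  seq s (seq t u)
  where ring : ∀ a b c → suc (a + suc (b + c)) ≡ b + (a + c + 2)
        ring = solve-∀

module _ (p : Prefix 0 1) where

  serᶜ : Code
  serᶜ = primᶜ serPrim

  statesᶜ : Code
  statesᶜ = cartᶜ boolsᶜ (univᶜ p true)

  leafStateᶜ : Bool → Code
  leafStateᶜ b = consᶜ (boolᶜ b) (boxᶜ (singleᶜ p [] ((λ _ → b) ∷ [])))

  leafᶜ : Code
  leafᶜ = consᶜ (consᶜ (leafStateᶜ false ▸ serᶜ) nilᶜ) (consᶜ (consᶜ (leafStateᶜ true ▸ serᶜ) nilᶜ) nilᶜ)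

  unaryWordᶜ binaryWordᶜ : Code
  unaryWordᶜ =
    consᶜ (consᶜ nilᶜ (consᶜ (argᶜ 0 ▸ tlᶜ) (consᶜ nilᶜ (dropᶜ 2)) ▸ boxᶜ (joinᶜ p [])) ▸ serᶜ)
          (consᶜ (argᶜ 0 ▸ serᶜ) nilᶜ)
  binaryWordᶜ =
    consᶜ (consᶜ nilᶜ (consᶜ (argᶜ 0 ▸ tlᶜ) (consᶜ (argᶜ 1 ▸ tlᶜ) (dropᶜ 2)) ▸ boxᶜ (joinᶜ p [])) ▸ serᶜ)
          (consᶜ (argᶜ 0 ▸ serᶜ) (consᶜ (argᶜ 1 ▸ serᶜ) nilᶜ))

  unaryᶜ binaryᶜ : Code
  unaryᶜ  = consᶜ (dropᶜ 2 ▸ statesᶜ) (consᶜ yesᶜ (consᶜ nilᶜ itᶜ)) ▸ pairsᶜ unaryWordᶜ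
  binaryᶜ = consᶜ (dropᶜ 2 ▸ statesᶜ) (consᶜ (dropᶜ 2 ▸ statesᶜ) (consᶜ nilᶜ itᶜ)) ▸ pairsᶜ binaryWordᶜ

  pullsIntoᶜ : Code
  pullsIntoᶜ =
    consᶜ (consᶜ (consᶜ (argᶜ 0 ▸ hdᶜ) (argᶜ 2) ▸ recolorᶜ) (consᶜ (argᶜ 0 ▸ tlᶜ) (argᶜ 2) ▸ recolorᶜ)) (argᶜ 1)
    ▸ memberᶜ

  pullbackᶜ : Code
  pullbackᶜ = consᶜ (dropᶜ 2 ▸ cartᶜ colorsᶜ colorsᶜ) itᶜ ▸ filterᶜ pullsIntoᶜ

  acceptᶜ : Code
  acceptᶜ = consᶜ (consᶜ statesᶜ nilᶜ ▸ filterᶜ (hdᶜ ▸ tlᶜ ▸ boxᶜ (evalᶜ p))) (consᶜ yesᶜ (consᶜ nilᶜ nilᶜ))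
          ▸ pairsᶜ (hdᶜ ▸ serᶜ)

  -- From ((t ∙ F) ∙ stack) ∙ output ∙ W to tag ∙ arguments ∙ F ∙ stack ∙ output ∙ W,
  -- where t = tag ∙ arguments.
  unpackᶜ : Code
  unpackᶜ =
    consᶜ (hdᶜ ▸ hdᶜ ▸ hdᶜ ▸ hdᶜ) (consᶜ (hdᶜ ▸ hdᶜ ▸ hdᶜ ▸ tlᶜ)
      (consᶜ (hdᶜ ▸ hdᶜ ▸ tlᶜ) (consᶜ (hdᶜ ▸ tlᶜ) tlᶜ)))

  -- The output grows at the front: first the root, then the right subtree, then the left one. So
  -- `t₂` goes on top of the stack, and the finished list is in postorder.
  leafStepᶜ ⊕Stepᶜ : Code
  leafStepᶜ = consᶜ (argᶜ 3) (consᶜ (consᶜ (argᶜ 1 ▸ boxᶜ leafᶜ) (argᶜ 4)) (dropᶜ 5))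
  ⊕Stepᶜ =
    consᶜ (consᶜ (consᶜ (argᶜ 1 ▸ tlᶜ) (argᶜ 2)) (consᶜ (consᶜ (argᶜ 1 ▸ hdᶜ) (argᶜ 2)) (argᶜ 3)))
          (consᶜ (consᶜ (consᶜ (argᶜ 2) (consᶜ yesᶜ (dropᶜ 5)) ▸ boxᶜ binaryᶜ) (argᶜ 4)) (dropᶜ 5))

  recolorEnvᶜ addEdgesEnvᶜ : Code
  recolorEnvᶜ  = consᶜ (argᶜ 2) (consᶜ (argᶜ 1 ▸ tlᶜ) (dropᶜ 5))
  addEdgesEnvᶜ =
    consᶜ (consᶜ (argᶜ 1 ▸ tlᶜ)
                 (consᶜ (consᶜ (argᶜ 1 ▸ dropᶜ 2) (argᶜ 1 ▸ argᶜ 1)) (argᶜ 2)))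
          (consᶜ (consᶜ (argᶜ 1 ▸ argᶜ 1) (argᶜ 1 ▸ argᶜ 1)) (dropᶜ 5))

  unaryStepᶜ : Code → Code
  unaryStepᶜ env =
    consᶜ env itᶜ ▸
    consᶜ (consᶜ (consᶜ (argᶜ 2 ▸ hdᶜ) (hdᶜ ▸ boxᶜ pullbackᶜ)) (argᶜ 4))
          (consᶜ (consᶜ (hdᶜ ▸ boxᶜ unaryᶜ) (argᶜ 5)) (dropᶜ 6))

  -- Tags are unary numbers, so stripping one unit at a time and testing for `nil` separates leaf,
  -- union, recolouring and edge insertion.
  stepᶜ : Code
  stepᶜ = unpackᶜ ▸
    ifᶜ hdᶜ (ifᶜ (hdᶜ ▸ tlᶜ) (ifᶜ (hdᶜ ▸ tlᶜ ▸ tlᶜ) (boxᶜ (unaryStepᶜ addEdgesEnvᶜ)) (boxᶜ (unaryStepᶜ recolorEnvᶜ)))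
                             (boxᶜ ⊕Stepᶜ))
            (boxᶜ leafStepᶜ)

  startᶜ finishᶜ : Code
  startᶜ  = consᶜ (consᶜ (consᶜ tlᶜ nilᶜ) nilᶜ) (consᶜ nilᶜ hdᶜ)
  finishᶜ = consᶜ (dropᶜ 2 ▸ boxᶜ acceptᶜ) (argᶜ 1)

  loopOf : Program → Program
  loopOf s = while hd loop s

  main : Program
  main = ⌜ startᶜ ⌝ ⨾ loopOf ⌜ stepᶜ ⌝ ⨾ ⌜ finishᶜ ⌝

  encWord : ∀ {n} → Vec Bits n → Tree
  encWord w = encList encBits (Vec.toList w)

  encProcess : ∀ {ω} {D : Decomp ω} → Tree → Node D → Tree
  encProcess {D = D} F n = encList encWord (processᴰ p D F n)

  module _ {ω : ℕ} where

    run-states : run statesᶜ (encℕ ω) ≡ states p {ω}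
    run-states = trans (run-cart boolsᶜ (univᶜ p true) (encℕ ω)) (cong (cart bools) (run-univ p true ω))

    run-binary : ∀ (t₁ t₂ : Decomp ω) F → run binaryᶜ (plainEnv p {ω} F) ≡ encProcess {D = t₁ ⊕ t₂} F root
    run-binary t₁ t₂ F =
      trans (run-pairs binaryWordᶜ (run statesᶜ (encℕ ω)) (run statesᶜ (encℕ ω)) nil (plainEnv p {ω} F))
        (trans (cong (λ S → pairs (λ x y → run binaryWordᶜ (x ∙ y ∙ plainEnv p {ω} F)) S S nil) run-states)
               (sym (encList-pairs encWord (binaryWord p {ω} (plainEnv p {ω} F)) (states p) (states p) [])))

    run-unary : ∀ e → tail (tail e) ≡ encℕ ω →
      run unaryᶜ e ≡ encList encWord (pairsₗ (unaryWord p {ω} e) (states p {ω}) (nil ∙ nil) [])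
    run-unary e h =
      trans (run-pairs unaryWordᶜ (run statesᶜ (tail (tail e))) (nil ∙ nil) nil e)
        (trans (cong (λ S → pairs (λ x y → run unaryWordᶜ (x ∙ y ∙ e)) S (nil ∙ nil) nil)
                     (trans (cong (run statesᶜ) h) run-states))
               (sym (encList-pairs encWord (unaryWord p {ω} e) (states p {ω}) (nil ∙ nil) [])))

    run-pullback : ∀ e → tail (tail e) ≡ encℕ ω → run pullbackᶜ e ≡ childContext p {ω} e
    run-pullback e h =
      trans (run-filter pullsIntoᶜ (run (cartᶜ colorsᶜ colorsᶜ) (tail (tail e))) e)
        (trans (cong (λ l → filter (λ c → run pullsIntoᶜ (c ∙ e)) l nil) all-pairs)
               (filter-cong (cart (colors ω) (colors ω)) nil λ {c} _ → run-member _ (head e)))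
      where
      all-pairs : run (cartᶜ colorsᶜ colorsᶜ) (tail (tail e)) ≡ cart (colors ω) (colors ω)
      all-pairs = trans (cong (run (cartᶜ colorsᶜ colorsᶜ)) h)
        (trans (run-cart colorsᶜ colorsᶜ (encℕ ω)) (cong₂ cart (run-colors ω) (run-colors ω)))

    run-accept : run acceptᶜ (encℕ ω) ≡ encList encBits (acceptᴰ p {ω})
    run-accept =
      trans (run-pairs (hdᶜ ▸ serᶜ)
               (run (filterᶜ (hdᶜ ▸ tlᶜ ▸ boxᶜ (evalᶜ p))) (run statesᶜ (encℕ ω) ∙ nil)) (nil ∙ nil) nil nil)
        (trans (cong (λ S → pairs (λ x _ → encBits (ser x)) S (nil ∙ nil) nil)
                 (trans (run-filter (hdᶜ ▸ tlᶜ ▸ boxᶜ (evalᶜ p)) (run statesᶜ (encℕ ω)) nil)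
                   (trans (cong (λ S → filter (λ s → run (evalᶜ p) (tail s)) S nil) run-states)
                          (filter-cong (states p) nil λ {s} _ → run-eval p (tail s)))))
               (sym (encList-pairs encBits (λ s _ → ser s) (acceptedStates p) (nil ∙ nil) [])))

  -- Correctness and running time of the main loop.

  outputs : ∀ {ω} (D : Decomp ω) → Tree → Tree → Tree
  outputs D F out = foldr (λ n → encProcess {D = D} F n ∙_) out (nodes D)

  item : ∀ {ω} → Decomp ω → Tree → Tree
  item D F = encDecomp D ∙ F

  rest : ∀ {ω} → Decomp ω → Tree → Tree → Tree
  rest (intro a)            F st = st
  rest (t₁ ⊕ t₂)            F st = item t₂ F ∙ item t₁ F ∙ st
  rest {ω} (recolor t a b)  F st = item t (childContext p {ω} (recolorEnv p a b F)) ∙ st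
  rest {ω} (addEdges t a b) F st = item t (childContext p {ω} (addEdgesEnv p a b F)) ∙ st

  run-step : ∀ {ω} (D : Decomp ω) F st out →
    run stepᶜ ((item D F ∙ st) ∙ out ∙ encℕ ω) ≡ rest D F st ∙ (encProcess {D = D} F root ∙ out) ∙ encℕ ω
  run-step (intro a) F st out = refl
  run-step {ω} (t₁ ⊕ t₂) F st out =
    cong (λ o → rest (t₁ ⊕ t₂) F st ∙ (o ∙ out) ∙ encℕ ω) (run-binary t₁ t₂ F)
  run-step {ω} (recolor t a b) F st out =
    cong₂ (λ c o → (item t c ∙ st) ∙ (o ∙ out) ∙ encℕ ω)
      (run-pullback {ω} (recolorEnv p a b F) refl) (run-unary {ω} (recolorEnv p a b F) refl)
  run-step {ω} (addEdges t a b) F st out =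
    cong₂ (λ c o → (item t c ∙ st) ∙ (o ∙ out) ∙ encℕ ω)
      (run-pullback {ω} (addEdgesEnv p a b F) refl) (run-unary {ω} (addEdgesEnv p a b F) refl)

  module _ {ω ℓ T : ℕ} (W : Tree) (s : Program)
           (pullback≤ : ∀ r F → len (pullback {ω} r F) ≤ ℓ)
           (step : ∀ (D : Decomp ω) F st o → len F ≤ ℓ →
                   s ⊢ (item D F ∙ st) ∙ o ∙ W ⇓ rest D F st ∙ (encProcess {D = D} F root ∙ o) ∙ W within T) where

    iteration : ∀ (D : Decomp ω) F → len F ≤ ℓ → ∀ {st o z k} →
      loopOf s ⊢ rest D F st ∙ (encProcess {D = D} F root ∙ o) ∙ W ⇓ z within k →
      loopOf s ⊢ (item D F ∙ st) ∙ o ∙ W ⇓ z within T + 2 + k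
    iteration D F F≤ {st} {o} {z} {k} (n , n≤ , r) =
      let m , m≤ , t = step D F st o F≤ in
      suc (1 + m + n) , ≤-trans (s≤s (s≤s (+-mono-≤ m≤ n≤))) (≤-reflexive (ring T k)) , loop hd t r
      where ring : ∀ x k → 2 + (x + k) ≡ x + 2 + k
            ring = solve-∀

    -- Again a continuation stands for the rest of the stack, so the recursion on the decomposition
    -- charges `T + 2` once per node. The context passed to a child is either inherited or a
    -- pullback, hence short in both cases.
    loop-exec : ∀ (D : Decomp ω) F → len F ≤ ℓ → ∀ {st o z k} →
      loopOf s ⊢ st ∙ outputs D F o ∙ W ⇓ z within k →
      loopOf s ⊢ (item D F ∙ st) ∙ o ∙ W ⇓ z within #nodes D * (T + 2) + k
    loop-exec D@(intro a) F F≤ {k = k} h =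
      within-mono (≤-reflexive (cong (_+ k) (sym (+-identityʳ (T + 2))))) (iteration D F F≤ h)
    loop-exec D@(t₁ ⊕ t₂) F F≤ {st} {o} {z} {k} h =
      within-mono (≤-reflexive count≡)
        (iteration D F F≤ (loop-exec t₂ F F≤ (loop-exec t₁ F F≤
          (subst (λ x → loopOf s ⊢ st ∙ x ∙ W ⇓ z within k) outputs≡ h))))
      where
      outputs≡ : outputs D F o ≡ outputs t₁ F (outputs t₂ F (encProcess {D = D} F root ∙ o))
      outputs≡ = trans (List.foldr-++ _ o (map left (nodes t₁)) _)
        (trans (List.foldr-map _ left _ (nodes t₁))
          (cong (λ x → foldr (λ n → encProcess {D = t₁} F n ∙_) x (nodes t₁))
            (trans (List.foldr-++ _ o (map right (nodes t₂)) _) (List.foldr-map _ right _ (nodes t₂)))))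
      #≡ : #nodes D ≡ #nodes t₁ + (#nodes t₂ + 1)
      #≡ = trans (List.length-++ (map left (nodes t₁)))
        (cong₂ _+_ (List.length-map left (nodes t₁))
          (trans (List.length-++ (map right (nodes t₂))) (cong (_+ 1) (List.length-map right (nodes t₂)))))
      count≡ : (T + 2) + (#nodes t₂ * (T + 2) + (#nodes t₁ * (T + 2) + k)) ≡ #nodes D * (T + 2) + k
      count≡ = trans (ring (T + 2) (#nodes t₁) (#nodes t₂) k) (cong (λ n → n * (T + 2) + k) (sym #≡))
        where ring : ∀ s a b k → s + (b * s + (a * s + k)) ≡ (a + (b + 1)) * s + k
              ring = solve-∀
    loop-exec D@(recolor t a b) F F≤ {st} {o} {z} {k} h =
      within-mono (≤-reflexive count≡)
        (iteration D F F≤ (loop-exec t _ (pullback≤ (encFin a ∙ encFin b) F)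
          (subst (λ x → loopOf s ⊢ st ∙ x ∙ W ⇓ z within k) outputs≡ h)))
      where
      outputs≡ : outputs D F o ≡ outputs t (childContext p {ω} (recolorEnv p a b F)) (encProcess {D = D} F root ∙ o)
      outputs≡ = trans (List.foldr-++ _ o (map inRec (nodes t)) _) (List.foldr-map _ inRec _ (nodes t))
      count≡ : (T + 2) + (#nodes t * (T + 2) + k) ≡ #nodes D * (T + 2) + k
      count≡ = trans (ring (T + 2) (#nodes t) k) (cong (λ n → n * (T + 2) + k)
        (sym (trans (List.length-++ (map inRec (nodes t))) (cong (_+ 1) (List.length-map inRec (nodes t))))))
        where ring : ∀ s b k → s + (b * s + k) ≡ (b + 1) * s + k
              ring = solve-∀
    loop-exec D@(addEdges t a b) F F≤ {st} {o} {z} {k} h =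
      within-mono (≤-reflexive count≡)
        (iteration D F F≤ (loop-exec t _ (pullback≤ (encFin a ∙ encFin a) (joined a b F))
          (subst (λ x → loopOf s ⊢ st ∙ x ∙ W ⇓ z within k) outputs≡ h)))
      where
      outputs≡ : outputs D F o ≡ outputs t (childContext p {ω} (addEdgesEnv p a b F)) (encProcess {D = D} F root ∙ o)
      outputs≡ = trans (List.foldr-++ _ o (map inAdd (nodes t)) _) (List.foldr-map _ inAdd _ (nodes t))
      count≡ : (T + 2) + (#nodes t * (T + 2) + k) ≡ #nodes D * (T + 2) + k
      count≡ = trans (ring (T + 2) (#nodes t) k) (cong (λ n → n * (T + 2) + k)
        (sym (trans (List.length-++ (map inAdd (nodes t))) (cong (_+ 1) (List.length-map inAdd (nodes t))))))
        where ring : ∀ s b k → s + (b * s + k) ≡ (b + 1) * s + k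
              ring = solve-∀

  record TopTame (ℓ ω : ℕ) : Set where
    field
      tame  : Tame ℓ ω p true
      len≤  : len (univ p true ω) ≤ ℓ
      size≤ : ∀ {z} → z ∈ᵗ univ p true ω → size z ≤ ℓ

  module _ {ℓ B ω : ℕ} (budget : Budget ℓ B ω) (top : TopTame ℓ ω) where
    open Budget budget
    open TopTame top

    private
      W = encℕ ω

      1≤B : 1 ≤ B
      1≤B = ≤-trans (s≤s z≤n) 2+ℓ≤B

    fits-ser : ∀ t → size t ≤ 4 + ℓ → Fits B serᶜ t
    fits-ser t t≤ = compare≤ budget (≤-trans t≤ (+-monoʳ-≤ 4 (m≤m+n ℓ ℓ)))

    state-size : ∀ {b t} → size b ≤ 3 → t ∈ᵗ univ p true ω → size (b ∙ t) ≤ 4 + ℓ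
    state-size b≤ t∈ = s≤s (+-mono-≤ b≤ (size≤ t∈))

    bool-size : ∀ {b} → b ∈ᵗ bools → size b ≤ 3
    bool-size here         = ≤ᵇ⇒≤ 1 3 tt
    bool-size (there here) = ≤-refl

    states⁻ : ∀ {s} → s ∈ᵗ states p {ω} → size s ≤ 4 + ℓ × tail s ∈ᵗ univ p true ω
    states⁻ s∈ with ∈-pairs⁻ {_∙_} bools {univ p true ω} s∈
    ... | inj₂ (b , t , b∈ , t∈ , refl) = state-size (bool-size b∈) t∈ , t∈

    len-states : len (states p {ω}) ≤ B
    len-states = begin
      len (states p {ω})                ≡⟨ len-pairs {_∙_} bools (univ p true ω) nil ⟩
      2 * len (univ p true ω) + 0       ≤⟨ +-monoˡ-≤ 0 (*-monoʳ-≤ 2 len≤) ⟩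
      2 * ℓ + 0                         ≤⟨ m≤m+n _ (ℓ * ℓ + 1) ⟩
      2 * ℓ + 0 + (ℓ * ℓ + 1)           ≡⟨ ring ℓ ⟩
      suc ℓ * suc ℓ                     ≤⟨ square≤B ⟩
      B                                 ∎
      where open ≤-Reasoning
            ring : ∀ ℓ → 2 * ℓ + 0 + (ℓ * ℓ + 1) ≡ suc ℓ * suc ℓ
            ring = solve-∀

    fits-states : Fits B statesᶜ W
    fits-states = fits-cart boolsᶜ (univᶜ p true) W _ (fits-univ budget p true tame)
      (≤-trans (2≤ℓ budget) (ℓ≤B budget))
      (≤-trans (≤-reflexive (cong len (run-univ p true ω))) (≤-trans len≤ (ℓ≤B budget)))

    fits-join : ∀ {F r} → len F ≤ B → tail r ∈ᵗ colors ω → ∀ {t u} →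
      InUniv budget p true t → InUniv budget p true u →
      Fits B (joinᶜ p []) (t ∙ u ∙ F ∙ r ∙ W) × join p [] (F ∙ r ∙ W) t u ∈ᵗ univ p true ω
    fits-join F≤ r∈ t∈ u∈ = join-code budget F≤ r∈ p [] tame t∈ u∈

    fits-unary : ∀ {F r} → len F ≤ B → tail r ∈ᵗ colors ω → Fits B unaryᶜ (F ∙ r ∙ W)
    fits-unary {F} {r} F≤ r∈ =
      ((_ , fits-states) , _) ,
      subst (λ S → Fits B (pairsᶜ unaryWordᶜ) (S ∙ (nil ∙ nil) ∙ nil ∙ F ∙ r ∙ W)) (sym run-states)
        (fits-pairs (states p) (nil ∙ nil) len-states 1≤B word)
      where
      word : ∀ {s y} → s ∈ᵗ states p {ω} → y ∈ᵗ nil ∙ nil → Fits B unaryWordᶜ (s ∙ y ∙ F ∙ r ∙ W)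
      word {s} s∈ _ with states⁻ s∈
      ... | s≤ , ts∈ with fits-join F≤ r∈ (inj₁ ts∈) (inj₂ refl)
      ...   | f , j∈ = ((_ , _ , f) , fits-ser (unaryState p {ω} (F ∙ r ∙ W) s) (state-size {nil} {join p [] (F ∙ r ∙ W) (tail s) nil} (≤ᵇ⇒≤ 1 3 tt) j∈)) , (_ , fits-ser s s≤) , _

    fits-binary : ∀ {F r} → len F ≤ B → tail r ∈ᵗ colors ω → Fits B binaryᶜ (F ∙ r ∙ W)
    fits-binary {F} {r} F≤ r∈ =
      ((_ , fits-states) , (_ , fits-states) , _) ,
      subst (λ S → Fits B (pairsᶜ binaryWordᶜ) (S ∙ S ∙ nil ∙ F ∙ r ∙ W)) (sym run-states)
        (fits-pairs (states p) (states p) len-states len-states word)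
      where
      word : ∀ {s s′} → s ∈ᵗ states p {ω} → s′ ∈ᵗ states p {ω} → Fits B binaryWordᶜ (s ∙ s′ ∙ F ∙ r ∙ W)
      word {s} {s′} s∈ s′∈ with states⁻ s∈ | states⁻ s′∈
      ... | s≤ , ts∈ | s′≤ , ts′∈ with fits-join F≤ r∈ (inj₁ ts∈) (inj₁ ts′∈)
      ...   | f , j∈ = ((_ , _ , f) , fits-ser (binaryState p {ω} (F ∙ r ∙ W) s s′) (state-size {nil} {join p [] (F ∙ r ∙ W) (tail s) (tail s′)} (≤ᵇ⇒≤ 1 3 tt) j∈)) , (_ , fits-ser s s≤) , (_ , fits-ser s′ s′≤) , _

    fits-pullback : ∀ {F r} → len F ≤ B → tail r ∈ᵗ colors ω → Fits B pullbackᶜ (F ∙ r ∙ W)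
    fits-pullback {F} {r} F≤ r∈ =
      ((_ , fits-cart colorsᶜ colorsᶜ W (fits-colors ω ω≤B) (fits-colors ω ω≤B) len≤B len≤B) , _) ,
      subst (λ l → Fits B (filterᶜ pullsIntoᶜ) (l ∙ F ∙ r ∙ W)) (sym all-pairs)
        (fits-filter (cart (colors ω) (colors ω)) (F ∙ r ∙ W) pairs≤ pulls)
      where
      ω≤B = ≤-trans (ω≤ℓ budget) (ℓ≤B budget)
      len≤B = ≤-trans (≤-reflexive (len-run-colors budget)) ω≤B
      all-pairs : run (cartᶜ colorsᶜ colorsᶜ) W ≡ cart (colors ω) (colors ω)
      all-pairs = trans (run-cart colorsᶜ colorsᶜ W) (cong₂ cart (run-colors ω) (run-colors ω))
      pairs≤ : len (cart (colors ω) (colors ω)) ≤ B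
      pairs≤ = ≤-trans (≤-reflexive (trans (len-pairs {_∙_} (colors ω) (colors ω) nil)
                 (trans (+-identityʳ _) (cong₂ _*_ (len-colors ω) (len-colors ω)))))
                 (≤-trans ω*ω≤ (ℓ≤B budget))
      pulls : ∀ {c} → c ∈ᵗ cart (colors ω) (colors ω) → Fits B pullsIntoᶜ (c ∙ F ∙ r ∙ W)
      pulls c∈ with ∈-cart⁻ (colors ω) c∈
      ... | a∈ , b∈ =
        (((_ , fits-recolor budget F≤ r∈ a∈) , (_ , fits-recolor budget F≤ r∈ b∈)) , _) ,
        fits-member _ F F≤ (compare-pair≤ budget {F} {r} F≤ r∈ (recolor∈colors budget {F} {r} F≤ r∈ a∈)
          (recolor∈colors budget {F} {r} F≤ r∈ b∈))

    fits-single : ∀ {i s} (q : Prefix i s) ρ σ c → Fits B (singleᶜ q ρ σ) c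
    fits-single (matrix {i} {s} g) ρ σ c = go (allᵛ is-just ρ)
      where
      fits-bool : ∀ b {x} → Fits B (boolᶜ b) x
      fits-bool true  = _
      fits-bool false = _
      fits-hue : ∀ m → Fits B (maybe′ (λ _ → itᶜ) nilᶜ m) c
      fits-hue (just _) = _
      fits-hue nothing  = _
      go : ∀ b → Fits B (singleMatrixᶜ {suc i} {s} g b ρ σ) c
      go true  = fits-bool (g (values (single nil) ρ σ))
      go false = fits-tuple (λ x → maybe′ (λ _ → itᶜ) nilᶜ (lookup ρ x)) (λ x → fits-hue (lookup ρ x)) ,
                 fits-tuple (λ k → boolᶜ (value (single nil) ρ σ (atom k))) (λ k → fits-bool (value (single nil) ρ σ (atom k)))
    fits-single (vertex _ q) ρ σ c = fits-single q (nothing ∷ ρ) σ c , fits-single q (just tt ∷ ρ) σ c , _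
    fits-single (set _ q) ρ σ c =
      fits-single q ρ ((λ _ → false) ∷ σ) c , fits-single q ρ ((λ _ → true) ∷ σ) c , _

    fits-leaf : ∀ (a : Fin ω) → Fits B leafᶜ (encFin a)
    fits-leaf a = (state false , _) , (state true , _) , _
      where
      fits-bool : ∀ b {x} → Fits B (boolᶜ b) x
      fits-bool true  = _
      fits-bool false = _
      state : ∀ b → Fits B (leafStateᶜ b ▸ serᶜ) (encFin a)
      state b = (fits-bool b , fits-single p [] ((λ _ → b) ∷ []) (encFin a)) ,
        fits-ser (run (boolᶜ b) (encFin a) ∙ run (singleᶜ p [] ((λ _ → b) ∷ [])) (encFin a))
          (state-size {run (boolᶜ b) (encFin a)}
            (bool-size (subst (_∈ᵗ bools) (sym (run-bool b)) (encBool∈bools b)))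
            (single∈univ p [] ((λ _ → b) ∷ []) (encFin∈colors a) (encℕ∈colors 0<ω′)))

    fits-quantify : ∀ b {c} l → len l ≤ B → (∀ {x} → x ∈ᵗ l → Fits B c x) → Fits B (quantifyᶜ b c) l
    fits-quantify true {c} l l≤ h = _ , l≤ , fitsFold l λ x a x∈ →
      (_ , h x∈) , fitsBranch (run c x) _ _
    fits-quantify false {c} l l≤ h = _ , l≤ , fitsFold l λ x a x∈ →
      (_ , h x∈) , fitsBranch (run c x) _ _

    fits-eval : ∀ {i s} (q : Prefix i s) all → Tame ℓ ω q all → ∀ {t} → InUniv budget q all t →
                Fits B (evalᶜ q) t
    fits-eval (matrix g) all _ {t} _ = _ , fitsBranch t _ _
    fits-eval (vertex b q) all (_ , tame , 2^≤ , _ , _) {t} t∈ with vertex-univ budget {b = b} q all t∈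
    ... | _ , l≤ , sub = _ , fits-quantify b (tail t) (≤-trans l≤ (≤-trans (n≤2^n _) (≤-trans 2^≤ (ℓ≤B budget))))
                               (λ x∈ → fits-eval q all tame (sub x∈))
    fits-eval (set b q) all (tame , 2^≤ , _ , _) {t} t∈ with set-univ budget {b = b} q all t∈
    ... | _ , l≤ , sub =
      _ , fits-quantify b (head t ∙ tail t)
            (≤-trans (s≤s (≤-trans l≤ (≤-trans (n≤2^n _) 2^≤))) (≤-trans (n≤1+n _) 2+ℓ≤B))
            (λ x∈ → fits-eval q all tame (sub x∈))

    fits-accept : Fits B acceptᶜ W
    fits-accept =
      (((fits-states , _) , filter-fits) , _) ,
      subst (λ S → Fits B (pairsᶜ (hdᶜ ▸ serᶜ)) (S ∙ (nil ∙ nil) ∙ nil ∙ nil)) (sym filtered)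
        (fits-pairs (acceptedStates p) (nil ∙ nil)
          (≤-trans (len-filter _ (states p {ω}) nil) (≤-trans (≤-reflexive (+-identityʳ _)) len-states)) 1≤B
          λ {s} s∈ _ → _ , fits-ser s (proj₁ (states⁻ (accepted s∈))))
      where
      fits-test : ∀ {s} → s ∈ᵗ states p {ω} → Fits B (hdᶜ ▸ tlᶜ ▸ boxᶜ (evalᶜ p)) (s ∙ nil)
      fits-test s∈ = _ , _ , fits-eval p true tame (inj₁ (proj₂ (states⁻ s∈)))
      filter-fits : Fits B (filterᶜ (hdᶜ ▸ tlᶜ ▸ boxᶜ (evalᶜ p))) (run statesᶜ W ∙ nil)
      filter-fits = subst (λ S → Fits B (filterᶜ (hdᶜ ▸ tlᶜ ▸ boxᶜ (evalᶜ p))) (S ∙ nil)) (sym run-states)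
        (fits-filter (states p {ω}) nil len-states fits-test)
      filtered : run (filterᶜ (hdᶜ ▸ tlᶜ ▸ boxᶜ (evalᶜ p))) (run statesᶜ W ∙ nil) ≡ acceptedStates p {ω}
      filtered = trans (run-filter (hdᶜ ▸ tlᶜ ▸ boxᶜ (evalᶜ p)) (run statesᶜ W) nil)
        (trans (cong (λ S → filter (λ s → run (evalᶜ p) (tail s)) S nil) run-states)
               (filter-cong (states p) nil λ {s} _ → run-eval p (tail s)))
      accepted : ∀ {s} → s ∈ᵗ acceptedStates p {ω} → s ∈ᵗ states p {ω}
      accepted s∈ with ∈-filter⁻ {λ s → eval p (tail s)} (states p {ω}) s∈
      ... | inj₂ (s∈′ , _) = s∈′

    len-pullback : ∀ r F → len (pullback {ω} r F) ≤ ℓ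
    len-pullback r F = ≤-trans (len-filter _ (cart (colors ω) (colors ω)) nil)
      (≤-trans (≤-reflexive (trans (+-identityʳ _) (trans (len-pairs {_∙_} (colors ω) (colors ω) nil)
                 (trans (+-identityʳ _) (cong₂ _*_ (len-colors ω) (len-colors ω)))))) ω*ω≤)

    fits-step : ∀ (D : Decomp ω) F st o → len F ≤ ℓ → Fits B stepᶜ ((item D F ∙ st) ∙ o ∙ W)
    fits-step (intro a) F st o F≤ = _ , _ , (_ , ((_ , fits-leaf a) , _) , _)
    fits-step (t₁ ⊕ t₂) F st o F≤ =
      _ , _ , _ , (_ , ((_ , fits-binary (≤-trans F≤ (ℓ≤B budget)) (nil∈colors budget)) , _) , _)
    fits-step (recolor t a b) F st o F≤ =
      _ , _ , _ , _ , (_ , ((_ , (_ , fits-pullback F≤B r∈)) , _) , ((_ , fits-unary F≤B r∈) , _) , _)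
      where F≤B = ≤-trans F≤ (ℓ≤B budget)
            r∈ : encFin b ∈ᵗ colors ω
            r∈ = encFin∈colors b
    fits-step (addEdges t a b) F st o F≤ =
      _ , _ , _ , _ , (_ , ((_ , (_ , fits-pullback F≤B r∈)) , _) , ((_ , fits-unary F≤B r∈) , _) , _)
      where F≤B = ≤-trans (s≤s (s≤s F≤)) 2+ℓ≤B
            r∈ : encFin a ∈ᵗ colors ω
            r∈ = encFin∈colors a

    module _ (64≤B : 64 ≤ B) where

      step-exec : ∀ (D : Decomp ω) F st o → len F ≤ ℓ →
        ⌜ stepᶜ ⌝ ⊢ (item D F ∙ st) ∙ o ∙ W ⇓ rest D F st ∙ (encProcess {D = D} F root ∙ o) ∙ W
          within B ^ deg stepᶜ
      step-exec D F st o F≤ =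
        subst (λ y → ⌜ stepᶜ ⌝ ⊢ (item D F ∙ st) ∙ o ∙ W ⇓ y within B ^ deg stepᶜ) (run-step D F st o)
              (exec 64≤B stepᶜ _ (fits-step D F st o F≤))

      finish-exec : ∀ (D : Decomp ω) →
        ⌜ finishᶜ ⌝ ⊢ nil ∙ outputs D nil nil ∙ W ⇓ encOutput D (acceptᴰ p {ω}) (processᴰ p D nil)
          within B ^ deg finishᶜ
      finish-exec D =
        subst (λ y → ⌜ finishᶜ ⌝ ⊢ nil ∙ outputs D nil nil ∙ W ⇓ y within B ^ deg finishᶜ) output≡
              (exec 64≤B finishᶜ (nil ∙ outputs D nil nil ∙ W) ((_ , fits-accept) , _))
        where
        foldr≡encList : ∀ {A : Set} (f : A → Tree) xs → foldr (λ x → f x ∙_) nil xs ≡ encList f xs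
        foldr≡encList f []       = refl
        foldr≡encList f (x ∷ xs) = cong (f x ∙_) (foldr≡encList f xs)
        output≡ : run finishᶜ (nil ∙ outputs D nil nil ∙ W) ≡ encOutput D (acceptᴰ p {ω}) (processᴰ p D nil)
        output≡ = cong₂ _∙_ run-accept (foldr≡encList (encProcess {D = D} nil) (nodes D))

      main-exec : ∀ (D : Decomp ω) →
        main ⊢ encInput D ⇓ encOutput D (acceptᴰ p {ω}) (processᴰ p D nil)
          within #nodes D * (B ^ deg stepᶜ + 2) + 2 + (B ^ deg startᶜ + B ^ deg finishᶜ + 2)
      main-exec D =
        sequence (exec 64≤B startᶜ (encInput D) _)
          (loop-exec W ⌜ stepᶜ ⌝ len-pullback step-exec D nil z≤n {nil} {nil} {k = 2} (2 , ≤-refl , stop hd))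
          (finish-exec D)

-- Degrees of the running times

-- For a concrete skeleton the height computes to a numeral and the implicit check is solved by
-- evaluation. The value 50 is a common cap for the skeletons that occur.
deg-boxes : ∀ c {d} → {T (height c ≤ᵇ 50)} → All (λ b → deg b ≤ d) (boxes c) → deg c ≤ 50 + d
deg-boxes c {d} {h} bs = ≤-trans (deg≤height c bs) (+-monoˡ-≤ d (≤ᵇ⇒≤ (height c) 50 h))

deg-drop : ∀ k → deg (dropᶜ k) ≤ k
deg-drop zero    = z≤n
deg-drop (suc k) = s≤s (deg-drop k)

deg-arg : ∀ k → deg (argᶜ k) ≤ suc k
deg-arg k = s≤s (⊔-lub (deg-drop k) z≤n)

deg-tuple : ∀ n f {d} → (∀ k → deg (f k) ≤ d) → deg (tupleᶜ n f) ≤ n + d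
deg-tuple zero    f h = z≤n
deg-tuple (suc n) f {d} h = s≤s (⊔-lub (≤-trans (h zero) (m≤n+m d n)) (deg-tuple n (f ∘ suc) (h ∘ suc)))

deg-decide : ∀ n g → deg (decideᶜ n g) ≤ suc (n + n)
deg-decide zero    g with g []
... | true  = ≤-refl
... | false = z≤n
deg-decide (suc n) g = s≤s (≤-trans (⊔-lub (branch≤ true) (branch≤ false)) (≤-reflexive (cong suc (sym (+-suc n n)))))
  where
  branch≤ : ∀ b → suc (deg (decideᶜ n (g ∘ (b ∷_)))) ≤ 2 + (n + n)
  branch≤ b = s≤s (deg-decide n (g ∘ (b ∷_)))

deg-cart : ∀ p q {d} → deg p ≤ 50 + d → deg q ≤ 50 + d → deg (cartᶜ p q) ≤ 100 + d
deg-cart p q {d} hp hq = deg-boxes (cartᶜ p q) (hp ∷ hq ∷ ≤-trans (≤ᵇ⇒≤ (deg (consᶜ hdᶜ (argᶜ 1))) 50 tt) (m≤m+n 50 d) ∷ [])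

deg-power : ∀ c n → deg c ≤ 50 → deg (powerᶜ c n) ≤ 50 * n + 50
deg-power c zero    h = s≤s z≤n
deg-power c (suc n) h = ≤-trans (deg-cart c (powerᶜ c n) {50 * n} (≤-trans h (m≤m+n 50 _))
                                   (≤-trans (deg-power c n h) (≤-reflexive (+-comm (50 * n) 50))))
                          (≤-reflexive (ring n))
  where ring : ∀ n → 100 + 50 * n ≡ 50 * suc n + 50
        ring = solve-∀

#bits : ∀ {i s} → Prefix i s → ℕ
#bits p = #atoms (#vertices p) (#sets p)

-- Only linearity in the numbers of levels, variables and atoms matters: it keeps the degree below a
-- fixed multiple of ℓ, uniformly in the formula.
degBound : ∀ {i s} → Prefix i s → ℕ
degBound p = 100 * #levels p + (50 * (#vertices p + #bits p) + 250)

private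
  raise : ∀ {m} n x → m ≤ 100 + (100 * n + x) → m ≤ 100 * suc n + x
  raise n x h = ≤-trans h (≤-reflexive (ring n x))
    where ring : ∀ n x → 100 + (100 * n + x) ≡ 100 * suc n + x
          ring = solve-∀

  closed≤ : ∀ {i s} (p : Prefix i s) {m} → m ≤ 250 → m ≤ degBound p
  closed≤ p h = ≤-trans h (≤-trans (m≤n+m 250 (50 * (#vertices p + #bits p))) (m≤n+m _ (100 * #levels p)))

deg-univ : ∀ {i s} (p : Prefix i s) all → deg (univᶜ p all) ≤ degBound p
deg-univ p@(matrix g) true = closed≤ p (≤ᵇ⇒≤ (deg boolsᶜ) 250 tt)
deg-univ (matrix {i} {s} g) false =
  ≤-trans (deg-cart (powerᶜ colorsᶜ (suc i)) (powerᶜ boolsᶜ n) {50 * (suc i + n)}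
            (power≤ colorsᶜ (suc i) (≤ᵇ⇒≤ (deg colorsᶜ) 50 tt) (m≤m+n (suc i) n))
            (power≤ boolsᶜ n (≤ᵇ⇒≤ (deg boolsᶜ) 50 tt) (m≤n+m n (suc i))))
          (≤-trans (≤-reflexive (+-comm 100 (50 * (suc i + n)))) (+-monoʳ-≤ (50 * (suc i + n)) (≤ᵇ⇒≤ 100 250 tt)))
  where
  n = #atoms (suc i) s
  power≤ : ∀ c k → deg c ≤ 50 → k ≤ suc i + n → deg (powerᶜ c k) ≤ 50 + 50 * (suc i + n)
  power≤ c k h k≤ = ≤-trans (deg-power c k h)
    (≤-trans (≤-reflexive (+-comm (50 * k) 50)) (+-monoʳ-≤ 50 (*-monoʳ-≤ 50 k≤)))
deg-univ (vertex _ p) all =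
  raise (#levels p) _ (deg-cart (univᶜ p false) (boxᶜ (univᶜ p all) ▸ sublistsᶜ)
    (≤-trans (deg-univ p false) (m≤n+m _ 50))
    (deg-boxes (boxᶜ (univᶜ p all) ▸ sublistsᶜ) (deg-univ p all ∷ closed≤ p (≤ᵇ⇒≤ (deg (consᶜ hdᶜ (argᶜ 1))) 250 tt) ∷ [])))
deg-univ (set _ p) all =
  raise (#levels p) _ (deg-cart (univᶜ p all) (boxᶜ (univᶜ p all) ▸ sublistsᶜ)
    (≤-trans (deg-univ p all) (m≤n+m _ 50))
    (deg-boxes (boxᶜ (univᶜ p all) ▸ sublistsᶜ) (deg-univ p all ∷ closed≤ p (≤ᵇ⇒≤ (deg (consᶜ hdᶜ (argᶜ 1))) 250 tt) ∷ [])))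

deg-color : ∀ {i} (st : Vec Loc i) x → deg (colorᶜ st x) ≤ 50 + i
deg-color {i} st x with lookup st x
-- Inserting a box leaves the degree definitionally unchanged, so only the selector of the variable
-- is estimated separately.
... | ˡ = deg-boxes′ (consᶜ (argᶜ 0 ▸ hdᶜ ▸ boxᶜ (argᶜ (toℕ x))) (argᶜ 3) ▸ recolorᶜ) tt (arg≤ ∷ [])
  where
  arg≤ : deg (argᶜ (toℕ x)) ≤ i
  arg≤ = ≤-trans (deg-arg (toℕ x)) (Fin.toℕ<n x)
  deg-boxes′ : ∀ c {d} → T (height c ≤ᵇ 50) → All (λ b → deg b ≤ d) (boxes c) → deg c ≤ 50 + d
  deg-boxes′ c h = deg-boxes c {_} {h}
... | ʳ = deg-boxes (argᶜ 1 ▸ hdᶜ ▸ boxᶜ (argᶜ (toℕ x))) (≤-trans (deg-arg (toℕ x)) (Fin.toℕ<n x) ∷ [])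
... | ° = z≤n

deg-bit : ∀ {i} (st : Vec Loc i) {n} (k : Fin n) src → deg (bitᶜ st (toℕ k) src) ≤ 100 + (i + n)
deg-bit {i} st {n} k fromˡ = ≤-trans (deg-boxes (argᶜ 0 ▸ tlᶜ ▸ boxᶜ (argᶜ (toℕ k))) {i + n}
  (≤-trans (deg-arg (toℕ k)) (≤-trans (Fin.toℕ<n k) (m≤n+m n i)) ∷ [])) (m≤n+m _ 50)
deg-bit {i} st {n} k fromʳ = ≤-trans (deg-boxes (argᶜ 1 ▸ tlᶜ ▸ boxᶜ (argᶜ (toℕ k))) {i + n}
  (≤-trans (deg-arg (toℕ k)) (≤-trans (Fin.toℕ<n k) (m≤n+m n i)) ∷ [])) (m≤n+m _ 50)
deg-bit st k none = z≤n
deg-bit {i} st {n} k (cross x y) =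
  deg-boxes (consᶜ (consᶜ (boxᶜ (colorᶜ st x)) (boxᶜ (colorᶜ st y))) (argᶜ 2) ▸ memberᶜ)
    (color≤ x ∷ color≤ y ∷ [])
  where
  color≤ : ∀ x → deg (colorᶜ st x) ≤ 50 + (i + n)
  color≤ x = ≤-trans (deg-color st x) (+-monoʳ-≤ 50 (m≤m+n i n))

deg-join : ∀ {i s} (p : Prefix i s) st → deg (joinᶜ p st) ≤ degBound p
deg-join (matrix {i} {s} g) st = go (allᵛ isˡ st) (allᵛ isʳ st) (allᵛ inside st)
  where
  n = #atoms (suc i) s
  bits≤ : deg (bitTupleᶜ s st) ≤ n + (100 + (suc i + n))
  bits≤ = deg-tuple n (λ k → bitᶜ st (toℕ k) (source {s = s} st (atom k))) λ k → deg-bit st k (source {s = s} st (atom k))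
  colors≤ : deg (colorTupleᶜ st) ≤ suc i + (50 + suc i)
  colors≤ = deg-tuple (suc i) (colorᶜ st) (deg-color st)
  d = 50 * (suc i + n) + 250
  enough : n + (100 + (suc i + n)) + (suc i + (50 + suc i)) + suc (n + n) ≤ 49 * (suc i + n) + (suc i + n) + 200
  enough = begin
    n + (100 + (suc i + n)) + (suc i + (50 + suc i)) + suc (n + n) ≡⟨ ring (suc i) n ⟩
    3 * suc i + 4 * n + 151                ≤⟨ +-mono-≤ (+-mono-≤ (*-monoˡ-≤ (suc i) (≤ᵇ⇒≤ 3 50 tt)) (*-monoˡ-≤ n (≤ᵇ⇒≤ 4 50 tt))) (≤ᵇ⇒≤ 151 200 tt) ⟩
    50 * suc i + 50 * n + 200              ≡⟨ ring′ (suc i) n ⟩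
    49 * (suc i + n) + (suc i + n) + 200   ∎
    where open ≤-Reasoning
          ring : ∀ i n → n + (100 + (i + n)) + (i + (50 + i)) + suc (n + n) ≡ 3 * i + 4 * n + 151
          ring = solve-∀
          ring′ : ∀ i n → 50 * i + 50 * n + 200 ≡ 49 * (i + n) + (i + n) + 200
          ring′ = solve-∀
  total≤ : 50 + (49 * (suc i + n) + (suc i + n) + 200) ≤ d
  total≤ = ≤-reflexive (ring (suc i + n))
    where ring : ∀ m → 50 + (49 * m + m + 200) ≡ 50 * m + 250
          ring = solve-∀
  bits≤′ : deg (bitTupleᶜ s st) ≤ 49 * (suc i + n) + (suc i + n) + 200
  bits≤′ = ≤-trans bits≤ (≤-trans (≤-trans (m≤m+n _ (suc i + (50 + suc i))) (m≤m+n _ (suc (n + n)))) enough)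
  colors≤′ : deg (colorTupleᶜ st) ≤ 49 * (suc i + n) + (suc i + n) + 200
  colors≤′ = ≤-trans colors≤ (≤-trans (≤-trans (m≤n+m _ (n + (100 + (suc i + n)))) (m≤m+n _ (suc (n + n)))) enough)
  decide≤′ : deg (decideᶜ n g) ≤ 49 * (suc i + n) + (suc i + n) + 200
  decide≤′ = ≤-trans (deg-decide n g) (≤-trans (m≤n+m (suc (n + n)) (n + (100 + (suc i + n)) + (suc i + (50 + suc i)))) enough)
  go : ∀ bA bB bC → deg (matrixᶜ {s = s} g st bA bB bC) ≤ d
  go true  _     _     = ≤-trans (≤ᵇ⇒≤ (deg (ifᶜ (argᶜ 0) yesᶜ nilᶜ)) 250 tt) (m≤n+m 250 (50 * (suc i + n)))
  go false true  _     = ≤-trans (≤ᵇ⇒≤ (deg (ifᶜ (argᶜ 1) yesᶜ nilᶜ)) 250 tt) (m≤n+m 250 (50 * (suc i + n)))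
  go false false true  = ≤-trans (deg-boxes (matrixᶜ {s = s} g st false false true) (bits≤′ ∷ decide≤′ ∷ [])) total≤
  go false false false = ≤-trans (deg-boxes (matrixᶜ {s = s} g st false false false) (colors≤′ ∷ bits≤′ ∷ [])) total≤
deg-join (vertex b p) st =
  raise (#levels p) _ (≤-trans (deg-boxes (joinᶜ (vertex b p) st)
    (deg-join p (° ∷ st) ∷ deg-univ p _ ∷ deg-join p (ʳ ∷ st) ∷ deg-join p (ˡ ∷ st) ∷ closed≤ p (≤ᵇ⇒≤ (deg memberᶜ) 250 tt) ∷ []))
    (+-monoˡ-≤ (degBound p) (≤ᵇ⇒≤ 50 100 tt)))
deg-join (set b p) st =
  raise (#levels p) _ (≤-trans (deg-boxes (joinᶜ (set b p) st)
    (deg-join p st ∷ deg-univ p _ ∷ deg-join p st ∷ closed≤ p (≤ᵇ⇒≤ (deg memberᶜ) 250 tt) ∷ []))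
    (+-monoˡ-≤ (degBound p) (≤ᵇ⇒≤ 50 100 tt)))

deg-single : ∀ {i s} (p : Prefix i s) ρ σ → deg (singleᶜ p ρ σ) ≤ degBound p
deg-single (matrix {i} {s} g) ρ σ = go (allᵛ is-just ρ)
  where
  n = #atoms (suc i) s
  bool≤ : ∀ b → deg (boolᶜ b) ≤ 1
  bool≤ true  = ≤-refl
  bool≤ false = z≤n
  hue≤ : ∀ m → deg (maybe′ (λ (_ : ⊤) → itᶜ) nilᶜ m) ≤ 1
  hue≤ (just _) = z≤n
  hue≤ nothing  = z≤n
  enough : 50 + ((suc i + n) + 1) ≤ 50 * (suc i + n) + 250
  enough = ≤-trans (≤-reflexive (+-comm 50 (suc i + n + 1))) (≤-trans (≤-reflexive (+-assoc (suc i + n) 1 50))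
    (+-mono-≤ (m≤n*m (suc i + n) 50) (≤ᵇ⇒≤ 51 250 tt)))
  go : ∀ b → deg (singleMatrixᶜ {suc i} {s} g b ρ σ) ≤ 50 * (suc i + n) + 250
  go true  = ≤-trans (bool≤ (g (values (single nil) ρ σ))) (≤-trans (≤ᵇ⇒≤ 1 250 tt) (m≤n+m 250 (50 * (suc i + n))))
  go false = ≤-trans (deg-boxes (singleMatrixᶜ {suc i} {s} g false ρ σ)
    (≤-trans (deg-tuple (suc i) (λ x → maybe′ (λ _ → itᶜ) nilᶜ (lookup ρ x)) λ x → hue≤ (lookup ρ x))
             (+-monoˡ-≤ 1 (m≤m+n (suc i) n)) ∷
     ≤-trans (deg-tuple n (λ k → boolᶜ (value (single nil) ρ σ (atom k))) λ k → bool≤ (value (single nil) ρ σ (atom k)))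
             (+-monoˡ-≤ 1 (m≤n+m n (suc i))) ∷ [])) enough
deg-single (vertex b p) ρ σ =
  raise (#levels p) _ (≤-trans (deg-boxes (singleᶜ (vertex b p) ρ σ)
    (deg-single p (nothing ∷ ρ) σ ∷ deg-single p (just tt ∷ ρ) σ ∷ []))
    (+-monoˡ-≤ (degBound p) (≤ᵇ⇒≤ 50 100 tt)))
deg-single (set b p) ρ σ =
  raise (#levels p) _ (≤-trans (deg-boxes (singleᶜ (set b p) ρ σ)
    (deg-single p ρ ((λ _ → false) ∷ σ) ∷ deg-single p ρ ((λ _ → true) ∷ σ) ∷ []))
    (+-monoˡ-≤ (degBound p) (≤ᵇ⇒≤ 50 100 tt)))

deg-eval : ∀ {i s} (p : Prefix i s) → deg (evalᶜ p) ≤ degBound p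
deg-eval p@(matrix g) = closed≤ p (≤ᵇ⇒≤ (deg (ifᶜ itᶜ yesᶜ nilᶜ)) 250 tt)
deg-eval (vertex true p) = raise (#levels p) _ (≤-trans
  (deg-boxes (evalᶜ (vertex true p)) (deg-eval p ∷ [])) (+-monoˡ-≤ (degBound p) (≤ᵇ⇒≤ 50 100 tt)))
deg-eval (vertex false p) = raise (#levels p) _ (≤-trans
  (deg-boxes (evalᶜ (vertex false p)) (deg-eval p ∷ [])) (+-monoˡ-≤ (degBound p) (≤ᵇ⇒≤ 50 100 tt)))
deg-eval (set true p) = raise (#levels p) _ (≤-trans
  (deg-boxes (evalᶜ (set true p)) (deg-eval p ∷ [])) (+-monoˡ-≤ (degBound p) (≤ᵇ⇒≤ 50 100 tt)))
deg-eval (set false p) = raise (#levels p) _ (≤-trans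
  (deg-boxes (evalᶜ (set false p)) (deg-eval p ∷ [])) (+-monoˡ-≤ (degBound p) (≤ᵇ⇒≤ 50 100 tt)))

module _ (p : Prefix 0 1) where

  private
    D = degBound p

    closed : ∀ k c → deg c ≤ 250 → deg c ≤ k + D
    closed k c h = ≤-trans (closed≤ p h) (m≤n+m D k)

    lift : ∀ c {k d} → {T (height c ≤ᵇ 50)} → All (λ b → deg b ≤ k + d) (boxes c) → deg c ≤ 50 + k + d
    lift c {k} {d} {h} bs = ≤-trans (deg-boxes c {k + d} {h} bs) (≤-reflexive (sym (+-assoc 50 k d)))

    univ≤ : deg (univᶜ p true) ≤ 50 + D
    univ≤ = ≤-trans (deg-univ p true) (m≤n+m D 50)

    binaryWord≤ : deg (binaryWordᶜ p) ≤ 50 + D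
    binaryWord≤ = deg-boxes (binaryWordᶜ p) (deg-join p [] ∷ [])

    unaryWord≤ : deg (unaryWordᶜ p) ≤ 50 + D
    unaryWord≤ = deg-boxes (unaryWordᶜ p) (deg-join p [] ∷ [])

    pair≤ : deg (consᶜ hdᶜ (argᶜ 1)) ≤ 50 + D
    pair≤ = closed 50 (consᶜ hdᶜ (argᶜ 1)) (≤ᵇ⇒≤ (deg (consᶜ hdᶜ (argᶜ 1))) 250 tt)

    bools≤ : deg boolsᶜ ≤ 50 + D
    bools≤ = closed 50 boolsᶜ (≤ᵇ⇒≤ (deg boolsᶜ) 250 tt)

    binary≤ : deg (binaryᶜ p) ≤ 100 + D
    binary≤ = lift (binaryᶜ p) {50} {D}
      (bools≤ ∷ univ≤ ∷ pair≤ ∷ bools≤ ∷ univ≤ ∷ pair≤ ∷ binaryWord≤ ∷ [])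

    unary≤ : deg (unaryᶜ p) ≤ 100 + D
    unary≤ = lift (unaryᶜ p) {50} {D} (bools≤ ∷ univ≤ ∷ pair≤ ∷ unaryWord≤ ∷ [])

    leaf≤ : deg (leafᶜ p) ≤ 100 + D
    leaf≤ = lift (leafᶜ p) {50} {D} (single≤ false ∷ single≤ true ∷ [])
      where single≤ : ∀ b → deg (singleᶜ p [] ((λ _ → b) ∷ [])) ≤ 50 + D
            single≤ b = ≤-trans (deg-single p [] ((λ _ → b) ∷ [])) (m≤n+m D 50)

    pullback≤ : deg (pullbackᶜ p) ≤ 100 + D
    pullback≤ = closed 100 (pullbackᶜ p) (≤ᵇ⇒≤ (deg (pullbackᶜ p)) 250 tt)

    addEdges≤ : deg (unaryStepᶜ p (addEdgesEnvᶜ p)) ≤ 150 + D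
    addEdges≤ = lift (unaryStepᶜ p (addEdgesEnvᶜ p)) {100} {D} (pullback≤ ∷ unary≤ ∷ [])

    recolor≤ : deg (unaryStepᶜ p (recolorEnvᶜ p)) ≤ 150 + D
    recolor≤ = lift (unaryStepᶜ p (recolorEnvᶜ p)) {100} {D} (pullback≤ ∷ unary≤ ∷ [])

    leafStep≤ : deg (leafStepᶜ p) ≤ 150 + D
    leafStep≤ = lift (leafStepᶜ p) {100} {D} (leaf≤ ∷ [])

    ⊕Step≤ : deg (⊕Stepᶜ p) ≤ 150 + D
    ⊕Step≤ = lift (⊕Stepᶜ p) {100} {D} (binary≤ ∷ [])

    accept≤ : deg (acceptᶜ p) ≤ 100 + D
    accept≤ = lift (acceptᶜ p) {50} {D}
      (bools≤ ∷ univ≤ ∷ pair≤ ∷ deg-boxes (hdᶜ ▸ tlᶜ ▸ boxᶜ (evalᶜ p)) (deg-eval p ∷ []) ∷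
       closed 50 (hdᶜ ▸ serᶜ p) (≤ᵇ⇒≤ (deg (hdᶜ ▸ serᶜ p)) 250 tt) ∷ [])

  deg-step : deg (stepᶜ p) ≤ 200 + D
  deg-step = lift (stepᶜ p) {150} {D} (addEdges≤ ∷ recolor≤ ∷ ⊕Step≤ ∷ leafStep≤ ∷ [])

  deg-finish : deg (finishᶜ p) ≤ 200 + D
  deg-finish = ≤-trans (lift (finishᶜ p) {100} {D} (accept≤ ∷ [])) (+-monoˡ-≤ D (≤ᵇ⇒≤ 150 200 tt))

  deg-start : deg (startᶜ p) ≤ 200 + D
  deg-start = closed 200 (startᶜ p) (≤ᵇ⇒≤ (deg (startᶜ p)) 250 tt)

-- Counting types

growth : ℕ → ℕ → ℕ
growth L zero    = L
growth L (suc j) = 2 ^ (3 * growth L j)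

2^-mono : ∀ {m n} → m ≤ n → 2 ^ m ≤ 2 ^ n
2^-mono = ^-monoʳ-≤ 2

module _ {L : ℕ} (3≤L : 3 ≤ L) where

  private
    y = 2 ^ L

    8≤y : 8 ≤ y
    8≤y = 2^-mono 3≤L

    cube : 2 ^ (3 * L) ≡ y * (y * y)
    cube = trans (cong (λ n → 2 ^ (L + (L + n))) (+-identityʳ L))
             (trans (^-distribˡ-+-* 2 L (L + L)) (cong (y *_) (^-distribˡ-+-* 2 L L)))

    double≤ : ∀ {n} → n ≤ y → n + n ≤ y * y
    double≤ {n} n≤ = begin
      n + n     ≡⟨ cong (n +_) (+-identityʳ n) ⟨
      2 * n     ≤⟨ *-mono-≤ (≤-trans (≤ᵇ⇒≤ 2 8 tt) 8≤y) n≤ ⟩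
      y * y     ∎
      where open ≤-Reasoning

  2^*2^≤ : y * y ≤ 2 ^ (3 * L)
  2^*2^≤ = ≤-trans (m≤n*m (y * y) y {{m^n≢0 2 L}}) (≤-reflexive (sym cube))

  L≤growth : L ≤ 2 ^ (3 * L)
  L≤growth = ≤-trans (n≤2^n L) (≤-trans (m≤n*m y y {{m^n≢0 2 L}}) 2^*2^≤)

  2^*2^2^≤ : y * 2 ^ y ≤ 2 ^ (2 ^ (3 * L))
  2^*2^2^≤ = ≤-trans (≤-reflexive (sym (^-distribˡ-+-* 2 L y)))
    (2^-mono (≤-trans (+-monoˡ-≤ y (n≤2^n L)) (≤-trans (double≤ ≤-refl) 2^*2^≤)))

  -- The origin of the 3 in `growth`: counting types needs two factors `2 ^ L`, while their size is
  -- about twice the square of `2 ^ L`, and the third factor absorbs that 2.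
  polynomial≤ : ∀ {a k S} → a ≤ y → k ≤ y → S ≤ y → suc (a + suc (k * suc S)) ≤ 2 ^ (3 * L)
  polynomial≤ {a} {k} {S} a≤ k≤ S≤ = begin
    suc (a + suc (k * suc S))            ≤⟨ s≤s (+-mono-≤ a≤ (s≤s (*-mono-≤ k≤ (s≤s S≤)))) ⟩
    suc (y + suc (y * suc y))            ≡⟨ ring y ⟩
    y * y + (y + y + 2)                  ≤⟨ +-monoʳ-≤ (y * y) small ⟩
    y * y + y * y                        ≡⟨ cong (y * y +_) (+-identityʳ (y * y)) ⟨
    2 * (y * y)                          ≤⟨ *-monoˡ-≤ (y * y) (≤-trans (≤ᵇ⇒≤ 2 8 tt) 8≤y) ⟩
    y * (y * y)                          ≡⟨ cube ⟨
    2 ^ (3 * L)                          ∎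
    where
    open ≤-Reasoning
    ring : ∀ y → suc (y + suc (y * suc y)) ≡ y * y + (y + y + 2)
    ring = solve-∀
    ring′ : ∀ y → y + y + y ≡ 3 * y
    ring′ = solve-∀
    small : y + y + 2 ≤ y * y
    small = ≤-trans (+-monoʳ-≤ (y + y) (≤-trans (≤ᵇ⇒≤ 2 8 tt) 8≤y))
              (≤-trans (≤-reflexive (ring′ y)) (*-monoˡ-≤ y (≤-trans (≤ᵇ⇒≤ 3 8 tt) 8≤y)))

-- A variable left outside forgoes its own powerset, so these types are only 2 ^ L many even
-- though they need the colours and not just the truth value at the matrix.
record Bounded {i s} (ω : ℕ) (p : Prefix i s) (L : ℕ) : Set where
  field
    len-all    : len (univ p true ω) ≤ L
    size-all   : ∀ {z} → z ∈ᵗ univ p true ω → size z ≤ L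
    len-some   : len (univ p false ω) ≤ 2 ^ L
    size-some  : ∀ {z} → z ∈ᵗ univ p false ω → size z ≤ 2 ^ L

size-sublists : ∀ {S w} u → (∀ {x} → x ∈ᵗ u → size x ≤ S) → w ∈ᵗ sublists u (nil ∙ nil) →
                size w ≤ suc (len u * suc S)
size-sublists {S} {w} u h w∈ = subst (λ k → size w ≤ suc (k * suc S)) (+-identityʳ (len u))
  (∈-sublists⁻ (λ k w → size w ≤ suc (k * suc S)) u (λ { here → ≤-refl ; (there ()) })
    (λ {k} l → ≤-trans l (s≤s (m≤n+m (k * suc S) (suc S))))
    (λ {u} {k} u∈ l → s≤s (≤-trans (+-mono-≤ (h u∈) l) (≤-reflexive (+-suc S (k * suc S))))) w∈)

module _ {ω : ℕ} where

  len-cart-sublists : ∀ a u → len (cart a (sublists u (nil ∙ nil))) ≡ len a * 2 ^ len u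
  len-cart-sublists a u = trans (len-pairs {_∙_} a (sublists u (nil ∙ nil)) nil)
    (trans (+-identityʳ _) (cong (len a *_) (trans (len-sublists u (nil ∙ nil)) (*-identityʳ _))))

  size-cart-sublists : ∀ {A S z} a u → (∀ {x} → x ∈ᵗ a → size x ≤ A) → (∀ {x} → x ∈ᵗ u → size x ≤ S) →
                       z ∈ᵗ cart a (sublists u (nil ∙ nil)) → size z ≤ suc (A + suc (len u * suc S))
  size-cart-sublists a u ha hu z∈ with ∈-pairs⁻ {_∙_} a {sublists u (nil ∙ nil)} z∈
  ... | inj₂ (x , w , x∈ , w∈ , refl) = s≤s (+-mono-≤ (ha x∈) (size-sublists u hu w∈))

  bounded-vertex : ∀ {i s b L} {p : Prefix (suc i) s} → 3 ≤ L → Bounded ω p L →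
                   Bounded ω (vertex b p) (2 ^ (3 * L))
  bounded-vertex {L = L} {p} 3≤L h = record
    { len-all   = ≤-trans (≤-reflexive (len-cart-sublists (univ p false ω) (univ p true ω)))
                    (≤-trans (*-mono-≤ len-some (2^-mono len-all)) (2^*2^≤ 3≤L))
    ; size-all  = λ z∈ → ≤-trans (size-cart-sublists (univ p false ω) (univ p true ω) size-some size-all z∈)
                    (polynomial≤ 3≤L ≤-refl (≤-trans len-all (n≤2^n L)) (n≤2^n L))
    ; len-some  = ≤-trans (≤-reflexive (len-cart-sublists (univ p false ω) (univ p false ω)))
                    (≤-trans (*-mono-≤ len-some (2^-mono len-some)) (2^*2^2^≤ 3≤L))
    ; size-some = λ z∈ → ≤-trans (size-cart-sublists (univ p false ω) (univ p false ω) size-some size-some z∈)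
                    (≤-trans (polynomial≤ 3≤L ≤-refl len-some ≤-refl) (n≤2^n _)) }
    where open Bounded h

  bounded-set : ∀ {i s b L} {p : Prefix i (suc s)} → 3 ≤ L → Bounded ω p L →
                Bounded ω (set b p) (2 ^ (3 * L))
  bounded-set {L = L} {p} 3≤L h = record
    { len-all   = ≤-trans (≤-reflexive (len-cart-sublists (univ p true ω) (univ p true ω)))
                    (≤-trans (*-mono-≤ (≤-trans len-all (n≤2^n L)) (2^-mono len-all)) (2^*2^≤ 3≤L))
    ; size-all  = λ z∈ → ≤-trans (size-cart-sublists (univ p true ω) (univ p true ω) size-all size-all z∈)
                    (polynomial≤ 3≤L (n≤2^n L) (≤-trans len-all (n≤2^n L)) (n≤2^n L))
    ; len-some  = ≤-trans (≤-reflexive (len-cart-sublists (univ p false ω) (univ p false ω)))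
                    (≤-trans (*-mono-≤ len-some (2^-mono len-some)) (2^*2^2^≤ 3≤L))
    ; size-some = λ z∈ → ≤-trans (size-cart-sublists (univ p false ω) (univ p false ω) size-some size-some z∈)
                    (≤-trans (polynomial≤ 3≤L ≤-refl len-some ≤-refl) (n≤2^n _)) }
    where open Bounded h

  -- The parameters v and n are the numbers of individual variables and of atoms of the matrix.
  record Seed (v n L : ℕ) : Set where
    field
      3≤L      : 3 ≤ L
      colors≤  : ω ^ v ≤ 2 ^ L
      bits≤    : 2 ^ n ≤ 2 ^ L
      atomic≤  : ω ^ v * 2 ^ n ≤ 2 ^ L
      size≤    : suc (suc (v * suc (suc (ω + ω))) + suc (n * 4)) ≤ 2 ^ L

  module _ {v n L : ℕ} (seed : Seed v n L) where
    open Seed seed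

    3≤growth : ∀ j → 3 ≤ growth L j
    3≤growth zero    = 3≤L
    3≤growth (suc j) = ≤-trans (3≤growth j) (L≤growth (3≤growth j))

    growth-suc : ∀ j → growth L j ≤ growth L (suc j)
    growth-suc j = L≤growth (3≤growth j)

    2^growth≤ : ∀ j → 2 ^ growth L j ≤ growth L (suc j)
    2^growth≤ j = ≤-trans (m≤n*m (2 ^ growth L j) (2 ^ growth L j) {{m^n≢0 2 (growth L j)}}) (2^*2^≤ (3≤growth j))

    bounded : ∀ {i s} (p : Prefix i s) → #vertices p ≡ v → #bits p ≡ n → Bounded ω p (growth L (#levels p))
    bounded (matrix {i} {s} g) refl refl = record
      { len-all   = ≤-trans (≤ᵇ⇒≤ 2 3 tt) 3≤L
      ; size-all  = λ { here → ≤-trans (≤ᵇ⇒≤ 1 3 tt) 3≤L ; (there here) → 3≤L ; (there (there ())) }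
      ; len-some  = ≤-trans (≤-reflexive (trans (len-pairs {_∙_} (power (colors ω) (suc i)) (power bools k) nil)
          (trans (+-identityʳ _) (cong₂ _*_
            (trans (len-power (colors ω) (suc i)) (cong (_^ suc i) (len-colors ω))) (len-power bools k)))))
          atomic≤
      ; size-some = some }
      where
      k = #atoms (suc i) s
      bool-size′ : ∀ {b} → b ∈ᵗ bools → size b ≤ 3
      bool-size′ here         = ≤ᵇ⇒≤ 1 3 tt
      bool-size′ (there here) = ≤-refl
      some : ∀ {z} → z ∈ᵗ cart (power (colors ω) (suc i)) (power bools k) → size z ≤ 2 ^ L
      some z∈ with ∈-pairs⁻ {_∙_} (power (colors ω) (suc i)) {power bools k} z∈
      ... | inj₂ (x , y , x∈ , y∈ , refl) =
        ≤-trans (s≤s (+-mono-≤ (size-power (suc i) (size-colors ω) x∈) (size-power k bool-size′ y∈))) size≤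
    bounded (vertex b p) hv hn = bounded-vertex (3≤growth (#levels p)) (bounded p hv hn)
    bounded (set b p)    hv hn = bounded-set (3≤growth (#levels p)) (bounded p hv hn)

    -- With a variable outside there is one exponential more of types, so one more level of `growth`
    -- is demanded. From the top this case is entered only below a vertex quantifier, which has just
    -- supplied that level.
    tame-some : ∀ {ℓ i s} (p : Prefix i s) → #vertices p ≡ v → #bits p ≡ n →
                growth L (suc (#levels p)) ≤ ℓ → Tame ℓ ω p false
    tame-some (matrix g) refl refl h _ =
      ≤-trans colors≤ (≤-trans (2^growth≤ 0) h) , ≤-trans bits≤ (≤-trans (2^growth≤ 0) h)
    tame-some {ℓ} (vertex b p) hv hn h =
      sub , sub , ≤-trans (2^-mono (≤-trans len-some (2^growth≤ j))) (≤-trans (2^growth≤ (suc j)) h) ,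
      ≤-trans len-some 2^≤ , λ z∈ → ≤-trans (size-some z∈) 2^≤
      where
      j   = #levels p
      open Bounded (bounded p hv hn)
      1+j≤ℓ = ≤-trans (growth-suc (suc j)) h
      2^≤ = ≤-trans (2^growth≤ j) 1+j≤ℓ
      sub = tame-some p hv hn 1+j≤ℓ
    tame-some {ℓ} (set b p) hv hn h =
      sub , ≤-trans (2^-mono (≤-trans len-some (2^growth≤ j))) (≤-trans (2^growth≤ (suc j)) h) ,
      ≤-trans len-some 2^≤ , λ z∈ → ≤-trans (size-some z∈) 2^≤
      where
      j   = #levels p
      open Bounded (bounded p hv hn)
      1+j≤ℓ = ≤-trans (growth-suc (suc j)) h
      2^≤ = ≤-trans (2^growth≤ j) 1+j≤ℓ
      sub = tame-some p hv hn 1+j≤ℓ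

    tame-all : ∀ {ℓ i s} (p : Prefix i s) → #vertices p ≡ v → #bits p ≡ n →
               growth L (#levels p) ≤ ℓ → Tame ℓ ω p true
    tame-all (matrix g) hv hn h ()
    tame-all (vertex b p) hv hn h =
      tame-some p hv hn h , tame-all p hv hn j≤ℓ , ≤-trans (2^-mono len-all) 2^≤ ,
      ≤-trans len-some 2^≤ , λ z∈ → ≤-trans (size-all z∈) j≤ℓ
      where
      open Bounded (bounded p hv hn)
      j≤ℓ = ≤-trans (growth-suc (#levels p)) h
      2^≤ = ≤-trans (2^growth≤ (#levels p)) h
    tame-all (set b p) hv hn h =
      tame-all p hv hn j≤ℓ , ≤-trans (2^-mono len-all) 2^≤ ,
      ≤-trans len-some 2^≤ , λ z∈ → ≤-trans (size-all z∈) j≤ℓ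
      where
      open Bounded (bounded p hv hn)
      j≤ℓ = ≤-trans (growth-suc (#levels p)) h
      2^≤ = ≤-trans (2^growth≤ (#levels p)) h

    topTame : (p : Prefix 0 1) → #vertices p ≡ v → #bits p ≡ n → TopTame p (growth L (#levels p)) ω
    topTame p hv hn = record { tame = tame-all p hv hn ≤-refl ; len≤ = len-all ; size≤ = size-all }
      where open Bounded (bounded p hv hn)

-- Towers

n≤2^⌈log₂n⌉ : ∀ n → n ≤ 2 ^ ⌈log₂ n ⌉
n≤2^⌈log₂n⌉ = <-rec _ go
  where
  go : ∀ n → (∀ {m} → m < n → m ≤ 2 ^ ⌈log₂ m ⌉) → n ≤ 2 ^ ⌈log₂ n ⌉
  go 0 rec = z≤n
  go 1 rec = ≤-refl
  go n@(suc (suc k)) rec = begin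
    n                                    ≡⟨ ⌊n/2⌋+⌈n/2⌉≡n n ⟨
    ⌊ n /2⌋ + ⌈ n /2⌉                    ≤⟨ +-monoˡ-≤ ⌈ n /2⌉ (⌊n/2⌋≤⌈n/2⌉ n) ⟩
    ⌈ n /2⌉ + ⌈ n /2⌉                    ≡⟨ cong (⌈ n /2⌉ +_) (+-identityʳ ⌈ n /2⌉) ⟨
    2 * ⌈ n /2⌉                          ≤⟨ *-monoʳ-≤ 2 (rec (⌈n/2⌉<n k)) ⟩
    2 ^ suc ⌈log₂ ⌈ n /2⌉ ⌉              ≡⟨ cong (λ m → 2 ^ suc m) (⌈log₂⌈n/2⌉⌉≡⌈log₂n⌉∸1 n) ⟩
    2 ^ suc (⌈log₂ n ⌉ ∸ 1)              ≡⟨ cong (2 ^_) (m+[n∸m]≡n (⌈log₂⌉-mono-≤ {2} {n} (s≤s (s≤s z≤n)))) ⟩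
    2 ^ ⌈log₂ n ⌉                        ∎
    where open ≤-Reasoning

-- The invariant carries the constant and the square. Then K (2^(3G))² ≤ 2^(K + 6G), and K + 6G ≤ K
-- G² returns the exponent to the invariant one level down. The factor 3 of every level is thus
-- absorbed by the top argument, and the height of the tower does not change.
growth≤tower : ∀ {K L y} → 8 ≤ K → 3 ≤ L → K + 6 * L ≤ y → ∀ j →
  K * (growth L (suc j) * growth L (suc j)) ≤ tower (suc j) y × 3 ≤ growth L (suc j)
growth≤tower {K} {L} {y} 8≤K 3≤L h = go
  where
  3≤2^ : ∀ {G} → 3 ≤ G → 3 ≤ 2 ^ (3 * G)
  3≤2^ {G} 3≤G = ≤-trans 3≤G (≤-trans (m≤n*m G 3) (n≤2^n (3 * G)))
  square : ∀ G → K * (2 ^ (3 * G) * 2 ^ (3 * G)) ≤ 2 ^ (K + 6 * G)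
  square G = begin
    K * (2 ^ (3 * G) * 2 ^ (3 * G))      ≤⟨ *-monoˡ-≤ _ (n≤2^n K) ⟩
    2 ^ K * (2 ^ (3 * G) * 2 ^ (3 * G))  ≡⟨ cong (2 ^ K *_) (^-distribˡ-+-* 2 (3 * G) (3 * G)) ⟨
    2 ^ K * 2 ^ (3 * G + 3 * G)          ≡⟨ cong (λ m → 2 ^ K * 2 ^ m) (*-distribʳ-+ G 3 3) ⟨
    2 ^ K * 2 ^ (6 * G)                  ≡⟨ ^-distribˡ-+-* 2 K (6 * G) ⟨
    2 ^ (K + 6 * G)                      ∎
    where open ≤-Reasoning
  base : K * (growth L 1 * growth L 1) ≤ tower 1 y × 3 ≤ growth L 1
  base = ≤-trans (square L) (2^-mono h) , 3≤2^ 3≤L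
  step : ∀ j → K * (growth L (suc j) * growth L (suc j)) ≤ tower (suc j) y × 3 ≤ growth L (suc j) →
    K * (growth L (suc (suc j)) * growth L (suc (suc j))) ≤ tower (suc (suc j)) y × 3 ≤ growth L (suc (suc j))
  step j (ih , 3≤G) = ≤-trans (square G) (2^-mono (≤-trans exponent ih)) , 3≤2^ 3≤G
    where
    G = growth L (suc j)
    1≤G = ≤-trans (s≤s z≤n) 3≤G
    exponent : K + 6 * G ≤ K * (G * G)
    exponent = begin
      K + 6 * G          ≤⟨ +-mono-≤ (≤-trans (≤-reflexive (sym (*-identityʳ K))) (*-monoʳ-≤ K 1≤G))
                                     (*-monoˡ-≤ G (≤-trans (≤ᵇ⇒≤ 6 8 tt) 8≤K)) ⟩
      K * G + K * G      ≡⟨ *-distribˡ-+ K G G ⟨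
      K * (G + G)        ≤⟨ *-monoʳ-≤ K (≤-trans (≤-reflexive (cong (G +_) (sym (+-identityʳ G))))
                              (*-monoˡ-≤ G (≤-trans (≤ᵇ⇒≤ 2 3 tt) 3≤G))) ⟩
      K * (G * G)        ∎
      where open ≤-Reasoning
  go : ∀ j → K * (growth L (suc j) * growth L (suc j)) ≤ tower (suc j) y × 3 ≤ growth L (suc j)
  go zero    = base
  go (suc j) = step j (go j)

module _ {ω v q s : ℕ} (0<ω : 0 < ω) (1≤v : 1 ≤ v) (v≤q : v ≤ q) (s≤q : s ≤ q) where

  private
    lg = ⌈log₂ ω ⌉
    x  = v * (q + lg)
    n  = #atoms v s
    y  = 2 ^ x

    q+lg≤x : q + lg ≤ x
    q+lg≤x = ≤-trans (≤-reflexive (sym (*-identityˡ (q + lg)))) (*-monoˡ-≤ (q + lg) 1≤v)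

  q≤x : q ≤ x
  q≤x = ≤-trans (m≤m+n q lg) q+lg≤x

  1≤x : 1 ≤ x
  1≤x = ≤-trans 1≤v (≤-trans v≤q q≤x)

  private
    ω≤y : ω ≤ y
    ω≤y = ≤-trans (n≤2^⌈log₂n⌉ ω) (2^-mono (≤-trans (m≤n+m lg q) q+lg≤x))

  -- The origin of the product q_v (q + log ω): equalities, adjacencies and memberships number v²,
  -- v² and v s, with v and s at most q, and v vertices take v log ω bits of colour.
  n≤3x : n ≤ 3 * x
  n≤3x = +-mono-≤ vv≤ (+-mono-≤ vv≤ (≤-trans (*-monoʳ-≤ v (≤-trans s≤q (m≤m+n q lg))) (m≤m+n x 0)))
    where vv≤ : v * v ≤ x
          vv≤ = *-monoʳ-≤ v (≤-trans v≤q (m≤m+n q lg))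

  private
    ω^v≤ : ω ^ v ≤ y
    ω^v≤ = begin
      ω ^ v            ≤⟨ ^-monoˡ-≤ v (n≤2^⌈log₂n⌉ ω) ⟩
      (2 ^ lg) ^ v     ≡⟨ ^-*-assoc 2 lg v ⟩
      2 ^ (lg * v)     ≡⟨ cong (2 ^_) (*-comm lg v) ⟩
      2 ^ (v * lg)     ≤⟨ 2^-mono (*-monoʳ-≤ v (m≤n+m lg q)) ⟩
      y                ∎
      where open ≤-Reasoning

    1≤y : 1 ≤ y
    1≤y = m^n>0 2 x

    y≤yy : y ≤ y * y
    y≤yy = m≤n*m y y {{m^n≢0 2 x}}

    7x≡ : ∀ a b → a + b ≡ 7 → 2 ^ (a * x) * 2 ^ (b * x) ≡ 2 ^ (7 * x)
    7x≡ a b e = trans (sym (^-distribˡ-+-* 2 (a * x) (b * x)))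
      (cong (2 ^_) (trans (sym (*-distribʳ-+ x a b)) (cong (_* x) e)))

    k*yy≤ : ∀ {k} → k ≤ 32 → k * (y * y) ≤ 2 ^ (7 * x)
    k*yy≤ {k} k≤ = begin
      k * (y * y)               ≤⟨ *-monoˡ-≤ (y * y) (≤-trans k≤ (2^-mono {5} {5 * x} (≤-trans (≤-reflexive (sym (*-identityʳ 5))) (*-monoʳ-≤ 5 1≤x)))) ⟩
      2 ^ (5 * x) * (y * y)     ≡⟨ cong (2 ^ (5 * x) *_) (^-distribˡ-+-* 2 x x) ⟨
      2 ^ (5 * x) * 2 ^ (x + x) ≡⟨ cong (λ m → 2 ^ (5 * x) * 2 ^ (x + m)) (+-identityʳ x) ⟨
      2 ^ (5 * x) * 2 ^ (2 * x) ≡⟨ 7x≡ 5 2 refl ⟩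
      2 ^ (7 * x)               ∎
      where open ≤-Reasoning

  -- The colours are charged to `2 ^ (4 * x)` and the atoms to `2 ^ (3 * x)`. The sizes come to 19
  -- y² with y = `2 ^ x`; there 5x pays for the constant and 2x for the square.
  seed : Seed {ω} v n (7 * x)
  seed = record
    { 3≤L     = ≤-trans (≤ᵇ⇒≤ 3 7 tt) (≤-trans (≤-reflexive (sym (*-identityʳ 7))) (*-monoʳ-≤ 7 1≤x))
    ; colors≤ = ≤-trans ω^v≤ (2^-mono (m≤n*m x 7))
    ; bits≤   = 2^-mono (≤-trans n≤3x (*-monoˡ-≤ x (≤ᵇ⇒≤ 3 7 tt)))
    ; atomic≤ = ≤-trans (*-mono-≤ (≤-trans ω^v≤ (2^-mono (m≤n*m x 4))) (2^-mono n≤3x)) (≤-reflexive (7x≡ 4 3 refl))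
    ; size≤   = size≤ }
    where
    size≤ : suc (suc (v * suc (suc (ω + ω))) + suc (n * 4)) ≤ 2 ^ (7 * x)
    size≤ = begin
      suc (suc (v * suc (suc (ω + ω))) + suc (n * 4))
        ≤⟨ s≤s (+-mono-≤ (s≤s (*-mono-≤ v≤y (s≤s (s≤s (+-mono-≤ ω≤y ω≤y))))) (s≤s (*-monoˡ-≤ 4 n≤3y))) ⟩
      suc (suc (y * suc (suc (y + y))) + suc (3 * y * 4))
        ≡⟨ ring y ⟩
      3 + 14 * y + 2 * (y * y)
        ≤⟨ +-monoˡ-≤ (2 * (y * y)) (+-mono-≤ {3} {3 * (y * y)} (*-monoʳ-≤ 3 (≤-trans 1≤y y≤yy)) (*-monoʳ-≤ 14 y≤yy)) ⟩
      3 * (y * y) + 14 * (y * y) + 2 * (y * y)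
        ≡⟨ ring′ (y * y) ⟩
      19 * (y * y)
        ≤⟨ k*yy≤ (≤ᵇ⇒≤ 19 32 tt) ⟩
      2 ^ (7 * x) ∎
      where
      open ≤-Reasoning
      v≤y = ≤-trans v≤q (≤-trans q≤x (n≤2^n x))
      n≤3y = ≤-trans n≤3x (*-monoʳ-≤ 3 (n≤2^n x))
      ring : ∀ y → suc (suc (y * suc (suc (y + y))) + suc (3 * y * 4)) ≡ 3 + 14 * y + 2 * (y * y)
      ring = solve-∀
      ring′ : ∀ z → 3 * z + 14 * z + 2 * z ≡ 19 * z
      ring′ = solve-∀

  private
    ℓ = growth (7 * x) q

    2^7x≤ℓ : 2 ^ (7 * x) ≤ ℓ
    2^7x≤ℓ = go q (≤-trans 1≤v v≤q)
      where
      go : ∀ j → 1 ≤ j → 2 ^ (7 * x) ≤ growth (7 * x) j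
      go (suc zero)    _ = 2^growth≤ seed 0
      go (suc (suc j)) _ = ≤-trans (go (suc j) (s≤s z≤n)) (growth-suc seed (suc j))

  x≤ℓ : x ≤ ℓ
  x≤ℓ = ≤-trans (n≤2^n x) (≤-trans (2^-mono (m≤n*m x 7)) 2^7x≤ℓ)

  1≤ℓ′ : 1 ≤ ℓ
  1≤ℓ′ = ≤-trans 1≤x x≤ℓ

  -- The value of `B`. It is quadratic because pairs of types are joined. The coefficients in the
  -- budget sum to at most 400, and 1024 is a power of two above that.
  capacity : ℕ
  capacity = 1024 * (ℓ * ℓ)

  private
    z = ℓ * ℓ

    ℓ≤z : ℓ ≤ z
    ℓ≤z = m≤n*m ℓ ℓ {{>-nonZero 1≤ℓ′}}

    constant : ∀ k → k ≤ k * z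
    constant k = ≤-trans (≤-reflexive (sym (*-identityʳ k))) (*-monoʳ-≤ k (≤-trans 1≤ℓ′ ℓ≤z))

    fits-capacity : ∀ {m} a b c → m ≡ a + b * ℓ + c * z → T (a + b + c ≤ᵇ 1024) → m ≤ capacity
    fits-capacity a b c refl h = begin
      a + b * ℓ + c * z          ≤⟨ +-monoˡ-≤ (c * z) (+-mono-≤ (constant a) (*-monoʳ-≤ b ℓ≤z)) ⟩
      a * z + b * z + c * z      ≡⟨ cong (_+ c * z) (*-distribʳ-+ z a b) ⟨
      (a + b) * z + c * z        ≡⟨ *-distribʳ-+ z (a + b) c ⟨
      (a + b + c) * z            ≤⟨ *-monoˡ-≤ z (≤ᵇ⇒≤ (a + b + c) 1024 h) ⟩
      capacity                   ∎
      where open ≤-Reasoning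

  64≤capacity : 64 ≤ capacity
  64≤capacity = fits-capacity 64 0 0 refl tt

  budget : Budget ℓ capacity ω
  budget = record
    { 0<ω′      = 0<ω
    ; color≤    = ≤-trans (≤-trans (+-mono-≤ (≤-trans 1≤y y≤yy) (+-mono-≤ (≤-trans ω≤y y≤yy) (≤-trans ω≤y y≤yy)))
                    (≤-reflexive (ring (y * y)))) (≤-trans (k*yy≤ (≤ᵇ⇒≤ 3 32 tt)) 2^7x≤ℓ)
    ; ω*ω≤      = ≤-trans (*-mono-≤ ω≤y ω≤y) (≤-trans (≤-trans (≤-reflexive (sym (*-identityˡ (y * y)))) (k*yy≤ (≤ᵇ⇒≤ 1 32 tt))) 2^7x≤ℓ)
    ; 2+ℓ≤B     = fits-capacity 2 1 0 (ring₁ ℓ) tt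
    ; square≤B  = fits-capacity 1 2 1 (ring₂ ℓ) tt
    ; compare≤B = fits-capacity 272 128 0 (ring₃ ℓ) tt }
    where
    ring : ∀ z → z + (z + z) ≡ 3 * z
    ring = solve-∀
    ring₁ : ∀ ℓ → 2 + ℓ ≡ 2 + 1 * ℓ + 0 * (ℓ * ℓ)
    ring₁ = solve-∀
    ring₂ : ∀ ℓ → suc ℓ * suc ℓ ≡ 1 + 2 * ℓ + 1 * (ℓ * ℓ)
    ring₂ = solve-∀
    ring₃ : ∀ ℓ → 64 * (4 + (ℓ + ℓ)) + 16 ≡ 272 + 128 * ℓ + 0 * (ℓ * ℓ)
    ring₃ = solve-∀

  -- Base at most `2 ^ (12 * ℓ)`, where 12 = 10 + 2 comes from 1024 and ℓ², and exponent at most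
  -- `e * ℓ`: the running time has a square of ℓ in its exponent.
  capacity^≤ : ∀ {e d} → d ≤ e * ℓ → capacity ^ d ≤ 2 ^ (12 * e * z)
  capacity^≤ {e} {d} d≤ = begin
    capacity ^ d               ≤⟨ ^-monoʳ-≤ capacity {{>-nonZero (≤-trans (s≤s z≤n) 64≤capacity)}} d≤ ⟩
    capacity ^ (e * ℓ)         ≤⟨ ^-monoˡ-≤ (e * ℓ) capacity≤ ⟩
    (2 ^ (12 * ℓ)) ^ (e * ℓ)   ≡⟨ ^-*-assoc 2 (12 * ℓ) (e * ℓ) ⟩
    2 ^ (12 * ℓ * (e * ℓ))     ≡⟨ cong (2 ^_) ([m*n]*[o*p]≡[m*o]*[n*p] 12 ℓ e ℓ) ⟩
    2 ^ (12 * e * z)           ∎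
    where
    open ≤-Reasoning
    capacity≤ : capacity ≤ 2 ^ (12 * ℓ)
    capacity≤ = begin
      1024 * (ℓ * ℓ)                     ≤⟨ *-mono-≤ (2^-mono {10} {10 * ℓ} (≤-trans (≤-reflexive (sym (*-identityʳ 10))) (*-monoʳ-≤ 10 1≤ℓ′)))
                                                    (*-mono-≤ (n≤2^n ℓ) (n≤2^n ℓ)) ⟩
      2 ^ (10 * ℓ) * (2 ^ ℓ * 2 ^ ℓ)     ≡⟨ cong (2 ^ (10 * ℓ) *_) (^-distribˡ-+-* 2 ℓ ℓ) ⟨
      2 ^ (10 * ℓ) * 2 ^ (ℓ + ℓ)         ≡⟨ ^-distribˡ-+-* 2 (10 * ℓ) (ℓ + ℓ) ⟨
      2 ^ (10 * ℓ + (ℓ + ℓ))             ≡⟨ cong (2 ^_) (ring ℓ) ⟩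
      2 ^ (12 * ℓ)                       ∎
      where ring : ∀ ℓ → 10 * ℓ + (ℓ + ℓ) ≡ 12 * ℓ
            ring = solve-∀

  -- 750 = 200 + 100 + 50 * 4 + 250, where the 4 is one share of `x` for the variables and three for
  -- the atoms.
  degrees≤ : 200 + (100 * q + (50 * (v + n) + 250)) ≤ 750 * ℓ
  degrees≤ = begin
    200 + (100 * q + (50 * (v + n) + 250))
      ≤⟨ +-mono-≤ (k≤kx 200) (+-mono-≤ (*-monoʳ-≤ 100 q≤x) (+-mono-≤ (*-monoʳ-≤ 50 (+-mono-≤ (≤-trans v≤q q≤x) n≤3x)) (k≤kx 250))) ⟩
    200 * x + (100 * x + (50 * (x + 3 * x) + 250 * x))
      ≡⟨ ring x ⟩
    750 * x
      ≤⟨ *-monoʳ-≤ 750 x≤ℓ ⟩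
    750 * ℓ ∎
    where
    open ≤-Reasoning
    k≤kx : ∀ k → k ≤ k * x
    k≤kx k = ≤-trans (≤-reflexive (sym (*-identityʳ k))) (*-monoʳ-≤ k 1≤x)
    ring : ∀ x → 200 * x + (100 * x + (50 * (x + 3 * x) + 250 * x)) ≡ 750 * x
    ring = solve-∀

-- The core

length-row : ∀ {A : Set} (g : Tree → A) ys as → length (rowₗ g ys as) ≡ len ys + length as
length-row g nil      as = refl
length-row g (y ∙ ys) as = trans (length-row g ys (g y ∷ as)) (+-suc (len ys) (length as))

length-pairs : ∀ {A : Set} (g : Tree → Tree → A) xs ys as →
               length (pairsₗ g xs ys as) ≡ len xs * len ys + length as
length-pairs g nil      ys as = refl
length-pairs g (x ∙ xs) ys as = trans (length-pairs g xs ys (rowₗ (g x) ys as))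
  (trans (cong (len xs * len ys +_) (length-row (g x) ys as)) (ring (len xs * len ys) (len ys) (length as)))
  where ring : ∀ a b c → a + (b + c) ≡ b + a + c
        ring = solve-∀

abstract
  -- 12 comes from the base in `capacity^≤` and 750 from `degrees≤`. It is abstract so that the
  -- numeral does not unfold.
  exponent : ℕ
  exponent = 12 * 750

  exponent≡ : 12 * 750 ≡ exponent
  exponent≡ = refl

  4≤exponent : 4 ≤ exponent
  4≤exponent = ≤ᵇ⇒≤ 4 exponent tt

-- The additional 4 pays for the nine copies of the power in `total≤`, since 9 ≤ 2 ^ 4, and also
-- covers the 4 ℓ² words of a process set.
factor : ℕ
factor = 4 + exponent

-- 42 = 6 * 7: the 7 of `seed` times the 6 in the base case of `growth≤tower`.
constant : ℕ
constant = factor + 42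

square≤tower : ∀ {x} q → 1 ≤ q → 1 ≤ x → factor * (growth (7 * x) q * growth (7 * x) q) ≤ tower q (constant * x)
square≤tower {x} (suc j) _ 1≤x =
  proj₁ (growth≤tower {factor} {7 * x} {constant * x} (+-monoʳ-≤ 4 4≤exponent)
    (≤-trans (≤ᵇ⇒≤ 3 7 tt) (≤-trans (≤-reflexive (sym (*-identityʳ 7))) (*-monoʳ-≤ 7 1≤x)))
    (start factor) j)
  where
  start : ∀ K → K + 6 * (7 * x) ≤ (K + 42) * x
  start K = begin
    K + 6 * (7 * x)   ≤⟨ +-monoˡ-≤ (6 * (7 * x)) (≤-trans (≤-reflexive (sym (*-identityʳ K))) (*-monoʳ-≤ K 1≤x)) ⟩
    K * x + 6 * (7 * x) ≡⟨ cong (K * x +_) (*-assoc 6 7 x) ⟨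
    K * x + 42 * x    ≡⟨ *-distribʳ-+ x K 42 ⟨
    (K + 42) * x      ∎
    where open ≤-Reasoning

-- The costs of starting and finishing are charged to the nodes, of which there is at least one.
total≤ : ∀ {N S A F E z} → 1 ≤ N → 1 ≤ z → S ≤ 2 ^ (E * z) → A ≤ 2 ^ (E * z) → F ≤ 2 ^ (E * z) →
         N * (S + 2) + 2 + (A + F + 2) ≤ N * 2 ^ ((4 + E) * z)
total≤ {N} {S} {A} {F} {E} {z} 1≤N 1≤z S≤ A≤ F≤ = begin
  N * (S + 2) + 2 + (A + F + 2)          ≤⟨ +-mono-≤ (+-monoˡ-≤ 2 (*-monoʳ-≤ N (+-monoˡ-≤ 2 S≤))) (+-monoˡ-≤ 2 (+-mono-≤ A≤ F≤)) ⟩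
  N * (X + 2) + 2 + (X + X + 2)          ≡⟨ ring N X ⟩
  N * (X + 2) + 1 * (X + X + 4)          ≤⟨ +-monoʳ-≤ (N * (X + 2)) (*-monoˡ-≤ (X + X + 4) 1≤N) ⟩
  N * (X + 2) + N * (X + X + 4)          ≡⟨ *-distribˡ-+ N (X + 2) (X + X + 4) ⟨
  N * (X + 2 + (X + X + 4))              ≤⟨ *-monoʳ-≤ N (+-mono-≤ (+-monoʳ-≤ X (*-monoʳ-≤ 2 1≤X)) (+-monoʳ-≤ (X + X) (*-monoʳ-≤ 4 1≤X))) ⟩
  N * (X + 2 * X + (X + X + 4 * X))      ≡⟨ cong (N *_) (ring′ X) ⟩
  N * (9 * X)                            ≤⟨ *-monoʳ-≤ N (*-monoˡ-≤ X (≤-trans (≤ᵇ⇒≤ 9 16 tt) (2^-mono {4} {4 * z} (≤-trans (≤-reflexive (sym (*-identityʳ 4))) (*-monoʳ-≤ 4 1≤z))))) ⟩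
  N * (2 ^ (4 * z) * X)                  ≡⟨ cong (N *_) (^-distribˡ-+-* 2 (4 * z) (E * z)) ⟨
  N * 2 ^ (4 * z + E * z)                ≡⟨ cong (λ m → N * 2 ^ m) (*-distribʳ-+ z 4 E) ⟨
  N * 2 ^ ((4 + E) * z)                  ∎
  where
  open ≤-Reasoning
  X = 2 ^ (E * z)
  1≤X : 1 ≤ X
  1≤X = m^n>0 2 (E * z)
  ring : ∀ N X → N * (X + 2) + 2 + (X + X + 2) ≡ N * (X + 2) + 1 * (X + X + 4)
  ring = solve-∀
  ring′ : ∀ X → X + 2 * X + (X + X + 4 * X) ≡ 9 * X
  ring′ = solve-∀

1≤#nodes : ∀ {ω} (D : Decomp ω) → 1 ≤ #nodes D
1≤#nodes (intro a)        = s≤s z≤n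
1≤#nodes (t₁ ⊕ t₂)        = ≤-trans (1≤#nodes t₁) (≤-trans (≤-reflexive (sym (List.length-map left (nodes t₁))))
  (≤-trans (m≤m+n (length (map left (nodes t₁))) _) (≤-reflexive (sym (List.length-++ (map left (nodes t₁)))))))
1≤#nodes (recolor t a b)  = ≤-trans (m≤n+m 1 (length (map inRec (nodes t)))) (≤-reflexive (sym (List.length-++ (map inRec (nodes t)))))
1≤#nodes (addEdges t a b) = ≤-trans (m≤n+m 1 (length (map inAdd (nodes t)))) (≤-reflexive (sym (List.length-++ (map inAdd (nodes t)))))

module _ (p : Prefix 0 1) (1≤v : 1 ≤ #vertices p) (v≤q : #vertices p ≤ #levels p) (s≤q : #sets p ≤ #levels p) where

  private
    q = #levels p

    measure : ℕ → ℕ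
    measure ω = #vertices p * (q + ⌈log₂ ω ⌉)

  module _ {ω : ℕ} (0<ω : 0 < ω) where

    private
      ℓ = growth (7 * measure ω) q
      z = ℓ * ℓ

      top : TopTame p ℓ ω
      top = topTame (seed 0<ω 1≤v v≤q s≤q) p refl refl

      1≤z : 1 ≤ z
      1≤z = *-mono-≤ {1} {ℓ} {1} {ℓ} (1≤ℓ′ 0<ω 1≤v v≤q s≤q) (1≤ℓ′ 0<ω 1≤v v≤q s≤q)

      z≤tower : factor * z ≤ tower q (constant * measure ω)
      z≤tower = square≤tower q (≤-trans 1≤v v≤q) (1≤x 0<ω 1≤v v≤q s≤q)

      len-states≤ : len (states p {ω}) ≤ 2 * ℓ
      len-states≤ = ≤-trans (≤-reflexive (trans (len-pairs {_∙_} bools (univ p true ω) nil) (+-identityʳ _)))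
                            (*-monoʳ-≤ 2 (TopTame.len≤ top))

      four≤ : 4 * z ≤ tower q (constant * measure ω)
      four≤ = ≤-trans (*-monoˡ-≤ z (m≤m+n 4 exponent)) z≤tower

      0<ℓ : 1 ≤ ℓ
      0<ℓ = 1≤ℓ′ 0<ω 1≤v v≤q s≤q

      -- At most two children with at most 2 ℓ states each give 4 ℓ² words, so the size bound rests
      -- on the same square as the time bound.
      pairs≤ : ∀ {A : Set} (g : Tree → Tree → A) ys → len ys ≤ 2 * ℓ →
               length (pairsₗ g (states p {ω}) ys []) ≤ tower q (constant * measure ω)
      pairs≤ g ys ys≤ = ≤-trans (≤-reflexive (trans (length-pairs g (states p) ys []) (+-identityʳ _)))
        (≤-trans (*-mono-≤ len-states≤ ys≤) (≤-trans (≤-reflexive ([m*n]*[o*p]≡[m*o]*[n*p] 2 ℓ 2 ℓ)) four≤))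

      singleton≤ : len (nil ∙ nil) ≤ 2 * ℓ
      singleton≤ = ≤-trans 0<ℓ (m≤n*m ℓ 2)

    length-process : ∀ (D : Decomp ω) F n → length (processᴰ p D F n) ≤ tower q (constant * measure ω)
    length-process (intro a)        F root      = ≤-trans (≤-trans (≤ᵇ⇒≤ 2 4 tt) (*-monoʳ-≤ 4 1≤z)) four≤
    length-process (t₁ ⊕ t₂)        F root      = pairs≤ (binaryWord p {ω} (plainEnv p {ω} F)) (states p) len-states≤
    length-process (t₁ ⊕ t₂)        F (left n)  = length-process t₁ F n
    length-process (t₁ ⊕ t₂)        F (right n) = length-process t₂ F n
    length-process (recolor t a b)  F root      = pairs≤ (unaryWord p {ω} (recolorEnv p a b F)) (nil ∙ nil) singleton≤
    length-process (recolor t a b)  F (inRec n) = length-process t _ n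
    length-process (addEdges t a b) F root      = pairs≤ (unaryWord p {ω} (addEdgesEnv p a b F)) (nil ∙ nil) singleton≤
    length-process (addEdges t a b) F (inAdd n) = length-process t _ n

    main-time : ∀ (D : Decomp ω) →
      main p ⊢ encInput D ⇓ encOutput D (acceptᴰ p {ω}) (processᴰ p D nil)
        within #nodes D * tower (suc q) (constant * measure ω)
    main-time D = within-mono
      (≤-trans (total≤ {E = exponent} {z} (1≤#nodes D) 1≤z (cap (deg-step p)) (cap (deg-start p)) (cap (deg-finish p)))
               (*-monoʳ-≤ (#nodes D) (2^-mono z≤tower)))
      (main-exec p (budget 0<ω 1≤v v≤q s≤q) top (64≤capacity 0<ω 1≤v v≤q s≤q) D)
      where
      cap : ∀ {d} → d ≤ 200 + degBound p → capacity 0<ω 1≤v v≤q s≤q ^ d ≤ 2 ^ (exponent * z)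
      cap {d} d≤ = subst (λ E → capacity 0<ω 1≤v v≤q s≤q ^ d ≤ 2 ^ (E * z)) exponent≡
        (capacity^≤ 0<ω 1≤v v≤q s≤q {750} (≤-trans d≤ (degrees≤ 0<ω 1≤v v≤q s≤q)))

  core : Core
  core = record
    { program = main p
    ; accept  = λ {ω} _ → acceptᴰ p {ω}
    ; process = λ D → processᴰ p D nil
    ; τ       = λ D → proj₁ (main-time (0<width D) D)
    ; runs    = λ D → proj₂ (proj₂ (main-time (0<width D) D)) }

  core-τ : ∀ {ω} (D : Decomp ω) → τ core D ≤ #nodes D * tower (suc q) (constant * measure ω)
  core-τ D = proj₁ (proj₂ (main-time (0<width D) D))

  core-Size : ∀ {ω} (D : Decomp ω) → Size core D ≤ tower q (constant * measure ω)
  core-Size D = max≤v⁺ z≤n (All.map⁺ (All.universal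
    (λ n → ≤-trans (List.length-deduplicate (Core._≟_ core) (processᴰ p D nil n)) (length-process (0<width D) D nil n)) (nodes D)))

1≤#individual : ∀ {s} {φ : Formula 0 s} → Prenex φ → 1 ≤ #individual φ
1≤#individual (matrix a) = ⊥-elim (no-closed-matrix a)
1≤#individual (∃v a)     = s≤s z≤n
1≤#individual (∀v a)     = s≤s z≤n
1≤#individual (∃s a)     = 1≤#individual a
1≤#individual (∀s a)     = 1≤#individual a

theorem10 : ∃[ c ] ((P : VertexProblem) (Φ : Formula 0 1) → Prenex Φ → Φ Expresses P →
    ∃[ C ] ∃[ ρ ] (Solves C ρ P ×
    (∀ {ω : ℕ} (D : Decomp ω) →
    τ C D ≤ #nodes D * tower (suc (#quantified Φ)) (c * parameter Φ ω) ×
    Size C D ≤ tower (#quantified Φ) (c * parameter Φ ω))))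
theorem10 = constant , λ P Φ a expresses →
  let p   = prefix a
      v≡  = trans (#vertices-prefix a) (+-identityʳ (#individual Φ))
      s≡  = trans (#sets-prefix a) (+-comm (#set Φ) 1)
      q≡  = #levels-prefix a
      1≤v = ≤-trans (1≤#individual a) (≤-reflexive (sym v≡))
      v≤q = subst₂ _≤_ (sym v≡) (sym q≡) (m≤m+n (#individual Φ) (#set Φ))
      -- The free set variable counts as one further set variable; it is paid for by the individual
      -- quantifier that must be present.
      s≤q = subst₂ _≤_ (sym s≡) (sym q≡) (+-monoˡ-≤ (#set Φ) (1≤#individual a))
      C   = core p 1≤v v≤q s≤q
  in C , bitOf ,
     (λ G D iso S →
        let open Equivalence (accepts-iff iso a S) renaming (to to accepted; from to accepted⁻) in
        mk⇔ (λ h → let α , (l , g) , m = accepted (⇒ (expresses G S) h) in α , record { local = l ; global = g } , m)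
            (λ { (α , w , m) → ⇐ (expresses G S) (accepted⁻ (α , (Witness.local w , Witness.global w) , m)) })) ,
     λ {ω} D →
       subst₂ (λ v q → τ C D ≤ #nodes D * tower (suc q) (constant * (v * (q + ⌈log₂ ω ⌉)))) v≡ q≡ (core-τ p 1≤v v≤q s≤q D) ,
       subst₂ (λ v q → Size C D ≤ tower q (constant * (v * (q + ⌈log₂ ω ⌉)))) v≡ q≡ (core-Size p 1≤v v≤q s≤q D)
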